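{- Let $a$ be any integer and let $n$ be a positive odd integer. Then, for indeterminates $x$ and $q$ (equivalently, for all complex $x$ and all nonzero complex $q$), $$\det\left[x+q^{\lfloor \frac{aj-(a+1)k}{n}\rfloor}\right]_{1\leqslant j,k\leqslant n}=\left(\frac{a(a+1)}{n}\right)q^{(1-3n)/2}(1-q)^{n-1}(1+qx)$$ and $$\det\left[x+q^{\lceil \frac{(a+1)j-ak}{n}\rceil}\right]_{1\leqslant j,k\leqslant n}=\left(\frac{a(a+1)}{n}\right)q^{(n-1)/2}(1-q)^{n-1}(x+q).$$
   Context: $\lfloor x\rfloor$ is the largest integer not exceeding $x$ and $\lceil x\rceil$ is the least integer not smaller than $x$. $\left(\frac{\cdot}{n}\right)$ denotes the Jacobi symbol modulo the positive odd integer $n$ (equal to $0$ when the argument is not coprime to $n$, and $\left(\frac{\cdot}{1}\right)=1$). -}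

module Defs where

open import Algebra.Bundles using (CommutativeRing; Semiring)
open import Data.Fin.Base as Fin using (Fin; toℕ; punchIn)
open import Data.Fin.Properties using (any?)
open import Data.Integer.Base as ℤ using (ℤ; +_; -[1+_]; 0ℤ; 1ℤ; -1ℤ)
open import Data.Integer.Divisibility.Signed using (_∣_; _∣?_)
open import Data.List.Base using (foldr; map)
open import Data.Nat.Base as ℕ using (ℕ; zero; suc; NonZero)
open import Data.Nat.Primality.Factorisation using (factorise; factors)
open import Data.Product.Base using (∃-syntax)
open import Relation.Nullary.Decidable using (Dec; yes; no)

-- Solvability of y² ≡ a (mod p); it suffices to look for y in {0, …, p-1}.
IsSquareMod : ℕ → ℤ → Set
IsSquareMod p a = ∃[ y ] + p ∣ (+ toℕ {p} y ℤ.* + toℕ y ℤ.- a)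

isSquareMod? : ∀ p a → Dec (IsSquareMod p a)
isSquareMod? p a = any? λ y → + p ∣? (+ toℕ y ℤ.* + toℕ y ℤ.- a)

-- Only meaningful when p is an odd prime.
legendre : ℤ → ℕ → ℤ
legendre a p with + p ∣? a | isSquareMod? p a
... | yes _ | _     = 0ℤ
... | no  _ | yes _ = 1ℤ
... | no  _ | no  _ = -1ℤ

-- The product runs over the prime factors of n with multiplicity.
jacobi : ℤ → (n : ℕ) .{{_ : NonZero n}} → ℤ
jacobi a n = foldr ℤ._*_ 1ℤ (map (legendre a) (factors (factorise n)))

module OverRing {c ℓ} (R : CommutativeRing c ℓ) where

  open CommutativeRing R
  open import Algebra.Definitions.RawSemiring (Semiring.rawSemiring semiring) using (_×_; _^_; sum) public

  fromℤ : ℤ → Carrier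
  fromℤ (+ m)    = m × 1#
  fromℤ -[1+ m ] = - (suc m × 1#)

  -- u and v are meant to be mutually inverse: zpow u v z is the power u ^ z.
  zpow : (u v : Carrier) → ℤ → Carrier
  zpow u v (+ m)    = u ^ m
  zpow u v -[1+ m ] = v ^ suc m

  -- Cofactor expansion along the first row.
  det : ∀ {n} → (Fin n → Fin n → Carrier) → Carrier
  det {zero}  M = 1#
  det {suc n} M = sum λ k →
    (- 1#) ^ toℕ k * (M Fin.zero k * det λ i j → M (Fin.suc i) (punchIn k j))

{-# OPTIONS --safe #-}
-- Write a j = r + n u and (a + 1) k = s + n v with 0 ≤ r, s < n.  Then ⌊(a j - (a + 1) k) / n⌋ = u - v - [r < s],
-- so after sorting the rows by r and the columns by s and pulling out the factors q^u and q^(-v), the matrix becomes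
-- x q^(-u_r) q^(v_s) + T_rs, where T has entries 1 on and below the diagonal and q⁻¹ above it.
-- Subtracting from each row the previous one turns T into a multiple of the identity, and what is left is a rank one
-- update, governed by the sum of q^(v_r - u_r) - q^(v_r - u_(r-1)) over the residues r taken cyclically.
-- That sum telescopes to q - 1: if row j meets column k on the diagonal, row j + 1 meets column k + 1 just below it.
--
-- The sorting costs the signs of multiplication by a and by a + 1 on ℤ/n, whose product is the Jacobi symbol of
-- a (a + 1) by Zolotarev's lemma.  For a prime modulus and a nonresidue b, that lemma follows by comparing the
-- involutions y ↦ 1/y, which fixes ±1, and y ↦ b/y, which has no fixed point.
--
-- If an (odd) prime p divides n and a, the rows 1, 1 + n/p, 1 + 2n/p lie in the span of two vectors, so the
-- determinant vanishes.  Transposition exchanges a and -(a + 1), and also reduces the second identity to the first.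
module Submission where

open import Defs
open import Algebra.Bundles using (CommutativeRing; Semiring)
import Algebra.Solver.Ring
import Algebra.Solver.Ring.AlmostCommutativeRing as ACR
open import Data.Bool.Base using (if_then_else_)
open import Data.Empty using (⊥-elim)
open import Data.Fin.Base as Fin using (Fin; toℕ; punchIn)
import Data.Fin.Properties as Fin
open import Data.Integer.Base as ℤ using (ℤ; +_; -[1+_]; 0ℤ; 1ℤ; -1ℤ; _◃_; _%ℕ_; _/ℕ_)
open import Data.Integer.Divisibility.Signed using (_∣_; _∣?_; divides; ∣⇒∣ᵤ; ∣ᵤ⇒∣; ∣m∣n⇒∣m+n; ∣m⇒∣-m; ∣n⇒∣m*n; ∣m⇒∣m*n; *-cancelˡ-∣; *-monoʳ-∣; ∣-trans)
import Data.Integer.DivMod as ℤ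
import Data.Integer.Properties as ℤ
open import Data.Integer.Tactic.RingSolver using (solve-∀)
open import Data.List.Base using (List; []; _∷_; _++_; [_]; map; length; upTo; applyUpTo; concatMap; foldr; tabulate)
open import Data.List.Membership.Propositional using (_∈_; find)
open import Data.List.Membership.Propositional.Properties using (∈-applyUpTo⁻; ∈-map⁺; ∈-map⁻; ∈-upTo⁺; ∈-upTo⁻; ∈-concat⁺′)
import Data.List.Properties as List
open import Data.List.Relation.Binary.Permutation.Propositional as Perm using (_↭_)
import Data.List.Relation.Binary.Permutation.Propositional.Properties as Perm
open import Data.List.Relation.Binary.Subset.Propositional using (_⊆_)
open import Data.List.Relation.Unary.All as All using (All; []; _∷_)
import Data.List.Relation.Unary.All.Properties as All
open import Data.List.Relation.Unary.AllPairs using ([]; _∷_)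
open import Data.List.Relation.Unary.Any using (Any; here; there; any?)
open import Data.List.Relation.Unary.Unique.Propositional using (Unique)
import Data.List.Relation.Unary.Unique.Propositional.Properties as Unique
open import Data.Maybe.Base using (Maybe; just; nothing)
open import Data.Nat.Base as ℕ using (ℕ; zero; suc; _∸_; NonZero)
import Data.Nat.Divisibility as ℕ∣
import Data.Nat.DivMod as ℕ
open import Data.Nat.ListAction using (product)
open import Data.Nat.ListAction.Properties using (∈⇒∣product)
open import Data.Nat.Primality using (Prime; ¬prime[1]; euclidsLemma; prime⇒nonZero; prime⇒nonTrivial)
open import Data.Nat.Primality.Factorisation using (factorise; factors; module PrimeFactorisation)
import Data.Nat.Properties as ℕ
open import Data.Product.Base as Product using (_,_; proj₁; proj₂; ∃-syntax)
open import Data.Rational.Unnormalised.Base as ℚᵘ using (floor; ceiling)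
open import Data.Sign.Base as Sign using (Sign; opposite)
import Data.Sign.Properties as Sign
open import Data.Sum.Base as Sum using (_⊎_; inj₁; inj₂)
open import Function.Base using (_∘_; id; flip)
open import Relation.Binary.Definitions using (tri<; tri≈; tri>)
open import Relation.Binary.PropositionalEquality as ≡ using (_≡_; _≢_; module ≡-Reasoning)
open import Relation.Nullary.Decidable using (Dec; yes; no; does; dec-true; dec-false)
open import Relation.Nullary.Negation.Core using (¬_)
import Algebra.Properties.AbelianGroup ℤ.+-0-abelianGroup as ℤ+

-- Permutations of lists with their sign

-- The ring `R` is arbitrary: `1# - q` and `2` cannot be cancelled in it, and `1#` may equal `- 1#`.
-- Two choices follow. The row operations never divide: the rank one part arrives with one factor
-- `1# - q⁻¹` too few, and recovers it because the cyclic sum `x * (q - 1#)` equals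
-- `q * x * (1# - q⁻¹)`; this is also the origin of the factor `1# + q * x`. And a sign is not
-- computed from a permutation but carried by its derivation from transpositions; two derivations
-- are compared only inside `R`, through the determinant of the identity matrix. Hence it suffices
-- to relate the sorting maps and the multiplications by `a`, `a + 1` and `a (a + 1)` as maps, and
-- their signs follow.
--
-- Oddness of `n` enters the signs in two ways. Row numbers run from `1` and residues from `0`; the
-- shift between them is an `n`-cycle, which is even. And the passage from primes to composite
-- moduli in Zolotarev's lemma permutes blocks of residues, whose lengths and number have to be odd.

private
  variable
    A B : Set
    x y : A
    xs ys zs : List A
    s t : Sign

infix 4 _↭[_]_

-- The sign belongs to the derivation and counts its swaps. Two derivations between the same lists
-- may carry different signs when entries repeat; for `upTo n` the ambiguity is removed, as far as
-- `R` can see, by `signum-unique`.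
data _↭[_]_ {A : Set} : List A → Sign → List A → Set where
  ↭-refl  : xs ↭[ Sign.+ ] xs
  ↭-prep  : ∀ x → xs ↭[ s ] ys → x ∷ xs ↭[ s ] x ∷ ys
  ↭-swap  : ∀ x y → x ∷ y ∷ xs ↭[ Sign.- ] y ∷ x ∷ xs
  ↭-trans : xs ↭[ s ] ys → ys ↭[ t ] zs → xs ↭[ s Sign.* t ] zs

↭-withSign : s ≡ t → xs ↭[ s ] ys → xs ↭[ t ] ys
↭-withSign ≡.refl p = p

↭-reflexive : xs ≡ ys → xs ↭[ Sign.+ ] ys
↭-reflexive ≡.refl = ↭-refl

↭-respʳ-≡ : ys ≡ zs → xs ↭[ s ] ys → xs ↭[ s ] zs
↭-respʳ-≡ ≡.refl p = p

↭-respˡ-≡ : xs ≡ ys → xs ↭[ s ] zs → ys ↭[ s ] zs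
↭-respˡ-≡ ≡.refl p = p

↭-sym : xs ↭[ s ] ys → ys ↭[ s ] xs
↭-sym ↭-refl        = ↭-refl
↭-sym (↭-prep x p)  = ↭-prep x (↭-sym p)
↭-sym (↭-swap x y)  = ↭-swap y x
↭-sym (↭-trans {s = s} {t = t} p q) = ↭-withSign (Sign.*-comm t s) (↭-trans (↭-sym q) (↭-sym p))

↭-map : (f : A → B) → xs ↭[ s ] ys → map f xs ↭[ s ] map f ys
↭-map f ↭-refl        = ↭-refl
↭-map f (↭-prep x p)  = ↭-prep (f x) (↭-map f p)
↭-map f (↭-swap x y)  = ↭-swap (f x) (f y)
↭-map f (↭-trans p q) = ↭-trans (↭-map f p) (↭-map f q)

↭-unsigned : xs ↭[ s ] ys → xs ↭ ys
↭-unsigned ↭-refl        = Perm.refl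
↭-unsigned (↭-prep x p)  = Perm.prep x (↭-unsigned p)
↭-unsigned (↭-swap x y)  = Perm.swap x y Perm.refl
↭-unsigned (↭-trans p q) = Perm.trans (↭-unsigned p) (↭-unsigned q)

↭-++ˡ : ∀ zs → xs ↭[ s ] ys → zs ++ xs ↭[ s ] zs ++ ys
↭-++ˡ []       p = p
↭-++ˡ (z ∷ zs) p = ↭-prep z (↭-++ˡ zs p)

↭-++ʳ : ∀ zs → xs ↭[ s ] ys → xs ++ zs ↭[ s ] ys ++ zs
↭-++ʳ zs ↭-refl        = ↭-refl
↭-++ʳ zs (↭-prep x p)  = ↭-prep x (↭-++ʳ zs p)
↭-++ʳ zs (↭-swap x y)  = ↭-swap x y
↭-++ʳ zs (↭-trans p q) = ↭-trans (↭-++ʳ zs p) (↭-++ʳ zs q)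

↭-++ : ∀ {ws : List A} → xs ↭[ s ] ys → zs ↭[ t ] ws → xs ++ zs ↭[ s Sign.* t ] ys ++ ws
↭-++ {ys = ys} {zs = zs} p q = ↭-trans (↭-++ʳ zs p) (↭-++ˡ ys q)

parity : ℕ → Sign
parity zero    = Sign.+
parity (suc n) = opposite (parity n)

parity-+ : ∀ m n → parity (m ℕ.+ n) ≡ parity m Sign.* parity n
parity-+ zero    n = ≡.refl
parity-+ (suc m) n = begin
  opposite (parity (m ℕ.+ n))              ≡⟨ ≡.cong opposite (parity-+ m n) ⟩
  Sign.- Sign.* (parity m Sign.* parity n) ≡⟨ Sign.*-assoc Sign.- (parity m) (parity n) ⟨
  opposite (parity m) Sign.* parity n      ∎
  where open ≡-Reasoning

↭-∷-++ : ∀ (x : A) xs ys → x ∷ xs ++ ys ↭[ parity (length xs) ] xs ++ x ∷ ys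
↭-∷-++ x []       ys = ↭-refl
↭-∷-++ x (z ∷ xs) ys = ↭-trans (↭-swap x z) (↭-prep z (↭-∷-++ x xs ys))

∈⇒↭ : x ∈ xs → ∃[ s ] ∃[ ys ] xs ↭[ s ] x ∷ ys
∈⇒↭ {xs = x ∷ xs} (here ≡.refl) = Sign.+ , xs , ↭-refl
∈⇒↭ {xs = z ∷ xs} (there x∈) with s , ys , p ← ∈⇒↭ x∈ = _ , z ∷ ys , ↭-trans (↭-prep z p) (↭-swap z _)

∈-resp : xs ↭[ s ] ys → x ∈ xs → x ∈ ys
∈-resp p = Perm.∈-resp-↭ (↭-unsigned p)

↭-length : xs ↭[ s ] ys → length xs ≡ length ys
↭-length p = Perm.↭-length (↭-unsigned p)

∈-∷⁻ : x ∈ y ∷ ys → x ≢ y → x ∈ ys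
∈-∷⁻ (here x≡y)  x≢y = ⊥-elim (x≢y x≡y)
∈-∷⁻ (there x∈) x≢y = x∈

-- By counting, a list without repetitions exhausts any list of the same length that contains it.
-- The sign stays existential; it gets determined later by comparing compositions.
unique∧⊆⇒↭ : Unique xs → (∀ {x} → x ∈ xs → x ∈ ys) → length xs ≡ length ys → ∃[ s ] xs ↭[ s ] ys
unique∧⊆⇒↭ {xs = []} {ys = []} _ _ _ = Sign.+ , ↭-refl
unique∧⊆⇒↭ {xs = x ∷ xs} {ys = ys} (x∉xs ∷ xs!) xs⊆ys ∣xs∣≡∣ys∣
  with s , ys′ , p ← ∈⇒↭ (xs⊆ys (here ≡.refl))
  with t , q ← unique∧⊆⇒↭ {xs = xs} {ys = ys′} xs!
         (λ z∈ → ∈-∷⁻ (∈-resp p (xs⊆ys (there z∈))) (λ z≡x → All.lookup x∉xs z∈ (≡.sym z≡x)))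
         (ℕ.suc-injective (≡.trans ∣xs∣≡∣ys∣ (↭-length p)))
  = t Sign.* s , ↭-trans (↭-prep x q) (↭-sym p)

map-cong∈ : {f g : A → B} → (∀ {x} → x ∈ xs → f x ≡ g x) → map f xs ≡ map g xs
map-cong∈ eq = List.map-cong-local (All.tabulate eq)

map-unique : {f : A → B} → Unique xs → (∀ {x y} → x ∈ xs → y ∈ xs → f x ≡ f y → x ≡ y) → Unique (map f xs)
map-unique {xs = []} _ _ = []
map-unique {xs = x ∷ xs} {f = f} (x∉xs ∷ xs!) inj =
  All.tabulate (λ y∈ fx≡y → helper y∈ fx≡y) ∷ map-unique xs! (λ p q → inj (there p) (there q))
  where
  helper : ∀ {y} → y ∈ map f xs → ¬ f x ≡ y
  helper y∈ ≡.refl with z , z∈ , eq ← ∈-map⁻ f y∈ = All.lookup x∉xs z∈ (inj (here ≡.refl) (there z∈) eq)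

unique-resp : xs ↭[ s ] ys → Unique xs → Unique ys
unique-resp ↭-refl xs! = xs!
unique-resp (↭-prep x p) (x∉ ∷ xs!) = Perm.All-resp-↭ (↭-unsigned p) x∉ ∷ unique-resp p xs!
unique-resp (↭-swap x y) ((x≢y ∷ x∉) ∷ (y∉ ∷ xs!)) = ((≡.≢-sym x≢y) ∷ y∉) ∷ (x∉ ∷ xs!)
unique-resp (↭-trans p q) xs! = unique-resp q (unique-resp p xs!)

record FreeInvolutionOn (f : A → A) (xs : List A) : Set where
  field
    closed     : ∀ {x} → x ∈ xs → f x ∈ xs
    involutive : ∀ {x} → x ∈ xs → f (f x) ≡ x
    fixedFree  : ∀ {x} → x ∈ xs → f x ≢ x

-- Such an involution is a product of length xs / 2 transpositions.
freeInvolution⇒↭ : ∀ k {xs} (f : A → A) → length xs ℕ.≤ k → Unique xs → FreeInvolutionOn f xs →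
                   ∃[ h ] length xs ≡ h ℕ.+ h Product.× xs ↭[ parity h ] map f xs
freeInvolution⇒↭ _ {[]} f _ _ _ = 0 , ≡.refl , ↭-refl
freeInvolution⇒↭ (suc k) {x ∷ xs} f (ℕ.s≤s ∣xs∣≤k) (x∉xs ∷ xs!) inv =
  step (∈⇒↭ (∈-∷⁻ (closed (here ≡.refl)) (fixedFree (here ≡.refl))))
  where
  open FreeInvolutionOn inv
  sign-eq : ∀ s t → s Sign.* (t Sign.* (Sign.- Sign.* (Sign.+ Sign.* s))) ≡ opposite t
  sign-eq Sign.+ Sign.+ = ≡.refl
  sign-eq Sign.+ Sign.- = ≡.refl
  sign-eq Sign.- Sign.+ = ≡.refl
  sign-eq Sign.- Sign.- = ≡.refl
  step : ∃[ s ] ∃[ ys ] xs ↭[ s ] f x ∷ ys →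
         ∃[ h ] suc (length xs) ≡ h ℕ.+ h Product.× x ∷ xs ↭[ parity h ] map f (x ∷ xs)
  step (s , ys , p) with unique-resp p xs!
  ... | fx∉ys ∷ ys! = finish
    (freeInvolution⇒↭ k f (ℕ.≤-trans (ℕ.n≤1+n _) (≡.subst (ℕ._≤ k) (↭-length p) ∣xs∣≤k)) ys! (record
      { closed     = λ y∈ → ∈-∷⁻ (∈-∷⁻ (∈-resp (↭-prep x p) (closed (∈xs y∈))) (fy≢x y∈)) (fy≢fx y∈)
      ; involutive = λ y∈ → involutive (∈xs y∈)
      ; fixedFree  = λ y∈ → fixedFree (∈xs y∈)
      }))
    where
    ∈xs : ∀ {y} → y ∈ ys → y ∈ x ∷ xs
    ∈xs y∈ = there (∈-resp (↭-sym p) (there y∈))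
    fy≢x : ∀ {y} → y ∈ ys → f y ≢ x
    fy≢x y∈ fy≡x = All.lookup fx∉ys y∈ (≡.trans (≡.cong f (≡.sym fy≡x)) (involutive (∈xs y∈)))
    fy≢fx : ∀ {y} → y ∈ ys → f y ≢ f x
    fy≢fx y∈ fy≡fx = All.lookup x∉xs (∈-resp (↭-sym p) (there y∈))
      (≡.trans (≡.sym (involutive (here ≡.refl))) (≡.trans (≡.cong f (≡.sym fy≡fx)) (involutive (∈xs y∈))))
    finish : ∃[ h ] length ys ≡ h ℕ.+ h Product.× ys ↭[ parity h ] map f ys →
             ∃[ h ] suc (length xs) ≡ h ℕ.+ h Product.× x ∷ xs ↭[ parity h ] map f (x ∷ xs)
    finish (h , ∣ys∣≡2h , q) =
      suc h
      , ≡.trans (≡.cong suc (↭-length p)) (≡.trans (≡.cong (suc ∘ suc) ∣ys∣≡2h) (≡.cong suc (≡.sym (ℕ.+-suc h h))))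
      -- The rearrangement `p` occurs once directly and once, inverted, under `map f`, so its sign
      -- `s` cancels. What remains is the sign of the pairs inside `ys` and one swap of `x` with
      -- `f x`.
      , ↭-withSign (sign-eq s (parity h))
          (↭-trans (↭-prep x p) (↭-trans (↭-prep x (↭-prep (f x) q)) (↭-trans (↭-swap x (f x))
            (↭-trans (↭-reflexive (≡.cong (λ z → f x ∷ z ∷ map f ys) (≡.sym (involutive (here ≡.refl)))))
              (↭-sym (↭-map f (↭-prep x p)))))))

-- Signs of permutations of blocks of odd length

parity-odd-* : ∀ m n → parity n ≡ Sign.- → parity (m ℕ.* n) ≡ parity m
parity-odd-* zero    n _   = ≡.refl
parity-odd-* (suc m) n odd = begin
  parity (n ℕ.+ m ℕ.* n)               ≡⟨ parity-+ n (m ℕ.* n) ⟩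
  parity n Sign.* parity (m ℕ.* n)     ≡⟨ ≡.cong₂ Sign._*_ odd (parity-odd-* m n odd) ⟩
  opposite (parity m)                  ∎
  where open ≡-Reasoning

↭-++-comm : ∀ (xs ys : List A) → xs ++ ys ↭[ parity (length xs ℕ.* length ys) ] ys ++ xs
↭-++-comm []       ys = ↭-reflexive (≡.sym (List.++-identityʳ ys))
↭-++-comm (x ∷ xs) ys = ↭-withSign
  (≡.trans (Sign.*-comm (parity (length xs ℕ.* length ys)) (parity (length ys))) (≡.sym (parity-+ (length ys) (length xs ℕ.* length ys))))
  (↭-trans (↭-prep x (↭-++-comm xs ys)) (↭-∷-++ x ys xs))

-- Exchanging two adjacent blocks of lengths `l` and `l′` takes `l l′` transpositions, an odd number
-- when both lengths are odd. So permuting the blocks has the same sign as permuting their labels.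
↭-concatMap : (f : A → List B) → (∀ x → parity (length (f x)) ≡ Sign.-) →
              xs ↭[ s ] ys → concatMap f xs ↭[ s ] concatMap f ys
↭-concatMap f odd ↭-refl        = ↭-refl
↭-concatMap f odd (↭-prep x p)  = ↭-++ˡ (f x) (↭-concatMap f odd p)
↭-concatMap {xs = _ ∷ _ ∷ xs} f odd (↭-swap x y) =
  ↭-withSign sign-eq (↭-trans (↭-reflexive (≡.sym (List.++-assoc (f x) (f y) _)))
    (↭-trans (↭-++ʳ _ (↭-++-comm (f x) (f y))) (↭-reflexive (List.++-assoc (f y) (f x) _))))
  where
  sign-eq : parity (length (f x) ℕ.* length (f y)) Sign.* Sign.+ ≡ Sign.-
  sign-eq rewrite parity-odd-* (length (f x)) (length (f y)) (odd y) | odd x = ≡.refl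
↭-concatMap f odd (↭-trans p q) = ↭-trans (↭-concatMap f odd p) (↭-concatMap f odd q)

-- Every block contributes `s`, and an odd power of `s` is `s`.
concatMap-↭ : (f g : A → List B) → ∀ xs → (∀ {x} → x ∈ xs → f x ↭[ s ] g x) → parity (length xs) ≡ Sign.- →
              concatMap f xs ↭[ s ] concatMap g xs
concatMap-↭ {s = s} f g xs f↭g odd = ↭-withSign (power≡ s xs odd) (go xs f↭g)
  where
  power : Sign → List _ → Sign
  power s []       = Sign.+
  power s (_ ∷ xs) = s Sign.* power s xs
  power-+ : ∀ xs → power Sign.+ xs ≡ Sign.+
  power-+ []       = ≡.refl
  power-+ (_ ∷ xs) = power-+ xs
  power-- : ∀ xs → power Sign.- xs ≡ parity (length xs)
  power-- []       = ≡.refl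
  power-- (_ ∷ xs) = ≡.cong opposite (power-- xs)
  power≡ : ∀ s xs → parity (length xs) ≡ Sign.- → power s xs ≡ s
  power≡ Sign.+ xs _   = power-+ xs
  power≡ Sign.- xs odd = ≡.trans (power-- xs) odd
  go : ∀ xs → (∀ {x} → x ∈ xs → f x ↭[ s ] g x) → concatMap f xs ↭[ power s xs ] concatMap g xs
  go []       _   = ↭-refl
  go (x ∷ xs) f↭g = ↭-++ (f↭g (here ≡.refl)) (go xs (f↭g ∘ there))

-- Residues and Zolotarev's lemma

∣-resp-≡ : ∀ {k x y} → x ≡ y → k ∣ x → k ∣ y
∣-resp-≡ {k} = ≡.subst (k ∣_)

∣-residue : ∀ n .{{_ : NonZero n}} z → + n ∣ z ℤ.- + (z %ℕ n)
∣-residue n z = divides (z /ℕ n) (≡.trans (≡.cong (ℤ._- + (z %ℕ n)) (ℤ.a≡a%ℕn+[a/ℕn]*n z n)) (lemma (+ (z %ℕ n)) _))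
  where
  lemma : ∀ r q → r ℤ.+ q ℤ.- r ≡ q
  lemma = solve-∀

∣∧∣i∣<⇒≡0 : ∀ {n i} → + n ∣ i → ℤ.∣ i ∣ ℕ.< n → i ≡ 0ℤ
∣∧∣i∣<⇒≡0 {n} {i} n∣i i<n with ℤ.∣ i ∣ in eq | ∣⇒∣ᵤ n∣i
... | zero  | _   = ℤ.∣i∣≡0⇒i≡0 eq
... | suc _ | n∣ = ⊥-elim (ℕ∣.>⇒∤ i<n n∣)

residues-≡ : ∀ {n i j} → i ℕ.< n → j ℕ.< n → + n ∣ + i ℤ.- + j → i ≡ j
residues-≡ {n} {i} {j} i<n j<n n∣i-j =
  ℤ.+-injective (ℤ.i-j≡0⇒i≡j (+ i) (+ j) (∣∧∣i∣<⇒≡0 n∣i-j (ℕ.≤-<-trans bound (ℕ.⊔-lub i<n j<n))))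
  where
  bound : ℤ.∣ + i ℤ.- + j ∣ ℕ.≤ i ℕ.⊔ j
  bound = ≡.subst (ℕ._≤ i ℕ.⊔ j) (≡.cong ℤ.∣_∣ (≡.sym (ℤ.m-n≡m⊖n i j))) (ℤ.∣m⊝n∣≤m⊔n i j)

%ℕ-unique : ∀ n .{{_ : NonZero n}} z {r} → r ℕ.< n → + n ∣ z ℤ.- + r → z %ℕ n ≡ r
%ℕ-unique n z {r} r<n n∣z-r = residues-≡ (ℤ.n%ℕd<d z n) r<n
  (∣-resp-≡ (lemma z (+ (z %ℕ n)) (+ r)) (∣m∣n⇒∣m+n n∣z-r (∣m⇒∣-m (∣-residue n z))))
  where
  lemma : ∀ z w r → (z ℤ.- r) ℤ.+ ℤ.- (z ℤ.- w) ≡ w ℤ.- r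
  lemma = solve-∀

%ℕ-cong : ∀ n .{{_ : NonZero n}} y z → + n ∣ y ℤ.- z → y %ℕ n ≡ z %ℕ n
%ℕ-cong n y z n∣y-z = %ℕ-unique n y (ℤ.n%ℕd<d z n)
  (∣-resp-≡ (lemma y z (+ (z %ℕ n))) (∣m∣n⇒∣m+n n∣y-z (∣-residue n z)))
  where
  lemma : ∀ y z w → (y ℤ.- z) ℤ.+ (z ℤ.- w) ≡ y ℤ.- w
  lemma = solve-∀

%ℕ-small : ∀ n .{{_ : NonZero n}} {i} → i ℕ.< n → + i %ℕ n ≡ i
%ℕ-small n {i} i<n = ℕ.m<n⇒m%n≡m i<n

%ℕ-≡⇒∣ : ∀ n .{{_ : NonZero n}} y z → y %ℕ n ≡ z %ℕ n → + n ∣ y ℤ.- z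
%ℕ-≡⇒∣ n y z eq = ∣-resp-≡ (lemma y z (+ (z %ℕ n)))
  (∣m∣n⇒∣m+n (≡.subst (λ w → + n ∣ y ℤ.- + w) eq (∣-residue n y)) (∣m⇒∣-m (∣-residue n z)))
  where
  lemma : ∀ y z w → (y ℤ.- w) ℤ.+ ℤ.- (z ℤ.- w) ≡ y ℤ.- z
  lemma = solve-∀

mulMod : ℤ → (n : ℕ) .{{_ : NonZero n}} → ℕ → ℕ
mulMod b n i = (b ℤ.* + i) %ℕ n

shiftMod : ℤ → (n : ℕ) .{{_ : NonZero n}} → ℕ → ℕ
shiftMod c n i = (c ℤ.+ + i) %ℕ n

mulMod-∘ : ∀ b c n .{{_ : NonZero n}} i → mulMod b n (mulMod c n i) ≡ mulMod (b ℤ.* c) n i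
mulMod-∘ b c n i = %ℕ-cong n (b ℤ.* + mulMod c n i) (b ℤ.* c ℤ.* + i)
  (∣-resp-≡ (lemma b c (+ i) (+ mulMod c n i)) (∣n⇒∣m*n (ℤ.- b) (∣-residue n (c ℤ.* + i))))
  where
  lemma : ∀ b c i w → ℤ.- b ℤ.* (c ℤ.* i ℤ.- w) ≡ b ℤ.* w ℤ.- b ℤ.* c ℤ.* i
  lemma = solve-∀

mulMod-cong : ∀ {b c} n .{{_ : NonZero n}} → + n ∣ b ℤ.- c → ∀ i → mulMod b n i ≡ mulMod c n i
mulMod-cong {b} {c} n n∣b-c i = %ℕ-cong n (b ℤ.* + i) (c ℤ.* + i) (∣-resp-≡ (lemma b c (+ i)) (∣m⇒∣m*n (+ i) n∣b-c))
  where
  lemma : ∀ b c i → (b ℤ.- c) ℤ.* i ≡ b ℤ.* i ℤ.- c ℤ.* i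
  lemma = solve-∀

-- For n > 0 this says that b is coprime to n.
Cancellative : ℕ → ℤ → Set
Cancellative n b = ∀ {z} → + n ∣ b ℤ.* z → + n ∣ z

mulMod-injective : ∀ {b n} .{{_ : NonZero n}} → Cancellative n b →
                   ∀ {i j} → mulMod b n i ≡ mulMod b n j → + n ∣ + i ℤ.- + j
mulMod-injective {b} {n} cancel {i} {j} eq =
  cancel (∣-resp-≡ (lemma b (+ i) (+ j)) (%ℕ-≡⇒∣ n (b ℤ.* + i) (b ℤ.* + j) eq))
  where
  lemma : ∀ b i j → b ℤ.* i ℤ.- b ℤ.* j ≡ b ℤ.* (i ℤ.- j)
  lemma = solve-∀

mulMod-↭ : ∀ {b n} .{{_ : NonZero n}} → Cancellative n b → ∃[ s ] upTo n ↭[ s ] map (mulMod b n) (upTo n)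
mulMod-↭ {b} {n} cancel = Product.map₂ ↭-sym (unique∧⊆⇒↭
  (map-unique (Unique.upTo⁺ n) (λ i∈ j∈ eq →
    residues-≡ (∈-upTo⁻ i∈) (∈-upTo⁻ j∈) (mulMod-injective {b} cancel eq)))
  residue∈
  (List.length-map (mulMod b n) (upTo n)))
  where
  residue∈ : ∀ {x} → x ∈ map (mulMod b n) (upTo n) → x ∈ upTo n
  residue∈ x∈ with i , _ , ≡.refl ← ∈-map⁻ (mulMod b n) x∈ = ∈-upTo⁺ (ℤ.n%ℕd<d (b ℤ.* + i) n)

-- An injective map of the finite list of residues into itself is onto, so the congruence is solved
-- by counting instead of by Bézout coefficients.
mulMod-surjective : ∀ {b n} .{{_ : NonZero n}} → Cancellative n b →
                    ∀ c → ∃[ i ] i ℕ.< n Product.× + n ∣ b ℤ.* + i ℤ.- c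
mulMod-surjective {b} {n} cancel c =
  solution (∈-map⁻ (mulMod b n) (∈-resp (proj₂ (mulMod-↭ {b} cancel)) (∈-upTo⁺ (ℤ.n%ℕd<d c n))))
  where
  solution : ∃[ i ] i ∈ upTo n Product.× c %ℕ n ≡ mulMod b n i →
             ∃[ i ] i ℕ.< n Product.× + n ∣ b ℤ.* + i ℤ.- c
  solution (i , i∈ , eq) = i , ∈-upTo⁻ i∈ , %ℕ-≡⇒∣ n (b ℤ.* + i) c (≡.sym eq)

upTo-suc : ∀ n → upTo (suc n) ≡ 0 ∷ map suc (upTo n)
upTo-suc n = ≡.cong (0 ∷_) (≡.sym (List.map-upTo suc n))

-- An n-cycle is even when n is odd.
shiftMod-one-↭ : ∀ n .{{_ : NonZero n}} → parity n ≡ Sign.- → upTo n ↭[ Sign.+ ] map (shiftMod 1ℤ n) (upTo n)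
shiftMod-one-↭ n@(suc m) odd = ↭-withSign sign-eq
  (↭-respˡ-≡ (≡.sym (≡.trans (upTo-suc m) (≡.cong (0 ∷_) (≡.sym (List.++-identityʳ _)))))
    (↭-respʳ-≡ rotated (↭-∷-++ 0 (map suc (upTo m)) [])))
  where
  shift-below : ∀ {i} → i ∈ upTo m → suc i ≡ shiftMod 1ℤ n i
  shift-below i∈ = ≡.sym (%ℕ-small n (ℕ.s≤s (∈-upTo⁻ i∈)))
  rotated : map suc (upTo m) ++ [ 0 ] ≡ map (shiftMod 1ℤ n) (upTo n)
  rotated = begin
    map suc (upTo m) ++ [ 0 ]
      ≡⟨ ≡.cong₂ (λ xs y → xs ++ [ y ]) (map-cong∈ shift-below) (≡.sym (ℕ.n%n≡0 n)) ⟩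
    map (shiftMod 1ℤ n) (upTo m) ++ map (shiftMod 1ℤ n) [ m ]
      ≡⟨ List.map-++ (shiftMod 1ℤ n) (upTo m) [ m ] ⟨
    map (shiftMod 1ℤ n) (upTo m ++ [ m ])
      ≡⟨ ≡.cong (map (shiftMod 1ℤ n)) (List.upTo-∷ʳ m) ⟩
    map (shiftMod 1ℤ n) (upTo n) ∎
    where open ≡-Reasoning
  sign-eq : parity (length (map suc (upTo m))) ≡ Sign.+
  sign-eq = ≡.trans (≡.cong parity (≡.trans (List.length-map suc (upTo m)) (List.length-upTo m)))
    (Sign.opposite-injective odd)

shiftMod-↭ : ∀ c n .{{_ : NonZero n}} → parity n ≡ Sign.- → upTo n ↭[ Sign.+ ] map (shiftMod c n) (upTo n)
shiftMod-↭ c n odd = ↭-trans (natural (c %ℕ n)) (↭-reflexive (List.map-cong reduce (upTo n)))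
  where
  reduce : ∀ i → shiftMod (+ (c %ℕ n)) n i ≡ shiftMod c n i
  reduce i = %ℕ-cong n (+ (c %ℕ n) ℤ.+ + i) (c ℤ.+ + i) (∣-resp-≡ (lemma c (+ (c %ℕ n)) (+ i)) (∣m⇒∣-m (∣-residue n c)))
    where
    lemma : ∀ c w i → ℤ.- (c ℤ.- w) ≡ (w ℤ.+ i) ℤ.- (c ℤ.+ i)
    lemma = solve-∀
  next : ∀ k i → shiftMod 1ℤ n (shiftMod (+ k) n i) ≡ shiftMod (+ suc k) n i
  next k i = %ℕ-cong n (1ℤ ℤ.+ + shiftMod (+ k) n i) (+ suc k ℤ.+ + i) (∣-resp-≡ (lemma (+ k) (+ i) (+ shiftMod (+ k) n i)) (∣m⇒∣-m (∣-residue n (+ k ℤ.+ + i))))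
    where
    lemma : ∀ k i w → ℤ.- (k ℤ.+ i ℤ.- w) ≡ (1ℤ ℤ.+ w) ℤ.- (1ℤ ℤ.+ k ℤ.+ i)
    lemma = solve-∀
  natural : ∀ k → upTo n ↭[ Sign.+ ] map (shiftMod (+ k) n) (upTo n)
  natural zero    = ↭-reflexive (≡.trans (≡.sym (List.map-id (upTo n))) (map-cong∈ λ i∈ → ≡.sym (%ℕ-small n (∈-upTo⁻ i∈))))
  natural (suc k) = ↭-trans (shiftMod-one-↭ n odd) (↭-trans (↭-map (shiftMod 1ℤ n) (natural k))
    (↭-reflexive (≡.trans (≡.sym (List.map-∘ (upTo n))) (List.map-cong (next k) (upTo n)))))

euclidsLemmaℤ : ∀ {p} → Prime p → ∀ x y → + p ∣ x ℤ.* y → + p ∣ x ⊎ + p ∣ y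
euclidsLemmaℤ {p} pr x y p∣xy =
  Sum.map ∣ᵤ⇒∣ ∣ᵤ⇒∣ (euclidsLemma ℤ.∣ x ∣ ℤ.∣ y ∣ pr (≡.subst (p ℕ∣.∣_) (ℤ.abs-* x y) (∣⇒∣ᵤ p∣xy)))

prime∤⇒cancellative : ∀ {p b} → Prime p → ¬ + p ∣ b → Cancellative p b
prime∤⇒cancellative pr p∤b {z} p∣bz with euclidsLemmaℤ pr _ z p∣bz
... | inj₁ p∣b = ⊥-elim (p∤b p∣b)
... | inj₂ p∣z = p∣z

sign-*-unit : ∀ s t → (s ◃ 1) ℤ.* (t ◃ 1) ≡ (s Sign.* t) ◃ 1
sign-*-unit Sign.+ Sign.+ = ≡.refl
sign-*-unit Sign.+ Sign.- = ≡.refl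
sign-*-unit Sign.- Sign.+ = ≡.refl
sign-*-unit Sign.- Sign.- = ≡.refl

sign-conjugate : ∀ s t → s Sign.* (t Sign.* s) ≡ t
sign-conjugate Sign.+ Sign.+ = ≡.refl
sign-conjugate Sign.+ Sign.- = ≡.refl
sign-conjugate Sign.- Sign.+ = ≡.refl
sign-conjugate Sign.- Sign.- = ≡.refl

-- Zolotarev's lemma for an odd prime modulus

module ModPrime (p-1 : ℕ) (pr : Prime (suc p-1)) (odd : parity (suc p-1) ≡ Sign.-) where

  private
    p : ℕ
    p = suc p-1

  units : List ℕ
  units = applyUpTo suc p-1

  ∈units⁻ : ∀ {x} → x ∈ units → x ℕ.< p Product.× ¬ + p ∣ + x
  ∈units⁻ x∈ with ∈-applyUpTo⁻ suc x∈
  ... | i , i<p-1 , ≡.refl = ℕ.s≤s i<p-1 , λ p∣x → ℕ∣.>⇒∤ (ℕ.s≤s i<p-1) (∣⇒∣ᵤ p∣x)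

  ∈units⁺ : ∀ {x} → x ℕ.< p → ¬ + p ∣ + x → x ∈ units
  ∈units⁺ x<p p∤x = ∈-∷⁻ (∈-upTo⁺ x<p) λ { ≡.refl → p∤x (divides 0ℤ ≡.refl) }

  units! : Unique units
  units! with _ ∷ u ← Unique.upTo⁺ p = u

  1<p : 1 ℕ.< p
  1<p = ℕ.nonTrivial⇒n>1 p {{prime⇒nonTrivial pr}}

  p∤1 : ¬ + p ∣ 1ℤ
  p∤1 p∣1 = ℕ∣.>⇒∤ 1<p (∣⇒∣ᵤ p∣1)

  -- The condition sits inside the specification so that `quotMod` becomes a total function on
  -- natural numbers, the form in which `freeInvolution⇒↭` takes an involution. The value `0` at
  -- multiples of `p` is a default.
  divideMod : ∀ c x → ∃[ y ] (¬ + p ∣ + x → y ℕ.< p Product.× + p ∣ + x ℤ.* + y ℤ.- c)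
  divideMod c x = by-cases (+ p ∣? + x)
    where
    by-cases : Dec (+ p ∣ + x) → ∃[ y ] (¬ + p ∣ + x → y ℕ.< p Product.× + p ∣ + x ℤ.* + y ℤ.- c)
    by-cases (yes p∣x) = 0 , λ p∤x → ⊥-elim (p∤x p∣x)
    by-cases (no p∤x)  = Product.map₂ (λ spec _ → spec) (mulMod-surjective {+ x} (prime∤⇒cancellative pr p∤x) c)

  quotMod : ℤ → ℕ → ℕ
  quotMod c x = proj₁ (divideMod c x)

  quotMod-spec : ∀ c {x} → ¬ + p ∣ + x → quotMod c x ℕ.< p Product.× + p ∣ + x ℤ.* + quotMod c x ℤ.- c
  quotMod-spec c {x} = proj₂ (divideMod c x)

  quotMod-unique : ∀ c {x y} → ¬ + p ∣ + x → y ℕ.< p → + p ∣ + x ℤ.* + y ℤ.- c → quotMod c x ≡ y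
  quotMod-unique c {x} {y} p∤x y<p xy≡c with z<p , xz≡c ← quotMod-spec c p∤x =
    residues-≡ z<p y<p (prime∤⇒cancellative pr p∤x
      (∣-resp-≡ (lemma (+ x) (+ y) (+ quotMod c x) c) (∣m∣n⇒∣m+n xz≡c (∣m⇒∣-m xy≡c))))
    where
    lemma : ∀ x y z c → (x ℤ.* z ℤ.- c) ℤ.+ ℤ.- (x ℤ.* y ℤ.- c) ≡ x ℤ.* (z ℤ.- y)
    lemma = solve-∀

  quotMod-∤ : ∀ {c x} → ¬ + p ∣ c → ¬ + p ∣ + x → ¬ + p ∣ + quotMod c x
  quotMod-∤ {c} {x} p∤c p∤x p∣z = p∤c
    (∣-resp-≡ (lemma (+ x) (+ quotMod c x) c)
      (∣m∣n⇒∣m+n (∣n⇒∣m*n (+ x) p∣z) (∣m⇒∣-m (proj₂ (quotMod-spec c p∤x)))))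
    where
    lemma : ∀ x z c → x ℤ.* z ℤ.+ ℤ.- (x ℤ.* z ℤ.- c) ≡ c
    lemma = solve-∀

  quotMod-involutive : ∀ {c x} → ¬ + p ∣ c → x ∈ units → quotMod c (quotMod c x) ≡ x
  quotMod-involutive {c} {x} p∤c x∈ with x<p , p∤x ← ∈units⁻ x∈ =
    quotMod-unique c (quotMod-∤ p∤c p∤x) x<p
      (∣-resp-≡ (≡.cong (ℤ._- c) (ℤ.*-comm (+ x) (+ quotMod c x))) (proj₂ (quotMod-spec c p∤x)))

  quotMod-closed : ∀ {c x} → ¬ + p ∣ c → x ∈ units → quotMod c x ∈ units
  quotMod-closed {c} p∤c x∈ with x<p , p∤x ← ∈units⁻ x∈ =
    ∈units⁺ (proj₁ (quotMod-spec c p∤x)) (quotMod-∤ p∤c p∤x)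

  quotMod-fixed : ∀ {c x} → x ∈ units → quotMod c x ≡ x → + p ∣ + x ℤ.* + x ℤ.- c
  quotMod-fixed {c} {x} x∈ fixed = ≡.subst (λ y → + p ∣ + x ℤ.* + y ℤ.- c) fixed (proj₂ (quotMod-spec c (proj₂ (∈units⁻ x∈))))

  -- This is `b / x = b (1 / x)`: multiplication by `b` is what separates the two involutions
  -- compared in `nonsquare⇒odd`.
  mulMod-recip : ∀ b {x} → x ∈ units → quotMod b x ≡ mulMod b p (quotMod 1ℤ x)
  mulMod-recip b {x} x∈ with x<p , p∤x ← ∈units⁻ x∈ =
    quotMod-unique b p∤x (ℤ.n%ℕd<d (b ℤ.* + z) p)
      (∣-resp-≡ (lemma (+ x) b (+ z) (+ mulMod b p z))
        (∣m∣n⇒∣m+n (∣n⇒∣m*n b (proj₂ (quotMod-spec 1ℤ p∤x))) (∣n⇒∣m*n (ℤ.- + x) (∣-residue p (b ℤ.* + z)))))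
    where
    z = quotMod 1ℤ x
    lemma : ∀ x b z w → b ℤ.* (x ℤ.* z ℤ.- 1ℤ) ℤ.+ ℤ.- x ℤ.* (b ℤ.* z ℤ.- w) ≡ x ℤ.* w ℤ.- b
    lemma = solve-∀

  -- A fixed point `x` of `y ↦ b / y` would give `x x ≡ b`.
  nonsquare⇒↭ : ∀ b → ¬ + p ∣ b → ¬ IsSquareMod p b →
                ∃[ h ] length units ≡ h ℕ.+ h Product.× units ↭[ parity h ] map (quotMod b) units
  nonsquare⇒↭ b p∤b nonsquare = freeInvolution⇒↭ _ (quotMod b) ℕ.≤-refl units! record
    { closed     = quotMod-closed p∤b
    ; involutive = quotMod-involutive p∤b
    ; fixedFree  = λ x∈ fixed → nonsquare (isSquare (proj₁ (∈units⁻ x∈)) (quotMod-fixed {b} x∈ fixed))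
    }
    where
    isSquare : ∀ {x} → x ℕ.< p → + p ∣ + x ℤ.* + x ℤ.- b → IsSquareMod p b
    isSquare x<p x²≡b = Fin.fromℕ< x<p , ≡.subst (λ y → + p ∣ + y ℤ.* + y ℤ.- b) (≡.sym (Fin.toℕ-fromℕ< x<p)) x²≡b

  -- Oddness of `p` makes `1` and `-1` two distinct fixed points of inversion.
  p-1≢1 : p-1 ≢ 1
  p-1≢1 p-1≡1 = 2-even (≡.subst (λ r → parity (suc r) ≡ Sign.-) p-1≡1 odd)
    where
    2-even : parity 2 ≢ Sign.-
    2-even ()

  minusOne : ∀ x → + p ∣ x ℤ.+ 1ℤ → + p ∣ x ℤ.- + p-1
  minusOne x p∣x+1 = ∣-resp-≡ (lemma x (+ p-1)) (∣m∣n⇒∣m+n p∣x+1 (divides -1ℤ ≡.refl))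
    where
    lemma : ∀ x r → (x ℤ.+ 1ℤ) ℤ.+ -1ℤ ℤ.* (1ℤ ℤ.+ r) ≡ x ℤ.- r
    lemma = solve-∀

  squareRootOfOne : ∀ {x} → x ℕ.< p → + p ∣ + x ℤ.* + x ℤ.- 1ℤ → x ≡ 1 ⊎ x ≡ p-1
  squareRootOfOne {x} x<p p∣x²-1 =
    Sum.map (residues-≡ x<p 1<p) (residues-≡ x<p ℕ.≤-refl ∘ minusOne (+ x))
      (euclidsLemmaℤ pr (+ x ℤ.- 1ℤ) (+ x ℤ.+ 1ℤ) (∣-resp-≡ (lemma (+ x)) p∣x²-1))
    where
    lemma : ∀ x → x ℤ.* x ℤ.- 1ℤ ≡ (x ℤ.- 1ℤ) ℤ.* (x ℤ.+ 1ℤ)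
    lemma = solve-∀

  1∈units : 1 ∈ units
  1∈units = ∈units⁺ 1<p p∤1

  p-1∈units : p-1 ∈ units
  p-1∈units = ∈units⁺ ℕ.≤-refl λ p∣p-1 →
    p∤1 (∣-resp-≡ (lemma (+ p-1)) (∣m∣n⇒∣m+n (divides 1ℤ (≡.sym (ℤ.*-identityˡ (+ p)))) (∣m⇒∣-m p∣p-1)))
    where
    lemma : ∀ r → (1ℤ ℤ.+ r) ℤ.+ ℤ.- r ≡ 1ℤ
    lemma = solve-∀

  recip-1 : quotMod 1ℤ 1 ≡ 1
  recip-1 = quotMod-unique 1ℤ p∤1 1<p (divides 0ℤ ≡.refl)

  recip-p-1 : quotMod 1ℤ p-1 ≡ p-1
  recip-p-1 = quotMod-unique 1ℤ (proj₂ (∈units⁻ p-1∈units)) ℕ.≤-refl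
    (divides (+ p-1 ℤ.- 1ℤ) (lemma (+ p-1)))
    where
    lemma : ∀ r → r ℤ.* r ℤ.- 1ℤ ≡ (r ℤ.- 1ℤ) ℤ.* (1ℤ ℤ.+ r)
    lemma = solve-∀

  -- Inversion fixes exactly ±1, so it is one transposition short of a free involution.
  recip-↭ : ∃[ h ] length units ≡ suc h ℕ.+ suc h Product.× units ↭[ parity h ] map (quotMod 1ℤ) units
  recip-↭ = step₁ (∈⇒↭ 1∈units)
    where
    ι = quotMod 1ℤ

    step₂ : ∀ {s ys} → units ↭[ s ] 1 ∷ p-1 ∷ ys → Unique (1 ∷ p-1 ∷ ys) →
            ∃[ h ] length units ≡ suc h ℕ.+ suc h Product.× units ↭[ parity h ] map ι units
    step₂ {s} {ys} p₂ ((_ ∷ 1∉) ∷ (p-1∉ ∷ ys!)) = finish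
      (freeInvolution⇒↭ _ ι ℕ.≤-refl ys! record
        { closed     = λ y∈ → ∈-∷⁻ (∈-∷⁻ (∈-resp p₂ (quotMod-closed p∤1 (∈u y∈))) (ι≢ y∈ recip-1 1∉)) (ι≢ y∈ recip-p-1 p-1∉)
        ; involutive = λ y∈ → quotMod-involutive p∤1 (∈u y∈)
        ; fixedFree  = λ y∈ fixed → Sum.[ (λ { ≡.refl → All.lookup 1∉ y∈ ≡.refl }) , (λ { ≡.refl → All.lookup p-1∉ y∈ ≡.refl }) ]
            (squareRootOfOne (proj₁ (∈units⁻ (∈u y∈))) (quotMod-fixed (∈u y∈) fixed))
        })
      where
      ∈u : ∀ {y} → y ∈ ys → y ∈ units
      ∈u y∈ = ∈-resp (↭-sym p₂) (there (there y∈))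
      ι≢ : ∀ {y z} → y ∈ ys → ι z ≡ z → All (z ≢_) ys → ι y ≢ z
      ι≢ y∈ ιz≡z z∉ ιy≡z = All.lookup z∉ y∈
        (≡.trans (≡.sym (≡.trans (≡.cong ι ιy≡z) ιz≡z)) (quotMod-involutive p∤1 (∈u y∈)))
      finish : ∃[ h ] length ys ≡ h ℕ.+ h Product.× ys ↭[ parity h ] map ι ys →
               ∃[ h ] length units ≡ suc h ℕ.+ suc h Product.× units ↭[ parity h ] map ι units
      finish (h , ∣ys∣≡2h , q) = h
        , ≡.trans (↭-length p₂) (≡.trans (≡.cong (suc ∘ suc) ∣ys∣≡2h) (≡.cong suc (≡.sym (ℕ.+-suc h h))))
        -- Inversion fixes `1` and `p-1`, so the sign `s` of bringing them to the front occurs on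
        -- both sides and cancels.
        , ↭-withSign (sign-conjugate s (parity h)) (↭-trans p₂ (↭-trans
            (↭-respʳ-≡ (≡.cong₂ (λ x y → x ∷ y ∷ map ι ys) (≡.sym recip-1) (≡.sym recip-p-1)) (↭-prep 1 (↭-prep p-1 q)))
            (↭-sym (↭-map ι p₂))))

    step₁ : ∃[ s ] ∃[ ys ] units ↭[ s ] 1 ∷ ys →
            ∃[ h ] length units ≡ suc h ℕ.+ suc h Product.× units ↭[ parity h ] map ι units
    step₁ (s , ys , p₁) = go (∈⇒↭ (∈-∷⁻ (∈-resp p₁ p-1∈units) p-1≢1))
      where
      go : ∃[ t ] ∃[ zs ] ys ↭[ t ] p-1 ∷ zs →
           ∃[ h ] length units ≡ suc h ℕ.+ suc h Product.× units ↭[ parity h ] map ι units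
      go (t , zs , p₁′) = step₂ p₂ (unique-resp p₂ units!)
        where p₂ = ↭-trans p₁ (↭-prep 1 p₁′)

  upTo-units : ∀ {b s} → units ↭[ s ] map (mulMod b p) units → upTo p ↭[ s ] map (mulMod b p) (upTo p)
  upTo-units {b} q = ↭-respʳ-≡ (≡.cong (λ z → z ∷ map (mulMod b p) units) (≡.sym mulMod-0)) (↭-prep 0 q)
    where
    mulMod-0 : mulMod b p 0 ≡ 0
    mulMod-0 = %ℕ-unique p (b ℤ.* 0ℤ) ℕ.z<s (divides 0ℤ (≡.trans (ℤ.+-identityʳ _) (ℤ.*-zeroʳ b)))

  -- The `p - 1` units form `h` pairs under `y ↦ b / y`, but `h - 1` pairs and two fixed points
  -- under `y ↦ 1 / y`. Multiplication by `b` carries the second map to the first, so its sign is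
  -- the ratio of two signs that differ by one transposition.
  nonsquare⇒odd : ∀ b → ¬ + p ∣ b → ¬ IsSquareMod p b → upTo p ↭[ Sign.- ] map (mulMod b p) (upTo p)
  nonsquare⇒odd b p∤b nonsquare = compare (nonsquare⇒↭ b p∤b nonsquare) recip-↭
    where
    quotients : map (quotMod b) units ≡ map (mulMod b p) (map (quotMod 1ℤ) units)
    quotients = ≡.trans (map-cong∈ (mulMod-recip b)) (List.map-∘ units)
    halve : ∀ h k → h ℕ.+ h ≡ k ℕ.+ k → h ≡ k
    halve zero    zero    _  = ≡.refl
    halve (suc h) (suc k) eq = ≡.cong suc (halve h k (ℕ.suc-injective
      (≡.trans (≡.sym (ℕ.+-suc h h)) (≡.trans (ℕ.suc-injective eq) (ℕ.+-suc k k)))))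
    compare : ∃[ h ] length units ≡ h ℕ.+ h Product.× units ↭[ parity h ] map (quotMod b) units →
              ∃[ h ] length units ≡ suc h ℕ.+ suc h Product.× units ↭[ parity h ] map (quotMod 1ℤ) units →
              upTo p ↭[ Sign.- ] map (mulMod b p) (upTo p)
    compare (h , ∣u∣≡2h , q) (k , ∣u∣≡2k+2 , r) with ≡.refl ← halve h (suc k) (≡.trans (≡.sym ∣u∣≡2h) ∣u∣≡2k+2) =
      upTo-units {b} (↭-withSign (Sign.opposite[s]*s≡- (parity k))
        (↭-trans (↭-respʳ-≡ quotients q) (↭-sym (↭-map (mulMod b p) r))))

  -- Multiplication by `b ≡ z z` is the permutation `mulMod z p` applied twice, and `s * s` is `+`
  -- whatever the sign `s` is.
  square⇒even : ∀ b → ¬ + p ∣ b → IsSquareMod p b → upTo p ↭[ Sign.+ ] map (mulMod b p) (upTo p)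
  square⇒even b p∤b (y , y²≡b) = square (mulMod-↭ {z} (prime∤⇒cancellative pr p∤y))
    where
    z = + Fin.toℕ y
    p∤y : ¬ + p ∣ z
    p∤y p∣y = p∤b (∣-resp-≡ (lemma z b) (∣m∣n⇒∣m+n (∣n⇒∣m*n z p∣y) (∣m⇒∣-m y²≡b)))
      where
      lemma : ∀ z b → z ℤ.* z ℤ.+ ℤ.- (z ℤ.* z ℤ.- b) ≡ b
      lemma = solve-∀
    square : ∃[ s ] upTo p ↭[ s ] map (mulMod z p) (upTo p) → upTo p ↭[ Sign.+ ] map (mulMod b p) (upTo p)
    square (s , q) = ↭-withSign (Sign.s*s≡+ s) (↭-respʳ-≡
      (≡.trans (≡.sym (List.map-∘ (upTo p)))
        (List.map-cong (λ i → ≡.trans (mulMod-∘ z z p i) (mulMod-cong {z ℤ.* z} {b} p y²≡b i)) (upTo p)))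
      (↭-trans q (↭-map (mulMod z p) q)))

  zolotarev-prime : ∀ b → ¬ + p ∣ b →
                    ∃[ s ] legendre b p ≡ s ◃ 1 Product.× upTo p ↭[ s ] map (mulMod b p) (upTo p)
  zolotarev-prime b p∤b with + p ∣? b | isSquareMod? p b
  ... | yes p∣b | _             = ⊥-elim (p∤b p∣b)
  ... | no  _   | yes square    = Sign.+ , ≡.refl , square⇒even b p∤b square
  ... | no  _   | no  nonsquare = Sign.- , ≡.refl , nonsquare⇒odd b p∤b nonsquare

-- Zolotarev's lemma for odd composite moduli

legendre-zolotarev : ∀ b {p} .{{_ : NonZero p}} → Prime p → parity p ≡ Sign.- → ¬ + p ∣ b →
                     ∃[ s ] legendre b p ≡ s ◃ 1 Product.× upTo p ↭[ s ] map (mulMod b p) (upTo p)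
legendre-zolotarev b {suc p-1} pr odd = ModPrime.zolotarev-prime p-1 pr odd b

-- Writing the residues mod p m as i + p t, multiplication by b acts on i as mod p and, for each
-- fixed i, on t as multiplication by b mod m followed by a shift.
mulMod-product : ∀ b p m .{{_ : NonZero p}} .{{_ : NonZero m}} .{{_ : NonZero (p ℕ.* m)}} →
                 parity p ≡ Sign.- → parity m ≡ Sign.- →
                 upTo p ↭[ s ] map (mulMod b p) (upTo p) → upTo m ↭[ t ] map (mulMod b m) (upTo m) →
                 upTo (p ℕ.* m) ↭[ s Sign.* t ] map (mulMod b (p ℕ.* m)) (upTo (p ℕ.* m))
mulMod-product {s} {t} b p m oddp oddm πp πm = conjugate reorder
  where
  β = mulMod b (p ℕ.* m)
  join : ℕ → ℕ → ℕ
  join i k = i ℕ.+ p ℕ.* k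
  fibre : ℕ → List ℕ
  fibre i = map (join i) (upTo m)
  grid : List ℕ
  grid = concatMap fibre (upTo p)

  length-fibre : ∀ i → length (fibre i) ≡ m
  length-fibre i = ≡.trans (List.length-map (join i) (upTo m)) (List.length-upTo m)
  length-grid : ∀ is → length (concatMap fibre is) ≡ length is ℕ.* m
  length-grid []       = ≡.refl
  length-grid (i ∷ is) = ≡.trans (List.length-++ (fibre i)) (≡.cong₂ ℕ._+_ (length-fibre i) (length-grid is))

  -- The sign `r` of passing to the order by fibres is never computed: `conjugate` uses the
  -- rearrangement forwards and backwards.
  reorder : ∃[ r ] upTo (p ℕ.* m) ↭[ r ] grid
  reorder = unique∧⊆⇒↭ (Unique.upTo⁺ (p ℕ.* m)) ∈grid
    (≡.trans (List.length-upTo (p ℕ.* m)) (≡.sym (≡.trans (length-grid (upTo p)) (≡.cong (ℕ._* m) (List.length-upTo p)))))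
    where
    ∈grid : ∀ {x} → x ∈ upTo (p ℕ.* m) → x ∈ grid
    ∈grid {x} x∈ = ≡.subst (_∈ grid)
      (≡.sym (≡.trans (ℕ.m≡m%n+[m/n]*n x p) (≡.cong (x ℕ.% p ℕ.+_) (ℕ.*-comm (x ℕ./ p) p))))
      (∈-concat⁺′ (∈-map⁺ (join (x ℕ.% p)) (∈-upTo⁺ (ℕ.m<n*o⇒m/o<n (≡.subst (x ℕ.<_) (ℕ.*-comm p m) (∈-upTo⁻ x∈)))))
                  (∈-map⁺ fibre (∈-upTo⁺ (ℕ.m%n<n x p))))

  join< : ∀ {i k} → i ℕ.< p → k ℕ.< m → join i k ℕ.< p ℕ.* m
  join< {i} {k} i<p k<m = begin-strict
    i ℕ.+ p ℕ.* k  <⟨ ℕ.+-monoˡ-< (p ℕ.* k) i<p ⟩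
    p ℕ.+ p ℕ.* k  ≡⟨ ℕ.*-suc p k ⟨
    p ℕ.* suc k    ≤⟨ ℕ.*-monoʳ-≤ p k<m ⟩
    p ℕ.* m        ∎
    where open ℕ.≤-Reasoning

  +join : ∀ i k → + join i k ≡ + i ℤ.+ + p ℤ.* + k
  +join i k = ≡.cong (λ z → + i ℤ.+ z) (ℤ.pos-* p k)

  -- Multiplication in mixed digits: dividing `b i` by `p` leaves the new first digit and a carry
  -- `c`, which is added to `b k` in the second digit. The carry depends on `i` alone, so on a fixed
  -- fibre it is a shift, of sign `+` because `m` is odd.
  β-join : ∀ i k → β (join i k) ≡ join (mulMod b p i) (shiftMod ((b ℤ.* + i) /ℕ p) m (mulMod b m k))
  β-join i k = %ℕ-unique (p ℕ.* m) (b ℤ.* + join i k) (join< (ℤ.n%ℕd<d (b ℤ.* + i) p) (ℤ.n%ℕd<d (c ℤ.+ + k′) m))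
    (∣-resp-≡ eq (≡.subst (_∣ + p ℤ.* (c ℤ.+ b ℤ.* + k ℤ.- + k″)) (≡.sym (ℤ.pos-* p m)) (*-monoʳ-∣ (+ p)
      (∣-resp-≡ (lemma₁ c (b ℤ.* + k) (+ k′) (+ k″)) (∣m∣n⇒∣m+n (∣-residue m (b ℤ.* + k)) (∣-residue m (c ℤ.+ + k′)))))))
    where
    c = (b ℤ.* + i) /ℕ p
    i′ = mulMod b p i
    k′ = mulMod b m k
    k″ = shiftMod c m k′
    lemma₁ : ∀ c bk k′ k″ → (bk ℤ.- k′) ℤ.+ (c ℤ.+ k′ ℤ.- k″) ≡ c ℤ.+ bk ℤ.- k″
    lemma₁ = solve-∀
    lemma₂ : ∀ b p c i′ k k″ → p ℤ.* (c ℤ.+ b ℤ.* k ℤ.- k″) ≡ (i′ ℤ.+ c ℤ.* p) ℤ.+ b ℤ.* (p ℤ.* k) ℤ.- (i′ ℤ.+ p ℤ.* k″)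
    lemma₂ = solve-∀
    eq : + p ℤ.* (c ℤ.+ b ℤ.* + k ℤ.- + k″) ≡ b ℤ.* + join i k ℤ.- + join i′ k″
    eq = begin
      + p ℤ.* (c ℤ.+ b ℤ.* + k ℤ.- + k″)
        ≡⟨ lemma₂ b (+ p) c (+ i′) (+ k) (+ k″) ⟩
      (+ i′ ℤ.+ c ℤ.* + p) ℤ.+ b ℤ.* (+ p ℤ.* + k) ℤ.- (+ i′ ℤ.+ + p ℤ.* + k″)
        ≡⟨ ≡.cong (λ z → z ℤ.+ b ℤ.* (+ p ℤ.* + k) ℤ.- (+ i′ ℤ.+ + p ℤ.* + k″)) (ℤ.a≡a%ℕn+[a/ℕn]*n (b ℤ.* + i) p) ⟨
      b ℤ.* + i ℤ.+ b ℤ.* (+ p ℤ.* + k) ℤ.- (+ i′ ℤ.+ + p ℤ.* + k″)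
        ≡⟨ ≡.cong (ℤ._- (+ i′ ℤ.+ + p ℤ.* + k″)) (ℤ.*-distribˡ-+ b (+ i) (+ p ℤ.* + k)) ⟨
      b ℤ.* (+ i ℤ.+ + p ℤ.* + k) ℤ.- (+ i′ ℤ.+ + p ℤ.* + k″)
        ≡⟨ ≡.cong₂ (λ y z → b ℤ.* y ℤ.- z) (+join i k) (+join i′ k″) ⟨
      b ℤ.* + join i k ℤ.- + join i′ k″ ∎
      where open ≡-Reasoning

  β-fibre : ∀ i → fibre (mulMod b p i) ↭[ t ] map β (fibre i)
  β-fibre i = ↭-respʳ-≡ (begin
      map (join (mulMod b p i)) (map (shiftMod c m) (map (mulMod b m) (upTo m)))
        ≡⟨ ≡.cong (map (join (mulMod b p i))) (List.map-∘ (upTo m)) ⟨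
      map (join (mulMod b p i)) (map (shiftMod c m ∘ mulMod b m) (upTo m))
        ≡⟨ List.map-∘ (upTo m) ⟨
      map (λ k → join (mulMod b p i) (shiftMod c m (mulMod b m k))) (upTo m)
        ≡⟨ List.map-cong (β-join i) (upTo m) ⟨
      map (β ∘ join i) (upTo m)
        ≡⟨ List.map-∘ (upTo m) ⟩
      map β (fibre i) ∎)
    (↭-map (join (mulMod b p i)) (↭-trans (shiftMod-↭ c m oddm) (↭-map (shiftMod c m) πm)))
    where
    c = (b ℤ.* + i) /ℕ p
    open ≡-Reasoning

  -- The fibres move as blocks of odd length `m`, which costs `s`; the rearrangement within the
  -- fibres costs `t` for each of them, and their number `p` is odd.
  β-grid : grid ↭[ s Sign.* t ] map β grid
  β-grid = ↭-trans
    (↭-concatMap fibre (λ i → ≡.trans (≡.cong parity (length-fibre i)) oddm) πp)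
    (↭-respˡ-≡ (≡.sym (List.concatMap-map fibre (mulMod b p) (upTo p)))
      (↭-respʳ-≡ (≡.sym (List.map-concatMap β fibre (upTo p)))
        (concatMap-↭ (fibre ∘ mulMod b p) (map β ∘ fibre) (upTo p) (λ {i} _ → β-fibre i)
          (≡.trans (≡.cong parity (List.length-upTo p)) oddp))))

  conjugate : ∃[ r ] upTo (p ℕ.* m) ↭[ r ] grid → upTo (p ℕ.* m) ↭[ s Sign.* t ] map β (upTo (p ℕ.* m))
  conjugate (r , q) = ↭-withSign (sign-conjugate r (s Sign.* t)) (↭-trans q (↭-trans β-grid (↭-sym (↭-map β q))))

mulMod-one : ∀ b → upTo 1 ↭[ Sign.+ ] map (mulMod b 1) (upTo 1)
mulMod-one b = ↭-reflexive (≡.cong [_] (≡.sym (%ℕ-unique 1 (b ℤ.* 0ℤ) ℕ.z<s (divides (b ℤ.* 0ℤ ℤ.- 0ℤ) (≡.sym (ℤ.*-identityʳ _))))))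

parity-* : ∀ m n → parity (m ℕ.* n) ≡ Sign.- → parity m ≡ Sign.- Product.× parity n ≡ Sign.-
parity-* m n odd = by-cases (parity n) ≡.refl
  where
  even : ∀ m → parity n ≡ Sign.+ → parity (m ℕ.* n) ≡ Sign.+
  even zero    _  = ≡.refl
  even (suc m) ev = ≡.trans (parity-+ n (m ℕ.* n)) (≡.cong₂ Sign._*_ ev (even m ev))
  by-cases : ∀ s → parity n ≡ s → parity m ≡ Sign.- Product.× parity n ≡ Sign.-
  by-cases Sign.- eq = ≡.trans (≡.sym (parity-odd-* m n eq)) odd , eq
  by-cases Sign.+ eq = ⊥-elim (Sign.s≢opposite[s] Sign.+ (≡.trans (≡.sym (even m eq)) odd))

-- By `mulMod-product` the sign is multiplicative in the modulus, just as the symbol is by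
-- definition. Since that lemma splits residues by digits and not by the Chinese remainder theorem,
-- repeated primes are covered by the same induction.
zolotarev : ∀ b ps .{{_ : NonZero (product ps)}} → All Prime ps → All (λ p → ¬ + p ∣ b) ps → parity (product ps) ≡ Sign.- →
            ∃[ s ] foldr ℤ._*_ 1ℤ (map (legendre b) ps) ≡ s ◃ 1
              Product.× upTo (product ps) ↭[ s ] map (mulMod b (product ps)) (upTo (product ps))
zolotarev b [] _ _ _ = Sign.+ , ≡.refl , mulMod-one b
zolotarev b (p ∷ ps) (pr ∷ prs) (p∤b ∷ ps∤b) odd =
  combine (legendre-zolotarev b pr (proj₁ odds) p∤b)
          (zolotarev b ps prs ps∤b (proj₂ odds))
  where
  odds = parity-* p (product ps) odd
  instance
    _ : NonZero p
    _ = prime⇒nonZero pr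
    _ : NonZero (product ps)
    _ = ℕ.m*n≢0⇒n≢0 p
  combine : ∃[ s ] legendre b p ≡ s ◃ 1 Product.× upTo p ↭[ s ] map (mulMod b p) (upTo p) →
            ∃[ s ] foldr ℤ._*_ 1ℤ (map (legendre b) ps) ≡ s ◃ 1
              Product.× upTo (product ps) ↭[ s ] map (mulMod b (product ps)) (upTo (product ps)) →
            ∃[ s ] legendre b p ℤ.* foldr ℤ._*_ 1ℤ (map (legendre b) ps) ≡ s ◃ 1
              Product.× upTo (p ℕ.* product ps) ↭[ s ] map (mulMod b (p ℕ.* product ps)) (upTo (p ℕ.* product ps))
  combine (s , eq₁ , πp) (t , eq₂ , πm) = s Sign.* t , ≡.trans (≡.cong₂ ℤ._*_ eq₁ eq₂) (sign-*-unit s t)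
    , mulMod-product b p (product ps) (proj₁ odds) (proj₂ odds) πp πm

product-cancellative : ∀ {b} ps → All Prime ps → All (λ p → ¬ + p ∣ b) ps → Cancellative (product ps) b
product-cancellative [] _ _ {z} _ = divides z (≡.sym (ℤ.*-identityʳ z))
product-cancellative {b} (p ∷ ps) (pr ∷ prs) (p∤b ∷ ps∤b) {z} pm∣bz = ≡.subst (_∣ z) (≡.sym (ℤ.pos-* p (product ps)))
  (descend (prime∤⇒cancellative pr p∤b {z} (∣-trans (divides (+ product ps) (ℤ.*-comm (+ p) (+ product ps))) pm∣bz′)))
  where
  pm∣bz′ : + p ℤ.* + product ps ∣ b ℤ.* z
  pm∣bz′ = ≡.subst (_∣ b ℤ.* z) (ℤ.pos-* p (product ps)) pm∣bz
  descend : + p ∣ z → + p ℤ.* + product ps ∣ z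
  descend (divides w ≡.refl) = ≡.subst (+ p ℤ.* + product ps ∣_) (ℤ.*-comm (+ p) w) (*-monoʳ-∣ (+ p)
    (product-cancellative ps prs ps∤b (*-cancelˡ-∣ (+ p) {{prime⇒nonZero pr}} (≡.subst (+ p ℤ.* + product ps ∣_) (lemma b w (+ p)) pm∣bz′))))
    where
    lemma : ∀ b w p → b ℤ.* (w ℤ.* p) ≡ p ℤ.* (b ℤ.* w)
    lemma = solve-∀

-- Quotients and sums of integers

/ℕ-unique : ∀ n .{{_ : NonZero n}} z {r c} → r ℕ.< n → z ≡ + r ℤ.+ c ℤ.* + n → z /ℕ n ≡ c
/ℕ-unique n@(suc _) z {r} {c} r<n z≡ = ℤ.*-cancelʳ-≡ (z /ℕ n) c (+ n) (ℤ+.∙-cancelˡ (+ r) _ _ (begin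
  + r ℤ.+ z /ℕ n ℤ.* + n         ≡⟨ ≡.cong (λ w → + w ℤ.+ z /ℕ n ℤ.* + n) (%ℕ-unique n z r<n (divides c (≡.trans (≡.cong (ℤ._- + r) z≡) (lemma (+ r) (c ℤ.* + n))))) ⟨
  + (z %ℕ n) ℤ.+ z /ℕ n ℤ.* + n  ≡⟨ ℤ.a≡a%ℕn+[a/ℕn]*n z n ⟨
  z                              ≡⟨ z≡ ⟩
  + r ℤ.+ c ℤ.* + n              ∎))
  where
  open ≡-Reasoning
  lemma : ∀ r c → r ℤ.+ c ℤ.- r ≡ c
  lemma = solve-∀

/ℕ-+* : ∀ n .{{_ : NonZero n}} z c → (z ℤ.+ c ℤ.* + n) /ℕ n ≡ z /ℕ n ℤ.+ c
/ℕ-+* n z c = /ℕ-unique n (z ℤ.+ c ℤ.* + n) (ℤ.n%ℕd<d z n)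
  (≡.trans (≡.cong (ℤ._+ c ℤ.* + n) (ℤ.a≡a%ℕn+[a/ℕn]*n z n)) (lemma (+ (z %ℕ n)) (z /ℕ n) c (+ n)))
  where
  lemma : ∀ r q c n → r ℤ.+ q ℤ.* n ℤ.+ c ℤ.* n ≡ r ℤ.+ (q ℤ.+ c) ℤ.* n
  lemma = solve-∀

/ℕ-difference-≥ : ∀ n .{{_ : NonZero n}} {y z r s u v} → r ℕ.< n → s ℕ.≤ r →
                  y ≡ + r ℤ.+ u ℤ.* + n → z ≡ + s ℤ.+ v ℤ.* + n → (y ℤ.- z) /ℕ n ≡ u ℤ.- v
/ℕ-difference-≥ n {r = r} {s} {u} {v} r<n s≤r ≡.refl ≡.refl = /ℕ-unique n _ (ℕ.≤-<-trans (ℕ.m∸n≤m r s) r<n)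
  (≡.trans (lemma (+ r) (+ s) u v (+ n)) (≡.cong (ℤ._+ (u ℤ.- v) ℤ.* + n) (≡.trans (ℤ.m-n≡m⊖n r s) (ℤ.⊖-≥ s≤r))))
  where
  lemma : ∀ r s u v n → r ℤ.+ u ℤ.* n ℤ.- (s ℤ.+ v ℤ.* n) ≡ (r ℤ.- s) ℤ.+ (u ℤ.- v) ℤ.* n
  lemma = solve-∀

-- Here `r - s` is negative, so one `n` is borrowed from the quotient and the remainder is
-- `n + r - s`.
/ℕ-difference-< : ∀ n .{{_ : NonZero n}} {y z r s u v} → s ℕ.< n → r ℕ.< s →
                  y ≡ + r ℤ.+ u ℤ.* + n → z ≡ + s ℤ.+ v ℤ.* + n → (y ℤ.- z) /ℕ n ≡ u ℤ.- v ℤ.+ -1ℤ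
/ℕ-difference-< n {r = r} {s} {u} {v} s<n r<s ≡.refl ≡.refl = /ℕ-unique n _ remainder<n
  (≡.trans (lemma (+ r) (+ s) u v (+ n)) (≡.cong (ℤ._+ (u ℤ.- v ℤ.+ -1ℤ) ℤ.* + n)
    (≡.trans (ℤ.m-n≡m⊖n (n ℕ.+ r) s) (ℤ.⊖-≥ s≤n+r))))
  where
  s≤n+r : s ℕ.≤ n ℕ.+ r
  s≤n+r = ℕ.≤-trans (ℕ.<⇒≤ s<n) (ℕ.m≤m+n n r)
  remainder<n : n ℕ.+ r ℕ.∸ s ℕ.< n
  remainder<n = ℕ.+-cancelʳ-< s _ _ (≡.subst (ℕ._< n ℕ.+ s) (≡.sym (ℕ.m∸n+n≡m s≤n+r)) (ℕ.+-monoʳ-< n r<s))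
  lemma : ∀ r s u v n → r ℤ.+ u ℤ.* n ℤ.- (s ℤ.+ v ℤ.* n) ≡ (n ℤ.+ r ℤ.- s) ℤ.+ (u ℤ.- v ℤ.+ -1ℤ) ℤ.* n
  lemma = solve-∀

sumℤ : (A → ℤ) → List A → ℤ
sumℤ f = foldr (λ x z → f x ℤ.+ z) 0ℤ

sumℤ-↭ : ∀ {f : A → ℤ} {s xs ys} → xs ↭[ s ] ys → sumℤ f xs ≡ sumℤ f ys
sumℤ-↭ ↭-refl = ≡.refl
sumℤ-↭ {f = f} (↭-prep x p) = ≡.cong (λ z → f x ℤ.+ z) (sumℤ-↭ {f = f} p)
sumℤ-↭ {f = f} (↭-swap {xs = xs} x y) = lemma (f x) (f y) (sumℤ f xs)
  where
  lemma : ∀ x y z → x ℤ.+ (y ℤ.+ z) ≡ y ℤ.+ (x ℤ.+ z)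
  lemma = solve-∀
sumℤ-↭ {f = f} (↭-trans p q) = ≡.trans (sumℤ-↭ {f = f} p) (sumℤ-↭ {f = f} q)

sumℤ-map : ∀ (f : B → ℤ) (g : A → B) xs → sumℤ f (map g xs) ≡ sumℤ (f ∘ g) xs
sumℤ-map f g xs = List.foldr-map _ g 0ℤ xs

sumℤ-cong : ∀ {f g : A → ℤ} → (∀ x → f x ≡ g x) → ∀ xs → sumℤ f xs ≡ sumℤ g xs
sumℤ-cong f≡g []       = ≡.refl
sumℤ-cong f≡g (x ∷ xs) = ≡.cong₂ ℤ._+_ (f≡g x) (sumℤ-cong f≡g xs)

sumℤ-* : ∀ c (f : A → ℤ) xs → sumℤ (λ x → c ℤ.* f x) xs ≡ c ℤ.* sumℤ f xs
sumℤ-* c f []       = ≡.sym (ℤ.*-zeroʳ c)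
sumℤ-* c f (x ∷ xs) = ≡.trans (≡.cong (λ z → c ℤ.* f x ℤ.+ z) (sumℤ-* c f xs)) (≡.sym (ℤ.*-distribˡ-+ c (f x) (sumℤ f xs)))

sumℤ-- : ∀ (f g : A → ℤ) xs → sumℤ (λ x → f x ℤ.- g x) xs ≡ sumℤ f xs ℤ.- sumℤ g xs
sumℤ-- f g []       = ≡.refl
sumℤ-- f g (x ∷ xs) = ≡.trans (≡.cong (λ z → f x ℤ.- g x ℤ.+ z) (sumℤ-- f g xs)) (lemma (f x) (g x) (sumℤ f xs) (sumℤ g xs))
  where
  lemma : ∀ a b c d → (a ℤ.- b) ℤ.+ (c ℤ.- d) ≡ (a ℤ.+ c) ℤ.- (b ℤ.+ d)
  lemma = solve-∀

sumℤ-++ : ∀ (f : A → ℤ) xs ys → sumℤ f (xs ++ ys) ≡ sumℤ f xs ℤ.+ sumℤ f ys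
sumℤ-++ f []       ys = ≡.sym (ℤ.+-identityˡ _)
sumℤ-++ f (x ∷ xs) ys = ≡.trans (≡.cong (λ z → f x ℤ.+ z) (sumℤ-++ f xs ys)) (≡.sym (ℤ.+-assoc (f x) _ _))

sumℤ-suc-upTo : ∀ n → + 2 ℤ.* sumℤ (λ i → + suc i) (upTo n) ≡ + n ℤ.* + suc n
sumℤ-suc-upTo zero    = ≡.refl
sumℤ-suc-upTo (suc n) = begin
  + 2 ℤ.* S (upTo (suc n))                      ≡⟨ ≡.cong (λ xs → + 2 ℤ.* S xs) (List.upTo-∷ʳ n) ⟨
  + 2 ℤ.* S (upTo n ++ [ n ])                   ≡⟨ ≡.cong (+ 2 ℤ.*_) (sumℤ-++ (λ i → + suc i) (upTo n) [ n ]) ⟩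
  + 2 ℤ.* (S (upTo n) ℤ.+ (+ suc n ℤ.+ 0ℤ))     ≡⟨ lemma₁ (S (upTo n)) (+ n) ⟩
  + 2 ℤ.* S (upTo n) ℤ.+ + 2 ℤ.* + suc n        ≡⟨ ≡.cong (ℤ._+ + 2 ℤ.* + suc n) (sumℤ-suc-upTo n) ⟩
  + n ℤ.* + suc n ℤ.+ + 2 ℤ.* + suc n           ≡⟨ lemma₂ (+ n) ⟩
  + suc n ℤ.* + suc (suc n)                     ∎
  where
  open ≡-Reasoning
  S = sumℤ (λ i → + suc i)
  lemma₁ : ∀ s n → + 2 ℤ.* (s ℤ.+ ((1ℤ ℤ.+ n) ℤ.+ 0ℤ)) ≡ + 2 ℤ.* s ℤ.+ + 2 ℤ.* (1ℤ ℤ.+ n)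
  lemma₁ = solve-∀
  lemma₂ : ∀ n → n ℤ.* (1ℤ ℤ.+ n) ℤ.+ + 2 ℤ.* (1ℤ ℤ.+ n) ≡ (1ℤ ℤ.+ n) ℤ.* (+ 2 ℤ.+ n)
  lemma₂ = solve-∀

sumℤ-neg : ∀ (f : A → ℤ) xs → sumℤ (λ x → ℤ.- f x) xs ≡ ℤ.- sumℤ f xs
sumℤ-neg f []       = ≡.refl
sumℤ-neg f (x ∷ xs) = ≡.trans (≡.cong (λ z → ℤ.- f x ℤ.+ z) (sumℤ-neg f xs)) (≡.sym (ℤ.neg-distrib-+ (f x) (sumℤ f xs)))

-- Since i counts from 0, index r solves b (i + 1) ≡ r with 1 ≤ i + 1 ≤ n.
record ResidueInverse (b : ℤ) (n : ℕ) : Set where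
  field
    index    : ℕ → ℕ
    quot     : ℕ → ℤ
    index<   : ∀ r → index r ℕ.< n
    equation : ∀ r → b ℤ.* + suc (index r) ≡ + r ℤ.+ quot r ℤ.* + n

residueInverse : ∀ {b n} .{{_ : NonZero n}} → Cancellative n b → ResidueInverse b n
residueInverse {b} {n} cancel = record
  { index    = λ r → proj₁ (root r)
  ; quot     = λ r → _∣_.quotient (proj₂ (proj₂ (root r)))
  ; index<   = λ r → proj₁ (proj₂ (root r))
  ; equation = λ r → equation (+ r) (proj₁ (root r)) (proj₂ (proj₂ (root r)))
  }
  where
  -- The congruence `b (i + 1) ≡ r`, solved for the index `i` that counts from `0`.
  root : ∀ r → ∃[ i ] i ℕ.< n Product.× + n ∣ b ℤ.* + i ℤ.- (+ r ℤ.- b)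
  root r = mulMod-surjective {b} cancel (+ r ℤ.- b)
  equation : ∀ r i (d : + n ∣ b ℤ.* + i ℤ.- (r ℤ.- b)) → b ℤ.* (1ℤ ℤ.+ + i) ≡ r ℤ.+ _∣_.quotient d ℤ.* + n
  equation r i (divides q eq) = ≡.trans (lemma b (+ i) r) (≡.cong (λ z → r ℤ.+ z) eq)
    where
    lemma : ∀ b i r → b ℤ.* (1ℤ ℤ.+ i) ≡ r ℤ.+ (b ℤ.* i ℤ.- (r ℤ.- b))
    lemma = solve-∀

module ResidueInverseProperties {b n} .{{_ : NonZero n}} (cancel : Cancellative n b) (inv : ResidueInverse b n) where

  open ResidueInverse inv

  index-unique : ∀ {i r} z → i ℕ.< n → b ℤ.* + suc i ≡ + r ℤ.+ z ℤ.* + n → index r ≡ i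
  index-unique {i} {r} z i<n eq = residues-≡ (index< r) i<n (cancel (divides (quot r ℤ.- z) (begin
    b ℤ.* (+ index r ℤ.- + i)                              ≡⟨ lemma₁ b (+ index r) (+ i) ⟩
    b ℤ.* + suc (index r) ℤ.- b ℤ.* + suc i                ≡⟨ ≡.cong₂ ℤ._-_ (equation r) eq ⟩
    (+ r ℤ.+ quot r ℤ.* + n) ℤ.- (+ r ℤ.+ z ℤ.* + n)       ≡⟨ lemma₂ (+ r) (quot r) z (+ n) ⟩
    (quot r ℤ.- z) ℤ.* + n                                 ∎)))
    where
    open ≡-Reasoning
    lemma₁ : ∀ b j i → b ℤ.* (j ℤ.- i) ≡ b ℤ.* (1ℤ ℤ.+ j) ℤ.- b ℤ.* (1ℤ ℤ.+ i)
    lemma₁ = solve-∀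
    lemma₂ : ∀ r u z n → (r ℤ.+ u ℤ.* n) ℤ.- (r ℤ.+ z ℤ.* n) ≡ (u ℤ.- z) ℤ.* n
    lemma₂ = solve-∀

  -- The tool for computing exponents: any row number in range with the right residue identifies
  -- `quot`.
  quot-unique : ∀ {i r} z → i ℕ.< n → b ℤ.* + suc i ≡ + r ℤ.+ z ℤ.* + n → quot r ≡ z
  quot-unique {i} {r} z i<n eq = *n-injective (ℤ+.∙-cancelˡ (+ r) _ _ (begin
    + r ℤ.+ quot r ℤ.* + n   ≡⟨ equation r ⟨
    b ℤ.* + suc (index r)    ≡⟨ ≡.cong (λ j → b ℤ.* + suc j) (index-unique z i<n eq) ⟩
    b ℤ.* + suc i            ≡⟨ eq ⟩
    + r ℤ.+ z ℤ.* + n        ∎))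
    where
    open ≡-Reasoning
    *n-injective : quot r ℤ.* + n ≡ z ℤ.* + n → quot r ≡ z
    *n-injective = ℤ.*-cancelʳ-≡ (quot r) z (+ n) {{ℕ.≢-nonZero (ℕ.≢-nonZero⁻¹ n)}}

  residue : ℕ → ℕ
  residue i = (b ℤ.* + suc i) %ℕ n

  residue-index : ∀ {r} → r ℕ.< n → residue (index r) ≡ r
  residue-index {r} r<n = %ℕ-unique n (b ℤ.* + suc (index r)) r<n
    (divides (quot r) (≡.trans (≡.cong (ℤ._- + r) (equation r)) (lemma (+ r) (quot r ℤ.* + n))))
    where
    lemma : ∀ r c → r ℤ.+ c ℤ.- r ≡ c
    lemma = solve-∀

  residue-equation : ∀ i → b ℤ.* + suc i ≡ + residue i ℤ.+ ((b ℤ.* + suc i) /ℕ n) ℤ.* + n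
  residue-equation i = ℤ.a≡a%ℕn+[a/ℕn]*n (b ℤ.* + suc i) n

  index-residue : ∀ {i} → i ℕ.< n → index (residue i) ≡ i
  index-residue {i} i<n = index-unique ((b ℤ.* + suc i) /ℕ n) i<n (residue-equation i)

  residue-mulMod : ∀ i → mulMod b n (shiftMod 1ℤ n i) ≡ residue i
  residue-mulMod i = %ℕ-cong n (b ℤ.* + shiftMod 1ℤ n i) (b ℤ.* + suc i)
    (∣-resp-≡ (lemma b (+ suc i) (+ shiftMod 1ℤ n i)) (∣n⇒∣m*n (ℤ.- b) (∣-residue n (1ℤ ℤ.+ + i))))
    where
    lemma : ∀ b j w → ℤ.- b ℤ.* (j ℤ.- w) ≡ b ℤ.* w ℤ.- b ℤ.* j
    lemma = solve-∀

  index-↭ : ∃[ s ] upTo n ↭[ s ] map index (upTo n)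
  index-↭ = Product.map₂ ↭-sym (unique∧⊆⇒↭
    (map-unique (Unique.upTo⁺ n) λ r∈ r′∈ eq →
      ≡.trans (≡.sym (residue-index (∈-upTo⁻ r∈))) (≡.trans (≡.cong residue eq) (residue-index (∈-upTo⁻ r′∈))))
    index∈
    (List.length-map index (upTo n)))
    where
    index∈ : ∀ {i} → i ∈ map index (upTo n) → i ∈ upTo n
    index∈ i∈ with r , _ , ≡.refl ← ∈-map⁻ index i∈ = ∈-upTo⁺ (index< r)

  -- Multiplication by `b` after the shift by one undoes `index`, and the shift is even. Together
  -- with `signum-unique` this equates the sign of sorting by residues with the sign of
  -- multiplication by `b`.
  index-mulMod-↭ : ∀ {s t} → parity n ≡ Sign.- → upTo n ↭[ s ] map index (upTo n) → upTo n ↭[ t ] map (mulMod b n) (upTo n) →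
                   upTo n ↭[ t Sign.* s ] upTo n
  index-mulMod-↭ {s} {t} odd p q = ↭-respʳ-≡ (begin
      map (mulMod b n) (map (shiftMod 1ℤ n) (map index (upTo n)))
        ≡⟨ ≡.cong (map (mulMod b n)) (List.map-∘ (upTo n)) ⟨
      map (mulMod b n) (map (shiftMod 1ℤ n ∘ index) (upTo n))
        ≡⟨ List.map-∘ (upTo n) ⟨
      map (mulMod b n ∘ shiftMod 1ℤ n ∘ index) (upTo n)
        ≡⟨ map-cong∈ (λ {r} r∈ → ≡.trans (residue-mulMod (index r)) (residue-index (∈-upTo⁻ r∈))) ⟩
      map id (upTo n)
        ≡⟨ List.map-id (upTo n) ⟩
      upTo n ∎)
    (↭-trans q (↭-map (mulMod b n) (↭-trans (shiftMod-one-↭ n odd) (↭-map (shiftMod 1ℤ n) p))))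
    where open ≡-Reasoning

  residue-↭ : ∀ {s} → upTo n ↭[ s ] map index (upTo n) → map residue (upTo n) ↭[ s ] upTo n
  residue-↭ p = ↭-respʳ-≡
    (≡.trans (≡.sym (List.map-∘ (upTo n))) (≡.trans (map-cong∈ (residue-index ∘ ∈-upTo⁻)) (List.map-id (upTo n))))
    (↭-map residue p)

  -- On summing `equation` over all residues, `index` merely permutes the row numbers and drops out.
  -- The factor `+ n` stays on the left to avoid a division.
  quot-sum : ∀ {s} → upTo n ↭[ s ] map index (upTo n) →
             sumℤ quot (upTo n) ℤ.* + n ≡ b ℤ.* sumℤ (λ i → + suc i) (upTo n) ℤ.- sumℤ +_ (upTo n)
  quot-sum p = begin
    sumℤ quot (upTo n) ℤ.* + n
      ≡⟨ ℤ.*-comm (sumℤ quot (upTo n)) (+ n) ⟩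
    + n ℤ.* sumℤ quot (upTo n)
      ≡⟨ sumℤ-* (+ n) quot (upTo n) ⟨
    sumℤ (λ r → + n ℤ.* quot r) (upTo n)
      ≡⟨ sumℤ-cong (λ r → ≡.trans (lemma (+ n) (quot r) (+ r)) (≡.cong (ℤ._- + r) (≡.sym (equation r)))) (upTo n) ⟩
    sumℤ (λ r → b ℤ.* + suc (index r) ℤ.- + r) (upTo n)
      ≡⟨ sumℤ-- (λ r → b ℤ.* + suc (index r)) +_ (upTo n) ⟩
    sumℤ (λ r → b ℤ.* + suc (index r)) (upTo n) ℤ.- sumℤ +_ (upTo n)
      ≡⟨ ≡.cong (ℤ._- sumℤ +_ (upTo n)) (begin
          sumℤ (λ r → b ℤ.* + suc (index r)) (upTo n)       ≡⟨ sumℤ-* b (λ r → + suc (index r)) (upTo n) ⟩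
          b ℤ.* sumℤ (λ r → + suc (index r)) (upTo n)       ≡⟨ ≡.cong (b ℤ.*_) (sumℤ-map (λ i → + suc i) index (upTo n)) ⟨
          b ℤ.* sumℤ (λ i → + suc i) (map index (upTo n))   ≡⟨ ≡.cong (b ℤ.*_) (sumℤ-↭ {f = λ i → + suc i} p) ⟨
          b ℤ.* sumℤ (λ i → + suc i) (upTo n)               ∎) ⟩
    b ℤ.* sumℤ (λ i → + suc i) (upTo n) ℤ.- sumℤ +_ (upTo n) ∎
    where
    open ≡-Reasoning
    lemma : ∀ n u r → n ℤ.* u ≡ (r ℤ.+ u ℤ.* n) ℤ.- r
    lemma = solve-∀

-- subdiag r is the exponent of the entry below the diagonal in cyclic order: it pairs column r with row r - 1.
-- Moving from column k to column k + 1 turns diag into subdiag, because a (i + 1) ≡ (a + 1)(k + 1) implies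
-- a (i + 2) ≡ (a + 1)(k + 2) - 1.
module CyclicExponents (a : ℤ) (m : ℕ)
  (cancel : Cancellative (suc m) a) (cancel′ : Cancellative (suc m) (a ℤ.+ 1ℤ))
  (rows : ResidueInverse a (suc m)) (columns : ResidueInverse (a ℤ.+ 1ℤ) (suc m)) where

  private
    n : ℕ
    n = suc m

  open ResidueInverse rows using () renaming (index to I; quot to u; index< to I<n; equation to I-equation)
  open ResidueInverse columns using () renaming (quot to v; equation to K-equation)
  private
    module I = ResidueInverseProperties cancel rows
    module K = ResidueInverseProperties cancel′ columns

  diag subdiag : ℕ → ℤ
  diag r = v r ℤ.- u r
  subdiag zero    = v 0 ℤ.- u m ℤ.- 1ℤ
  subdiag (suc r) = v (suc r) ℤ.- u r

  column-equation : ∀ {k} → k ℕ.< n → (a ℤ.+ 1ℤ) ℤ.* + suc k ≡ + K.residue k ℤ.+ v (K.residue k) ℤ.* + n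
  column-equation {k} k<n =
    ≡.subst (λ j → (a ℤ.+ 1ℤ) ℤ.* + suc j ≡ + K.residue k ℤ.+ v (K.residue k) ℤ.* + n) (K.index-residue k<n) (K-equation (K.residue k))

  -- Column `n` and row `n` both have residue `0`, with quotients `a + 1` and `a`. This exponent
  -- supplies the `q` in the cyclic sum `q - 1`.
  diag-last : diag (K.residue m) ≡ 1ℤ
  diag-last = ≡.trans (≡.cong (λ z → v r ℤ.- z) (I.quot-unique (v r ℤ.- 1ℤ) ℕ.≤-refl eq)) (lemma₂ (v r))
    where
    r = K.residue m
    lemma₁ : ∀ a n r z → (a ℤ.+ 1ℤ) ℤ.* n ≡ r ℤ.+ z ℤ.* n → a ℤ.* n ≡ r ℤ.+ (z ℤ.- 1ℤ) ℤ.* n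
    lemma₁ a n r z eq = ≡.trans (step₁ a n) (≡.trans (≡.cong (ℤ._- n) eq) (step₂ n r z))
      where
      step₁ : ∀ a n → a ℤ.* n ≡ (a ℤ.+ 1ℤ) ℤ.* n ℤ.- n
      step₁ = solve-∀
      step₂ : ∀ n r z → (r ℤ.+ z ℤ.* n) ℤ.- n ≡ r ℤ.+ (z ℤ.- 1ℤ) ℤ.* n
      step₂ = solve-∀
    eq : a ℤ.* + n ≡ + r ℤ.+ (v r ℤ.- 1ℤ) ℤ.* + n
    eq = lemma₁ a (+ n) (+ r) (v r) (column-equation ℕ.≤-refl)
    lemma₂ : ∀ z → z ℤ.- (z ℤ.- 1ℤ) ≡ 1ℤ
    lemma₂ = solve-∀

  -- Cyclically the residue before `0` is `m = n - 1`, which is `-1` with one `n` taken from the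
  -- quotient. The `- 1ℤ` in `subdiag zero` compensates for it, so both cases obey one formula in
  -- `r - 1`.
  subdiag-unique : ∀ {i} r z → i ℕ.< n → a ℤ.* + suc i ≡ (+ r ℤ.- 1ℤ) ℤ.+ z ℤ.* + n → subdiag r ≡ v r ℤ.- z
  subdiag-unique zero z i<n eq = ≡.trans
    (≡.cong (λ w → v 0 ℤ.- w ℤ.- 1ℤ) (I.quot-unique (z ℤ.- 1ℤ) i<n (≡.trans eq (lemma₁ (+ m) z)))) (lemma₂ (v 0) z)
    where
    lemma₁ : ∀ m z → (0ℤ ℤ.- 1ℤ) ℤ.+ z ℤ.* (1ℤ ℤ.+ m) ≡ m ℤ.+ (z ℤ.- 1ℤ) ℤ.* (1ℤ ℤ.+ m)
    lemma₁ = solve-∀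
    lemma₂ : ∀ v z → v ℤ.- (z ℤ.- 1ℤ) ℤ.- 1ℤ ≡ v ℤ.- z
    lemma₂ = solve-∀
  subdiag-unique (suc r) z i<n eq = ≡.cong (λ w → v (suc r) ℤ.- w) (I.quot-unique z i<n (≡.trans eq (lemma (+ r) (z ℤ.* + n))))
    where
    lemma : ∀ r c → (1ℤ ℤ.+ r ℤ.- 1ℤ) ℤ.+ c ≡ r ℤ.+ c
    lemma = solve-∀

  -- From `a = (a + 1) - 1`, row `1` has the residue cyclically preceding that of column `1`. This
  -- exponent supplies the `1` in the cyclic sum `q - 1`.
  subdiag-first : subdiag (K.residue 0) ≡ 0ℤ
  subdiag-first = ≡.trans (subdiag-unique r (v r) ℕ.z<s (≡.trans (lemma₁ a) (≡.trans (≡.cong (ℤ._- 1ℤ) (column-equation ℕ.z<s)) (lemma₂ (+ r) (v r ℤ.* + n)))))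
    (ℤ.+-inverseʳ (v r))
    where
    r = K.residue 0
    lemma₁ : ∀ a → a ℤ.* 1ℤ ≡ (a ℤ.+ 1ℤ) ℤ.* 1ℤ ℤ.- 1ℤ
    lemma₁ = solve-∀
    lemma₂ : ∀ r c → (r ℤ.+ c) ℤ.- 1ℤ ≡ (r ℤ.- 1ℤ) ℤ.+ c
    lemma₂ = solve-∀

  subdiag-next : ∀ {k} → k ℕ.< m → subdiag (K.residue (suc k)) ≡ diag (K.residue k)
  subdiag-next {k} k<m = ≡.trans (subdiag-unique r⁺ (v r⁺ ℤ.- v r ℤ.+ u r) (ℕ.≤∧≢⇒< (I<n r) notLast) next-equation) (lemma₃ (v r⁺) (v r) (u r))
    where
    r = K.residue k
    r⁺ = K.residue (suc k)
    open ≡-Reasoning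
    -- The desired right-hand side plus a combination of the defects of three defining equations:
    -- row `i + 1`, column `k + 2` and column `k + 1`. All three defects are zero.
    lemma₁ : ∀ a i k n r r⁺ u v v⁺ → a ℤ.* (+ 2 ℤ.+ i) ≡
      (r⁺ ℤ.- 1ℤ ℤ.+ (v⁺ ℤ.- v ℤ.+ u) ℤ.* n) ℤ.+ ((a ℤ.* (1ℤ ℤ.+ i) ℤ.- (r ℤ.+ u ℤ.* n))
        ℤ.+ (((a ℤ.+ 1ℤ) ℤ.* (+ 2 ℤ.+ k) ℤ.- (r⁺ ℤ.+ v⁺ ℤ.* n)) ℤ.- ((a ℤ.+ 1ℤ) ℤ.* (1ℤ ℤ.+ k) ℤ.- (r ℤ.+ v ℤ.* n))))
    lemma₁ = solve-∀
    lemma₂ : ∀ z → z ℤ.+ (0ℤ ℤ.+ (0ℤ ℤ.- 0ℤ)) ≡ z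
    lemma₂ = solve-∀
    lemma₃ : ∀ v⁺ v u → v⁺ ℤ.- (v⁺ ℤ.- v ℤ.+ u) ≡ v ℤ.- u
    lemma₃ = solve-∀
    next-equation : a ℤ.* + suc (suc (I r)) ≡ (+ r⁺ ℤ.- 1ℤ) ℤ.+ (v r⁺ ℤ.- v r ℤ.+ u r) ℤ.* + n
    next-equation = ≡.trans (lemma₁ a (+ I r) (+ k) (+ n) (+ r) (+ r⁺) (u r) (v r) (v r⁺)) (≡.trans
      (≡.cong₂ (λ y z → target ℤ.+ (y ℤ.+ z)) (ℤ.i≡j⇒i-j≡0 (I-equation r))
        (≡.cong₂ ℤ._-_ (ℤ.i≡j⇒i-j≡0 (column-equation (ℕ.s<s k<m))) (ℤ.i≡j⇒i-j≡0 (column-equation (ℕ.m<n⇒m<1+n k<m)))))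
      (lemma₂ target))
      where target = (+ r⁺ ℤ.- 1ℤ) ℤ.+ (v r⁺ ℤ.- v r ℤ.+ u r) ℤ.* + n
    -- If row r were the last one then n would divide (a + 1)(k + 1).
    notLast : suc (I r) ≢ n
    notLast I≡ = ℕ∣.>⇒∤ (ℕ.s<s k<m) (∣⇒∣ᵤ (cancel′ (divides (a ℤ.+ v r ℤ.- u r) (begin
      (a ℤ.+ 1ℤ) ℤ.* + suc k
        ≡⟨ column-equation (ℕ.m<n⇒m<1+n k<m) ⟩
      + r ℤ.+ v r ℤ.* + n
        ≡⟨ lemma₄ (+ r) (u r) (v r) (+ n) ⟩
      (+ r ℤ.+ u r ℤ.* + n) ℤ.+ (v r ℤ.- u r) ℤ.* + n
        ≡⟨ ≡.cong (ℤ._+ (v r ℤ.- u r) ℤ.* + n) (≡.trans (≡.sym (I-equation r)) (≡.cong (λ j → a ℤ.* + j) I≡)) ⟩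
      a ℤ.* + n ℤ.+ (v r ℤ.- u r) ℤ.* + n
        ≡⟨ lemma₅ a (u r) (v r) (+ n) ⟩
      (a ℤ.+ v r ℤ.- u r) ℤ.* + n ∎))))
      where
      lemma₄ : ∀ r u v n → r ℤ.+ v ℤ.* n ≡ (r ℤ.+ u ℤ.* n) ℤ.+ (v ℤ.- u) ℤ.* n
      lemma₄ = solve-∀
      lemma₅ : ∀ a u v n → a ℤ.* n ℤ.+ (v ℤ.- u) ℤ.* n ≡ (a ℤ.+ v ℤ.- u) ℤ.* n
      lemma₅ = solve-∀

-- Determinants of matrices indexed by lists

-- A ring solver has to compare coefficients, and equality in `R` is not decidable. Taking the
-- coefficients in ℤ, mapped into `R`, makes cancellation of terms decidable.
module IntegerSolver {c ℓ} (R : CommutativeRing c ℓ) where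

  open CommutativeRing R
  open import Algebra.Definitions.RawSemiring (Semiring.rawSemiring semiring) using (_×′_)
  open import Algebra.Properties.Semiring.Mult.TCOptimised semiring using (×1-homo-*)
  open import Algebra.Properties.Monoid.Mult.TCOptimised +-monoid using (1+×; ×-homo-+)
  open import Algebra.Properties.Ring ring using (-‿distribˡ-*; -‿distribʳ-*; -0#≈0#; -‿involutive; -‿anti-homo-+)
  open import Relation.Binary.Reasoning.Setoid setoid

  -- With `_×′_` in place of the `_×_` of `fromℤ`, the image of `1ℤ` reduces to `1#` itself, so
  -- `con 1ℤ` matches the goals literally.
  ⟦_⟧ : ℤ → Carrier
  ⟦ + m ⟧      = m ×′ 1#
  ⟦ -[1+ m ] ⟧ = - (suc m ×′ 1#)

  ⟦-⟧-homo : ∀ i → ⟦ ℤ.- i ⟧ ≈ - ⟦ i ⟧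
  ⟦-⟧-homo (+ zero)    = sym -0#≈0#
  ⟦-⟧-homo (+ (suc m)) = refl
  ⟦-⟧-homo -[1+ m ]    = sym (-‿involutive _)

  cancel-1 : ∀ x y → (1# + x) - (1# + y) ≈ x - y
  cancel-1 x y = begin
    (1# + x) - (1# + y)       ≈⟨ +-cong (+-comm 1# x) (-‿anti-homo-+ 1# y) ⟩
    (x + 1#) + (- y - 1#)     ≈⟨ +-congˡ (+-comm (- y) (- 1#)) ⟩
    (x + 1#) + (- 1# - y)     ≈⟨ +-assoc x 1# (- 1# - y) ⟩
    x + (1# + (- 1# - y))     ≈⟨ +-congˡ (+-assoc 1# (- 1#) (- y)) ⟨
    x + ((1# - 1#) - y)       ≈⟨ +-congˡ (+-congʳ (-‿inverseʳ 1#)) ⟩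
    x + (0# - y)              ≈⟨ +-congˡ (+-identityˡ (- y)) ⟩
    x - y                     ∎

  ⟦⊖⟧-homo : ∀ m n → ⟦ m ℤ.⊖ n ⟧ ≈ m ×′ 1# - n ×′ 1#
  ⟦⊖⟧-homo m zero = sym (trans (+-congˡ -0#≈0#) (+-identityʳ _))
  ⟦⊖⟧-homo zero (suc n) = sym (+-identityˡ _)
  ⟦⊖⟧-homo (suc m) (suc n) = begin
    ⟦ suc m ℤ.⊖ suc n ⟧               ≡⟨ ≡.cong ⟦_⟧ (ℤ.[1+m]⊖[1+n]≡m⊖n m n) ⟩
    ⟦ m ℤ.⊖ n ⟧                       ≈⟨ ⟦⊖⟧-homo m n ⟩
    m ×′ 1# - n ×′ 1#                 ≈⟨ cancel-1 _ _ ⟨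
    (1# + m ×′ 1#) - (1# + n ×′ 1#)   ≈⟨ +-cong (1+× m 1#) (-‿cong (1+× n 1#)) ⟨
    suc m ×′ 1# - suc n ×′ 1#         ∎

  ⟦+⟧-homo : ∀ i j → ⟦ i ℤ.+ j ⟧ ≈ ⟦ i ⟧ + ⟦ j ⟧
  ⟦+⟧-homo (+ m)    (+ n)    = ×-homo-+ 1# m n
  ⟦+⟧-homo (+ m)    -[1+ n ] = ⟦⊖⟧-homo m (suc n)
  ⟦+⟧-homo -[1+ m ] (+ n)    = trans (⟦⊖⟧-homo n (suc m)) (+-comm _ _)
  ⟦+⟧-homo -[1+ m ] -[1+ n ] = begin
    - (suc (suc (m ℕ.+ n)) ×′ 1#)       ≡⟨ ≡.cong (λ k → - (suc k ×′ 1#)) (ℕ.+-suc m n) ⟨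
    - ((suc m ℕ.+ suc n) ×′ 1#)         ≈⟨ -‿cong (trans (×-homo-+ 1# (suc m) (suc n)) (+-comm _ _)) ⟩
    - (suc n ×′ 1# + suc m ×′ 1#)       ≈⟨ -‿anti-homo-+ _ _ ⟩
    - (suc m ×′ 1#) - (suc n ×′ 1#)     ∎

  ⟦+*⟧-homo : ∀ m j → ⟦ + m ℤ.* j ⟧ ≈ ⟦ + m ⟧ * ⟦ j ⟧
  ⟦+*⟧-homo m (+ n) = begin
    ⟦ + m ℤ.* + n ⟧       ≡⟨ ≡.cong ⟦_⟧ (ℤ.pos-* m n) ⟨
    (m ℕ.* n) ×′ 1#       ≈⟨ ×1-homo-* m n ⟩
    m ×′ 1# * n ×′ 1#     ∎
  ⟦+*⟧-homo m -[1+ n ] = begin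
    ⟦ + m ℤ.* -[1+ n ] ⟧          ≡⟨ ≡.cong ⟦_⟧ (ℤ.neg-distribʳ-* (+ m) (+ suc n)) ⟨
    ⟦ ℤ.- (+ m ℤ.* + suc n) ⟧     ≈⟨ ⟦-⟧-homo (+ m ℤ.* + suc n) ⟩
    - ⟦ + m ℤ.* + suc n ⟧         ≈⟨ -‿cong (⟦+*⟧-homo m (+ suc n)) ⟩
    - (⟦ + m ⟧ * ⟦ + suc n ⟧)     ≈⟨ -‿distribʳ-* _ _ ⟩
    ⟦ + m ⟧ * ⟦ -[1+ n ] ⟧        ∎

  ⟦*⟧-homo : ∀ i j → ⟦ i ℤ.* j ⟧ ≈ ⟦ i ⟧ * ⟦ j ⟧
  ⟦*⟧-homo (+ m) j = ⟦+*⟧-homo m j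
  ⟦*⟧-homo -[1+ m ] j = begin
    ⟦ -[1+ m ] ℤ.* j ⟧          ≡⟨ ≡.cong ⟦_⟧ (ℤ.neg-distribˡ-* (+ suc m) j) ⟨
    ⟦ ℤ.- (+ suc m ℤ.* j) ⟧     ≈⟨ ⟦-⟧-homo (+ suc m ℤ.* j) ⟩
    - ⟦ + suc m ℤ.* j ⟧         ≈⟨ -‿cong (⟦+*⟧-homo (suc m) j) ⟩
    - (⟦ + suc m ⟧ * ⟦ j ⟧)     ≈⟨ -‿distribˡ-* _ _ ⟩
    ⟦ -[1+ m ] ⟧ * ⟦ j ⟧        ∎

  morphism : ℤ.+-*-rawRing ACR.-Raw-AlmostCommutative⟶ ACR.fromCommutativeRing R
  morphism = record
    { ⟦_⟧    = ⟦_⟧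
    ; +-homo = ⟦+⟧-homo
    ; *-homo = ⟦*⟧-homo
    ; -‿homo = ⟦-⟧-homo
    ; 0-homo = refl
    ; 1-homo = refl
    }

  _≟_ : ∀ i j → Maybe (⟦ i ⟧ ≈ ⟦ j ⟧)
  i ≟ j with i ℤ.≟ j
  ... | yes ≡.refl = just refl
  ... | no  _      = nothing

  open Algebra.Solver.Ring ℤ.+-*-rawRing (ACR.fromCommutativeRing R) morphism _≟_ public
    using (solve; _:=_; _:+_; _:*_; :-_; _:-_; con)

module Determinant {c ℓ} (R : CommutativeRing c ℓ) where

  open CommutativeRing R hiding (zero)
  open OverRing R
  open IntegerSolver R
  open import Algebra.Properties.Ring ring using (-0#≈0#; -1*x≈-x)
  open import Algebra.Properties.Semiring.Sum semiring using (*-distribˡ-sum; sum-cong-≋)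
  open import Relation.Binary.Reasoning.Setoid setoid

  -- For a row f and a form g in k columns, the Laplace expansion of the form f ∧ g in k + 1 columns.
  expand : (B → Carrier) → (List B → Carrier) → List B → Carrier
  expand f g []       = 0#
  expand f g (y ∷ ys) = f y * g ys - expand f (g ∘ (y ∷_)) ys

  -- The value 0 on nonempty lists makes Det invariant under transposition also for nonsquare matrices.
  emptyDet : List B → Carrier
  emptyDet []      = 1#
  emptyDet (_ ∷ _) = 0#

  -- Lists as index sets turn reorderings of rows and columns into instances of `_↭[_]_`. Each row
  -- acts as a linear form wedged in front of the remaining ones, so multilinear arguments need no
  -- positions.
  Det : (A → B → Carrier) → List A → List B → Carrier
  Det F []       = emptyDet
  Det F (x ∷ xs) = expand (F x) (Det F xs)

  expand-cong : ∀ {f f′ : B → Carrier} {g g′} ys → (∀ {y} → y ∈ ys → f y ≈ f′ y) →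
                (∀ {zs} → zs ⊆ ys → g zs ≈ g′ zs) → expand f g ys ≈ expand f′ g′ ys
  expand-cong []       _   _   = refl
  expand-cong (y ∷ ys) f≈f′ g≈g′ = +-cong (*-cong (f≈f′ (here ≡.refl)) (g≈g′ there))
    (-‿cong (expand-cong ys (f≈f′ ∘ there) λ zs⊆ys → g≈g′ λ { (here eq) → here eq ; (there z∈) → there (zs⊆ys z∈) }))

  expand-congʳ : ∀ {f : B → Carrier} {g g′} → (∀ zs → g zs ≈ g′ zs) → ∀ ys → expand f g ys ≈ expand f g′ ys
  expand-congʳ g≈g′ ys = expand-cong ys (λ _ → refl) (λ {zs} _ → g≈g′ zs)

  Det-cong : ∀ {F G : A → B → Carrier} xs ys → (∀ {x y} → x ∈ xs → y ∈ ys → F x y ≈ G x y) → Det F xs ys ≈ Det G xs ys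
  Det-cong []       ys F≈G = refl
  Det-cong (x ∷ xs) ys F≈G = expand-cong ys (F≈G (here ≡.refl))
    λ {zs} zs⊆ys → Det-cong xs zs λ x∈ y∈ → F≈G (there x∈) (zs⊆ys y∈)

  expand-zeroˡ : ∀ {f : B → Carrier} {g} ys → (∀ {y} → y ∈ ys → f y ≈ 0#) → expand f g ys ≈ 0#
  expand-zeroˡ []       _   = refl
  expand-zeroˡ {g = g} (y ∷ ys) f≈0 = begin
    _ * g ys - expand _ _ ys  ≈⟨ +-cong (*-congʳ (f≈0 (here ≡.refl))) (-‿cong (expand-zeroˡ ys (f≈0 ∘ there))) ⟩
    0# * g ys - 0#            ≈⟨ solve 1 (λ g → con 0ℤ :* g :- con 0ℤ := con 0ℤ) refl (g ys) ⟩
    0#                        ∎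

  expand-zeroʳ : ∀ {f : B → Carrier} ys → expand f (λ _ → 0#) ys ≈ 0#
  expand-zeroʳ []       = refl
  expand-zeroʳ {f = f} (y ∷ ys) = begin
    f y * 0# - expand f (λ _ → 0#) ys  ≈⟨ +-congˡ (-‿cong (expand-zeroʳ ys)) ⟩
    f y * 0# - 0#                      ≈⟨ solve 1 (λ f → f :* con 0ℤ :- con 0ℤ := con 0ℤ) refl (f y) ⟩
    0#                                 ∎

  expand-linearˡ : ∀ {f h : B → Carrier} {g} α β ys →
                   expand (λ y → α * f y + β * h y) g ys ≈ α * expand f g ys + β * expand h g ys
  expand-linearˡ α β [] = solve 2 (λ α β → con 0ℤ := α :* con 0ℤ :+ β :* con 0ℤ) refl α β
  expand-linearˡ {f = f} {h} {g} α β (y ∷ ys) = begin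
    (α * f y + β * h y) * g ys - expand (λ y → α * f y + β * h y) (g ∘ (y ∷_)) ys
      ≈⟨ +-congˡ (-‿cong (expand-linearˡ α β ys)) ⟩
    (α * f y + β * h y) * g ys - (α * ef + β * eh)
      ≈⟨ solve 7 (λ α β f h g ef eh → (α :* f :+ β :* h) :* g :- (α :* ef :+ β :* eh)
                    := α :* (f :* g :- ef) :+ β :* (h :* g :- eh)) refl α β (f y) (h y) (g ys) ef eh ⟩
    α * (f y * g ys - ef) + β * (h y * g ys - eh) ∎
    where
    ef = expand f (g ∘ (y ∷_)) ys
    eh = expand h (g ∘ (y ∷_)) ys

  expand-linearʳ : ∀ {f : B → Carrier} {g h} α β ys →
                   expand f (λ zs → α * g zs + β * h zs) ys ≈ α * expand f g ys + β * expand f h ys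
  expand-linearʳ α β [] = solve 2 (λ α β → con 0ℤ := α :* con 0ℤ :+ β :* con 0ℤ) refl α β
  expand-linearʳ {f = f} {g} {h} α β (y ∷ ys) = begin
    f y * (α * g ys + β * h ys) - expand f (λ zs → α * g (y ∷ zs) + β * h (y ∷ zs)) ys
      ≈⟨ +-congˡ (-‿cong (expand-linearʳ α β ys)) ⟩
    f y * (α * g ys + β * h ys) - (α * eg + β * eh)
      ≈⟨ solve 7 (λ α β f g h eg eh → f :* (α :* g :+ β :* h) :- (α :* eg :+ β :* eh)
                    := α :* (f :* g :- eg) :+ β :* (f :* h :- eh)) refl α β (f y) (g ys) (h ys) eg eh ⟩
    α * (f y * g ys - eg) + β * (f y * h ys - eh) ∎
    where
    eg = expand f (g ∘ (y ∷_)) ys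
    eh = expand f (h ∘ (y ∷_)) ys

  expand-axpyʳ : ∀ {f : B → Carrier} {g h} α ys →
                 expand f (λ zs → α * g zs - h zs) ys ≈ α * expand f g ys - expand f h ys
  expand-axpyʳ {f = f} {g} {h} α ys = begin
    expand f (λ zs → α * g zs - h zs) ys          ≈⟨ expand-congʳ (λ zs → +-congˡ (-1*x≈-x (h zs))) ys ⟨
    expand f (λ zs → α * g zs + - 1# * h zs) ys   ≈⟨ expand-linearʳ α (- 1#) ys ⟩
    α * expand f g ys + - 1# * expand f h ys      ≈⟨ +-congˡ (-1*x≈-x _) ⟩
    α * expand f g ys - expand f h ys             ∎

  expand-scaleʳ : ∀ {f : B → Carrier} {g} α ys → expand f (λ zs → α * g zs) ys ≈ α * expand f g ys
  expand-scaleʳ {f = f} {g} α ys = begin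
    expand f (λ zs → α * g zs) ys              ≈⟨ expand-congʳ (λ zs → lemma (α * g zs) (g zs)) ys ⟨
    expand f (λ zs → α * g zs + 0# * g zs) ys  ≈⟨ expand-linearʳ α 0# ys ⟩
    α * expand f g ys + 0# * expand f g ys     ≈⟨ lemma _ _ ⟩
    α * expand f g ys                          ∎
    where
    lemma : ∀ x y → x + 0# * y ≈ x
    lemma = solve 2 (λ x y → x :+ con 0ℤ :* y := x) refl

  expand-negʳ : ∀ {f : B → Carrier} {g} ys → expand f (λ zs → - g zs) ys ≈ - expand f g ys
  expand-negʳ {f = f} {g} ys = begin
    expand f (λ zs → - g zs) ys       ≈⟨ expand-congʳ (λ zs → -1*x≈-x (g zs)) ys ⟨
    expand f (λ zs → - 1# * g zs) ys  ≈⟨ expand-scaleʳ (- 1#) ys ⟩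
    - 1# * expand f g ys              ≈⟨ -1*x≈-x _ ⟩
    - expand f g ys                   ∎

  expand-swap : ∀ (f h : B → Carrier) g ys → expand f (expand h g) ys ≈ - expand h (expand f g) ys
  expand-swap f h g []       = sym -0#≈0#
  expand-swap f h g (y ∷ ys) = begin
    f y * expand h g ys - expand f (λ zs → h y * g zs - expand h g′ zs) ys
      ≈⟨ +-congˡ (-‿cong (expand-axpyʳ (h y) ys)) ⟩
    f y * expand h g ys - (h y * expand f g ys - expand f (expand h g′) ys)
      ≈⟨ +-congˡ (-‿cong (+-congˡ (-‿cong (expand-swap f h g′ ys)))) ⟩
    f y * expand h g ys - (h y * expand f g ys - - expand h (expand f g′) ys)
      ≈⟨ solve 5 (λ f h eh ef e → f :* eh :- (h :* ef :- :- e) := :- (h :* ef :- (f :* eh :- e)))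
           refl (f y) (h y) (expand h g ys) (expand f g ys) (expand h (expand f g′) ys) ⟩
    - (h y * expand f g ys - (f y * expand h g ys - expand h (expand f g′) ys))
      ≈⟨ -‿cong (+-congˡ (-‿cong (expand-axpyʳ (f y) ys))) ⟨
    - (h y * expand f g ys - expand h (λ zs → f y * g zs - expand f g′ zs) ys) ∎
    where g′ = g ∘ (y ∷_)

  -- Antisymmetry only shows that twice this value vanishes, and `2` may be a zero divisor in `R`;
  -- hence a separate induction, in which the two leading terms cancel.
  expand-repeat : ∀ (f : B → Carrier) g ys → expand f (expand f g) ys ≈ 0#
  expand-repeat f g []       = refl
  expand-repeat f g (y ∷ ys) = begin
    f y * expand f g ys - expand f (λ zs → f y * g zs - expand f g′ zs) ys
      ≈⟨ +-congˡ (-‿cong (expand-axpyʳ (f y) ys)) ⟩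
    f y * expand f g ys - (f y * expand f g ys - expand f (expand f g′) ys)
      ≈⟨ solve 2 (λ x y → x :- (x :- y) := y) refl (f y * expand f g ys) _ ⟩
    expand f (expand f g′) ys
      ≈⟨ expand-repeat f g′ ys ⟩
    0# ∎
    where g′ = g ∘ (y ∷_)

  signum : Sign → Carrier
  signum Sign.+ = 1#
  signum Sign.- = - 1#

  signum-* : ∀ s t → signum (s Sign.* t) ≈ signum s * signum t
  signum-* Sign.+ t      = sym (*-identityˡ _)
  signum-* Sign.- Sign.+ = sym (*-identityʳ _)
  signum-* Sign.- Sign.- = solve 0 (con 1ℤ := :- con 1ℤ :* :- con 1ℤ) refl

  signum-square : ∀ s → signum s * signum s ≈ 1#
  signum-square s = trans (sym (signum-* s s)) (reflexive (≡.cong signum (Sign.s*s≡+ s)))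

  Det-permuteRows : ∀ {F : A → B → Carrier} {s xs xs′} → xs ↭[ s ] xs′ → ∀ ys → Det F xs ys ≈ signum s * Det F xs′ ys
  Det-permuteRows ↭-refl       ys = sym (*-identityˡ _)
  Det-permuteRows (↭-prep x p) ys = trans (expand-congʳ (Det-permuteRows p) ys) (expand-scaleʳ _ ys)
  Det-permuteRows (↭-swap x y) ys = trans (expand-swap _ _ _ ys) (sym (-1*x≈-x _))
  Det-permuteRows {F = F} {xs = xs} {xs′} (↭-trans {s = s} {ys = ws} {t = t} p q) ys = begin
    Det F xs ys                            ≈⟨ Det-permuteRows p ys ⟩
    signum s * Det F ws ys                 ≈⟨ *-congˡ (Det-permuteRows q ys) ⟩
    signum s * (signum t * Det F xs′ ys)   ≈⟨ *-assoc _ _ _ ⟨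
    signum s * signum t * Det F xs′ ys     ≈⟨ *-congʳ (signum-* s t) ⟨
    signum (s Sign.* t) * Det F xs′ ys     ∎

  expand-comm : ∀ {f : B → Carrier} {h : A → Carrier} {G : List B → List A → Carrier} ys xs →
                expand f (λ zs → expand h (G zs) xs) ys ≈ expand h (λ ws → expand f (λ zs → G zs ws) ys) xs
  expand-comm []       xs = sym (expand-zeroʳ xs)
  expand-comm {f = f} {h} {G} (y ∷ ys) xs = begin
    f y * expand h (G ys) xs - expand f (λ zs → expand h (G (y ∷ zs)) xs) ys
      ≈⟨ +-congˡ (-‿cong (expand-comm ys xs)) ⟩
    f y * expand h (G ys) xs - expand h (λ ws → expand f (λ zs → G (y ∷ zs) ws) ys) xs
      ≈⟨ expand-axpyʳ (f y) xs ⟨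
    expand h (λ ws → f y * G ys ws - expand f (λ zs → G (y ∷ zs) ws) ys) xs ∎

  -- Laplace expansion of `flip F` along its first column. The corner terms agree, and in the
  -- remainder the expansion along column `x` commutes with the expansion along row `y`.
  Det-expandColumn : ∀ (F : A → B → Carrier) x xs ys →
                     expand (F x) (λ zs → Det (flip F) zs xs) ys ≈ Det (flip F) ys (x ∷ xs)
  Det-expandColumn F x xs []       = refl
  Det-expandColumn F x xs (y ∷ ys) = +-congˡ (-‿cong (begin
    expand (F x) (λ zs → expand (flip F y) (Det (flip F) zs) xs) ys
      ≈⟨ expand-comm ys xs ⟩
    expand (flip F y) (λ ws → expand (F x) (λ zs → Det (flip F) zs ws) ys) xs
      ≈⟨ expand-congʳ (λ ws → Det-expandColumn F x ws ys) xs ⟩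
    expand (flip F y) (λ ws → Det (flip F) ys (x ∷ ws)) xs ∎))

  Det-transpose : ∀ (F : A → B → Carrier) xs ys → Det F xs ys ≈ Det (flip F) ys xs
  Det-transpose F []       []       = refl
  Det-transpose F []       (y ∷ ys) = refl
  Det-transpose F (x ∷ xs) ys = trans (expand-congʳ (Det-transpose F xs) ys) (Det-expandColumn F x xs ys)

  Det-permuteColumns : ∀ {F : A → B → Carrier} {s} xs {ys ys′} → ys ↭[ s ] ys′ →
                       Det F xs ys ≈ signum s * Det F xs ys′
  Det-permuteColumns {F = F} xs {ys} {ys′} p =
    trans (Det-transpose F xs ys) (trans (Det-permuteRows p xs) (*-congˡ (sym (Det-transpose F xs ys′))))

  expand-tabulate : ∀ n (f : B → Carrier) g (κ : Fin (suc n) → B) →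
                    expand f g (tabulate κ) ≈ sum λ k → (- 1#) ^ toℕ k * (f (κ k) * g (tabulate (κ ∘ punchIn k)))
  expand-tabulate zero f g κ = solve 1 (λ x → x :- con 0ℤ := con 1ℤ :* x :+ con 0ℤ) refl _
  expand-tabulate (suc n) f g κ = begin
    f (κ Fin.zero) * g (tabulate (κ ∘ Fin.suc)) - expand f (g ∘ (κ Fin.zero ∷_)) (tabulate (κ ∘ Fin.suc))
      ≈⟨ +-cong (sym (*-identityˡ _)) (trans (-‿cong (expand-tabulate n f (g ∘ (κ Fin.zero ∷_)) (κ ∘ Fin.suc))) (sym (-1*x≈-x _))) ⟩
    1# * (f (κ Fin.zero) * g (tabulate (κ ∘ Fin.suc))) + - 1# * sum (λ k → (- 1#) ^ toℕ k * term k)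
      ≈⟨ +-congˡ (*-distribˡ-sum (- 1#) (λ k → (- 1#) ^ toℕ k * term k)) ⟩
    1# * (f (κ Fin.zero) * g (tabulate (κ ∘ Fin.suc))) + sum (λ k → - 1# * ((- 1#) ^ toℕ k * term k))
      ≈⟨ +-congˡ (sum-cong-≋ λ k → sym (*-assoc (- 1#) ((- 1#) ^ toℕ k) (term k))) ⟩
    sum (λ k → (- 1#) ^ toℕ k * (f (κ k) * g (tabulate (κ ∘ punchIn k)))) ∎
    where
    term : Fin (suc n) → Carrier
    term k = f (κ (Fin.suc k)) * g (κ Fin.zero ∷ tabulate (κ ∘ Fin.suc ∘ punchIn k))

  -- The labelling `κ` has to be arbitrary for the induction: deleting column `k` replaces it by
  -- `κ ∘ punchIn k`.
  det≈Det : ∀ n (F : A → B → Carrier) (ρ : Fin n → A) (κ : Fin n → B) →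
            det (λ i j → F (ρ i) (κ j)) ≈ Det F (tabulate ρ) (tabulate κ)
  det≈Det zero    F ρ κ = refl
  det≈Det (suc n) F ρ κ = trans
    (sum-cong-≋ λ k → *-congˡ {(- 1#) ^ toℕ k} (*-congˡ {F (ρ Fin.zero) (κ k)} (det≈Det n F (ρ ∘ Fin.suc) (κ ∘ punchIn k))))
    (sym (expand-tabulate n (F (ρ Fin.zero)) (Det F (tabulate (ρ ∘ Fin.suc))) κ))

  Det-map : ∀ {A A′ B B′ : Set} (F : A′ → B′ → Carrier) (ρ : A → A′) (κ : B → B′) xs ys →
            Det F (map ρ xs) (map κ ys) ≈ Det (λ x y → F (ρ x) (κ y)) xs ys
  Det-map F ρ κ []       []       = refl
  Det-map F ρ κ []       (_ ∷ _)  = refl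
  Det-map F ρ κ (x ∷ xs) ys = trans (expand-map (F (ρ x)) (Det F (map ρ xs)) ys) (expand-congʳ (Det-map F ρ κ xs) ys)
    where
    expand-map : ∀ f g ys → expand f g (map κ ys) ≈ expand (f ∘ κ) (g ∘ map κ) ys
    expand-map f g []       = refl
    expand-map f g (y ∷ ys) = +-congˡ (-‿cong (expand-map f (g ∘ (κ y ∷_)) ys))

  -- In wedge notation `v ∧ (f + d v) = v ∧ f`: the top row `v` is moved past one row at a time, and
  -- the added multiples die by `expand-repeat`.
  expand-addRow : ∀ {F G : A → B → Carrier} {v} (d : A → Carrier) xs ys →
                  (∀ {x y} → x ∈ xs → y ∈ ys → G x y ≈ F x y + d x * v y) →
                  expand v (Det G xs) ys ≈ expand v (Det F xs) ys
  expand-addRow {F = F} {G} {v} d xs ys G≈ = trans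
    (expand-cong ys (λ _ → refl) λ {zs} zs⊆ → Det-cong xs zs λ x∈ y∈ → G≈ x∈ (zs⊆ y∈))
    (go xs ys)
    where
    G′ : _ → _ → Carrier
    G′ x y = F x y + d x * v y
    go : ∀ xs ys → expand v (Det G′ xs) ys ≈ expand v (Det F xs) ys
    go []       ys = refl
    go (x ∷ xs) ys = begin
      expand v (expand (G′ x) (Det G′ xs)) ys
        ≈⟨ expand-swap v (G′ x) _ ys ⟩
      - expand (G′ x) (expand v (Det G′ xs)) ys
        ≈⟨ -‿cong (expand-congʳ (go xs) ys) ⟩
      - expand (G′ x) (expand v (Det F xs)) ys
        ≈⟨ -‿cong (expand-cong ys (λ _ → +-congʳ (sym (*-identityˡ _))) λ _ → refl) ⟩
      - expand (λ y → 1# * F x y + d x * v y) (expand v (Det F xs)) ys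
        ≈⟨ -‿cong (expand-linearˡ 1# (d x) ys) ⟩
      - (1# * expand (F x) (expand v (Det F xs)) ys + d x * expand v (expand v (Det F xs)) ys)
        ≈⟨ -‿cong (+-cong (*-congˡ (expand-swap (F x) v _ ys)) (*-congˡ (expand-repeat v _ ys))) ⟩
      - (1# * - expand v (expand (F x) (Det F xs)) ys + d x * 0#)
        ≈⟨ solve 2 (λ e d → :- (con 1ℤ :* :- e :+ d :* con 0ℤ) := e) refl _ (d x) ⟩
      expand v (expand (F x) (Det F xs)) ys ∎

  Det-zeroColumn : ∀ {F : A → B → Carrier} xs y ys → (∀ {x} → x ∈ xs → F x y ≈ 0#) → Det F xs (y ∷ ys) ≈ 0#
  Det-zeroColumn []       y ys _   = refl
  Det-zeroColumn {F = F} (x ∷ xs) y ys F≈0 = begin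
    F x y * Det F xs ys - expand (F x) (λ zs → Det F xs (y ∷ zs)) ys
      ≈⟨ +-cong (*-congʳ (F≈0 (here ≡.refl)))
           (-‿cong (trans (expand-congʳ (λ zs → Det-zeroColumn xs y zs (F≈0 ∘ there)) ys) (expand-zeroʳ ys))) ⟩
    0# * Det F xs ys - 0#
      ≈⟨ solve 1 (λ e → con 0ℤ :* e :- con 0ℤ := con 0ℤ) refl _ ⟩
    0# ∎

  expand-zeroColumn : ∀ {F : A → B → Carrier} {v} xs y ys → (∀ {x} → x ∈ xs → F x y ≈ 0#) →
                      expand v (Det F xs) (y ∷ ys) ≈ v y * Det F xs ys
  expand-zeroColumn {F = F} {v} xs y ys F≈0 = begin
    v y * Det F xs ys - expand v (λ zs → Det F xs (y ∷ zs)) ys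
      ≈⟨ +-congˡ (-‿cong (trans (expand-congʳ (λ zs → Det-zeroColumn xs y zs F≈0) ys) (expand-zeroʳ ys))) ⟩
    v y * Det F xs ys - 0#
      ≈⟨ solve 1 (λ e → e :- con 0ℤ := e) refl _ ⟩
    v y * Det F xs ys ∎

  -- Relative to `f₀`, the other two forms are `f₀ + (β - α) h` and `f₀ + (γ - α) h`. Every term of
  -- the expanded wedge product then repeats `f₀` or `h`.
  expand-threeDependent : ∀ {v h : B → Carrier} {g} {f₀ f₁ f₂ : B → Carrier} α β γ ys →
    (∀ y → f₀ y ≈ v y + α * h y) → (∀ y → f₁ y ≈ v y + β * h y) → (∀ y → f₂ y ≈ v y + γ * h y) →
    expand f₀ (expand f₁ (expand f₂ g)) ys ≈ 0#
  expand-threeDependent {v = v} {h} {g} {f₀} {f₁} {f₂} α β γ ys f₀≈ f₁≈ f₂≈ = begin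
    expand f₀ (expand f₁ (expand f₂ g)) ys
      ≈⟨ expand-congʳ (λ zs → trans (expand-cong zs (λ {y} _ → shift β (f₁≈ y)) λ _ → refl) (expand-linearˡ 1# (β - α) zs)) ys ⟩
    expand f₀ (λ zs → 1# * expand f₀ (expand f₂ g) zs + (β - α) * expand h (expand f₂ g) zs) ys
      ≈⟨ expand-linearʳ 1# (β - α) ys ⟩
    1# * expand f₀ (expand f₀ (expand f₂ g)) ys + (β - α) * expand f₀ (expand h (expand f₂ g)) ys
      ≈⟨ +-cong (*-congˡ (expand-repeat f₀ _ ys)) (*-congˡ (expand-congʳ (λ zs → expand-congʳ (λ ws →
           trans (expand-cong ws (λ {y} _ → shift γ (f₂≈ y)) λ _ → refl) (expand-linearˡ 1# (γ - α) ws)) zs) ys)) ⟩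
    1# * 0# + (β - α) * expand f₀ (expand h (λ ws → 1# * expand f₀ g ws + (γ - α) * expand h g ws)) ys
      ≈⟨ +-congˡ (*-congˡ (expand-congʳ (λ zs → trans (expand-linearʳ 1# (γ - α) zs)
           (+-cong (*-congˡ (expand-swap h f₀ g zs)) (*-congˡ (expand-repeat h g zs)))) ys)) ⟩
    1# * 0# + (β - α) * expand f₀ (λ zs → 1# * - expand f₀ (expand h g) zs + (γ - α) * 0#) ys
      ≈⟨ +-congˡ (*-congˡ (trans (expand-congʳ (λ zs → solve 2 (λ e d → con 1ℤ :* :- e :+ d :* con 0ℤ := :- e) refl _ (γ - α)) ys)
           (trans (expand-negʳ ys) (-‿cong (expand-repeat f₀ _ ys))))) ⟩
    1# * 0# + (β - α) * - 0#
      ≈⟨ solve 1 (λ d → con 1ℤ :* con 0ℤ :+ d :* :- con 0ℤ := con 0ℤ) refl (β - α) ⟩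
    0# ∎
    where
    shift : ∀ {e y} δ → e ≈ v y + δ * h y → e ≈ 1# * f₀ y + (δ - α) * h y
    shift {e} {y} δ e≈ = begin
      e                                          ≈⟨ e≈ ⟩
      v y + δ * h y                              ≈⟨ solve 4 (λ v h α δ → v :+ δ :* h := con 1ℤ :* (v :+ α :* h) :+ (δ :- α) :* h) refl (v y) (h y) α δ ⟩
      1# * (v y + α * h y) + (δ - α) * h y       ≈⟨ +-congʳ (*-congˡ (f₀≈ y)) ⟨
      1# * f₀ y + (δ - α) * h y                  ∎

  ∑ ∏ : (A → Carrier) → List A → Carrier
  ∑ f = foldr (λ x e → f x + e) 0#
  ∏ f = foldr (λ x e → f x * e) 1#

  Det-scaleRows : ∀ (F : A → B → Carrier) (α : A → Carrier) xs ys →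
                  Det (λ x y → α x * F x y) xs ys ≈ ∏ α xs * Det F xs ys
  Det-scaleRows F α []       ys = sym (*-identityˡ _)
  Det-scaleRows F α (x ∷ xs) ys = begin
    expand (λ y → α x * F x y) (Det (λ x y → α x * F x y) xs) ys
      ≈⟨ expand-cong ys (λ {y} _ → solve 2 (λ α f → α :* f := α :* f :+ con 0ℤ :* f) refl (α x) (F x y))
                        (λ {zs} _ → Det-scaleRows F α xs zs) ⟩
    expand (λ y → α x * F x y + 0# * F x y) (λ zs → ∏ α xs * Det F xs zs) ys
      ≈⟨ expand-linearˡ (α x) 0# ys ⟩
    α x * expand (F x) (λ zs → ∏ α xs * Det F xs zs) ys + 0# * expand (F x) (λ zs → ∏ α xs * Det F xs zs) ys
      ≈⟨ +-cong (*-congˡ (expand-scaleʳ (∏ α xs) ys)) refl ⟩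
    α x * (∏ α xs * expand (F x) (Det F xs) ys) + 0# * expand (F x) (λ zs → ∏ α xs * Det F xs zs) ys
      ≈⟨ solve 4 (λ α β e e′ → α :* (β :* e) :+ con 0ℤ :* e′ := α :* β :* e) refl (α x) (∏ α xs) _ _ ⟩
    α x * ∏ α xs * expand (F x) (Det F xs) ys ∎

  Det-scaleColumns : ∀ (F : A → B → Carrier) (β : B → Carrier) xs ys →
                     Det (λ x y → β y * F x y) xs ys ≈ ∏ β ys * Det F xs ys
  Det-scaleColumns F β xs ys = begin
    Det (λ x y → β y * F x y) xs ys      ≈⟨ Det-transpose _ xs ys ⟩
    Det (λ y x → β y * F x y) ys xs      ≈⟨ Det-scaleRows (flip F) β ys xs ⟩
    ∏ β ys * Det (flip F) ys xs          ≈⟨ *-congˡ (Det-transpose F xs ys) ⟨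
    ∏ β ys * Det F xs ys                 ∎

  -- Rank one updates and the staircase determinant

  δ : ℕ → ℕ → Carrier
  δ i j = if does (i ℕ.≟ j) then 1# else 0#

  δ-diagonal : ∀ i → δ i i ≈ 1#
  δ-diagonal i = reflexive (≡.cong (if_then 1# else 0#) (dec-true (i ℕ.≟ i) ≡.refl))

  δ-offDiagonal : ∀ {i j} → i ≢ j → δ i j ≈ 0#
  δ-offDiagonal {i} {j} i≢j = reflexive (≡.cong (if_then 1# else 0#) (dec-false (i ℕ.≟ j) i≢j))

  Det-diagonal : ∀ c {xs} → Unique xs → Det (λ i j → c * δ i j) xs xs ≈ c ^ length xs
  Det-diagonal c []                     = refl
  Det-diagonal c {x ∷ xs} (x∉xs ∷ xs!) = begin
    expand (λ j → c * δ x j) (Det (λ i j → c * δ i j) xs) (x ∷ xs)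
      ≈⟨ expand-zeroColumn xs x xs (λ z∈ → trans (*-congˡ (δ-offDiagonal (≡.≢-sym (All.lookup x∉xs z∈)))) (zeroʳ c)) ⟩
    c * δ x x * Det (λ i j → c * δ i j) xs xs
      ≈⟨ *-cong (trans (*-congˡ (δ-diagonal x)) (*-identityʳ c)) (Det-diagonal c xs!) ⟩
    c * c ^ length xs ∎

  -- The matrix determinant lemma in a form without division by `c`. The first row splits into a
  -- multiple of `v`, below which the rank one part of the other rows disappears, and a multiple of
  -- a unit vector, which leaves the induction hypothesis. For the empty list the truncated exponent
  -- multiplies an empty sum.
  Det-rankOneUpdate : ∀ c (d v : ℕ → Carrier) {xs} → Unique xs →
    Det (λ i j → d i * v j + c * δ i j) xs xs ≈ c ^ length xs + c ^ (length xs ℕ.∸ 1) * ∑ (λ i → d i * v i) xs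
  Det-rankOneUpdate c d v []                     = solve 0 (con 1ℤ := con 1ℤ :+ con 1ℤ :* con 0ℤ) refl
  Det-rankOneUpdate c d v {x ∷ xs} (x∉xs ∷ xs!) = begin
    expand (λ j → d x * v j + c * δ x j) (Det M xs) (x ∷ xs)
      ≈⟨ expand-linearˡ {g = Det M xs} (d x) c (x ∷ xs) ⟩
    d x * expand v (Det M xs) (x ∷ xs) + c * expand (δ x) (Det M xs) (x ∷ xs)
      ≈⟨ +-cong (*-congˡ rank-one-row) (*-congˡ unit-row) ⟩
    d x * (v x * c ^ length xs) + c * (c ^ length xs + c ^ (length xs ℕ.∸ 1) * S)
      ≈⟨ solve 6 (λ c d v C C′ S → d :* (v :* C) :+ c :* (C :+ C′ :* S) := c :* C :+ (d :* v :* C :+ c :* (C′ :* S)))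
           refl c (d x) (v x) (c ^ length xs) (c ^ (length xs ℕ.∸ 1)) S ⟩
    c * c ^ length xs + (d x * v x * c ^ length xs + c * (c ^ (length xs ℕ.∸ 1) * S))
      ≈⟨ +-congˡ (+-congˡ (raise xs)) ⟩
    c * c ^ length xs + (d x * v x * c ^ length xs + c ^ length xs * S)
      ≈⟨ solve 4 (λ e dv C S → e :+ (dv :* C :+ C :* S) := e :+ C :* (dv :+ S)) refl (c * c ^ length xs) (d x * v x) (c ^ length xs) S ⟩
    c * c ^ length xs + c ^ length xs * (d x * v x + S) ∎
    where
    M : ℕ → ℕ → Carrier
    M i j = d i * v j + c * δ i j
    S = ∑ (λ i → d i * v i) xs
    raise : ∀ xs → c * (c ^ (length xs ℕ.∸ 1) * ∑ (λ i → d i * v i) xs) ≈ c ^ length xs * ∑ (λ i → d i * v i) xs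
    raise []       = solve 1 (λ c → c :* (con 1ℤ :* con 0ℤ) := con 1ℤ :* con 0ℤ) refl c
    raise (x ∷ xs) = sym (*-assoc _ _ _)
    off : ∀ {z} → z ∈ xs → z ≢ x
    off z∈ = ≡.≢-sym (All.lookup x∉xs z∈)
    rank-one-row : expand v (Det M xs) (x ∷ xs) ≈ v x * c ^ length xs
    rank-one-row = begin
      expand v (Det M xs) (x ∷ xs)
        ≈⟨ expand-addRow d xs (x ∷ xs) (λ _ _ → +-comm _ _) ⟩
      expand v (Det (λ i j → c * δ i j) xs) (x ∷ xs)
        ≈⟨ expand-zeroColumn xs x xs (λ z∈ → trans (*-congˡ (δ-offDiagonal (off z∈))) (zeroʳ c)) ⟩
      v x * Det (λ i j → c * δ i j) xs xs
        ≈⟨ *-congˡ (Det-diagonal c xs!) ⟩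
      v x * c ^ length xs ∎
    unit-row : expand (δ x) (Det M xs) (x ∷ xs) ≈ c ^ length xs + c ^ (length xs ℕ.∸ 1) * S
    unit-row = begin
      δ x x * Det M xs xs - expand (δ x) (λ zs → Det M xs (x ∷ zs)) xs
        ≈⟨ +-cong (*-congʳ (δ-diagonal x)) (-‿cong (expand-zeroˡ xs λ z∈ → δ-offDiagonal (All.lookup x∉xs z∈))) ⟩
      1# * Det M xs xs - 0#
        ≈⟨ solve 1 (λ e → con 1ℤ :* e :- con 0ℤ := e) refl _ ⟩
      Det M xs xs
        ≈⟨ Det-rankOneUpdate c d v xs! ⟩
      c ^ length xs + c ^ (length xs ℕ.∸ 1) * S ∎

  from : ℕ → ℕ → List ℕ
  from a zero    = []
  from a (suc m) = a ∷ from (suc a) m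

  -- For consecutive rows write `f = h - (h - f)`; the part `h` repeats the next row and vanishes.
  -- This leaves minus the difference row above the remaining rows, and moving the last row over the
  -- difference row gives a second minus sign. So the last row ends up on top without a sign.
  Det-differences : ∀ (F : ℕ → B → Carrier) a m ys →
    Det F (from a (suc m)) ys ≈ expand (F (a ℕ.+ m)) (Det (λ r y → F r y - F (ℕ.pred r) y) (from (suc a) m)) ys
  Det-differences F a zero    ys = expand-cong ys (λ {y} _ → reflexive (≡.cong (λ r → F r y) (≡.sym (ℕ.+-identityʳ a)))) λ _ → refl
  Det-differences F a (suc m) ys = begin
    expand (F a) (expand (F (suc a)) G) ys
      ≈⟨ expand-cong ys (λ {y} _ → solve 2 (λ f h → f := con 1ℤ :* h :+ :- con 1ℤ :* (h :- f)) refl (F a y) (F (suc a) y)) (λ _ → refl) ⟩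
    expand (λ y → 1# * F (suc a) y + - 1# * Δ (suc a) y) (expand (F (suc a)) G) ys
      ≈⟨ expand-linearˡ 1# (- 1#) ys ⟩
    1# * expand (F (suc a)) (expand (F (suc a)) G) ys + - 1# * expand (Δ (suc a)) (Det F (from (suc a) (suc m))) ys
      ≈⟨ +-cong (*-congˡ (expand-repeat (F (suc a)) G ys)) (*-congˡ (trans (expand-congʳ (Det-differences F (suc a) m) ys) (expand-swap _ _ _ ys))) ⟩
    1# * 0# + - 1# * - expand (F (suc a ℕ.+ m)) (expand (Δ (suc a)) (Det Δ (from (suc (suc a)) m))) ys
      ≈⟨ solve 1 (λ e → con 1ℤ :* con 0ℤ :+ :- con 1ℤ :* :- e := e) refl _ ⟩
    expand (F (suc a ℕ.+ m)) (Det Δ (from (suc a) (suc m))) ys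
      ≈⟨ expand-cong ys (λ {y} _ → reflexive (≡.cong (λ r → F r y) (≡.sym (ℕ.+-suc a m)))) (λ _ → refl) ⟩
    expand (F (a ℕ.+ suc m)) (Det Δ (from (suc a) (suc m))) ys ∎
    where
    G = Det F (from (suc (suc a)) m)
    Δ : ℕ → _ → Carrier
    Δ r y = F r y - F (ℕ.pred r) y

  ∈-from⁻ : ∀ {a x} m → x ∈ from a m → a ℕ.≤ x Product.× x ℕ.< a ℕ.+ m
  ∈-from⁻ {a} (suc m) (here ≡.refl) = ℕ.≤-refl , ℕ.m<m+n a ℕ.z<s
  ∈-from⁻ {a} {x} (suc m) (there x∈) = Product.map ℕ.<⇒≤ (≡.subst (x ℕ.<_) (≡.sym (ℕ.+-suc a m))) (∈-from⁻ m x∈)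

  from-unique : ∀ a m → Unique (from a m)
  from-unique a zero    = []
  from-unique a (suc m) = All.tabulate (λ x∈ → ℕ.<⇒≢ (proj₁ (∈-from⁻ m x∈))) ∷ from-unique (suc a) m

  length-from : ∀ a m → length (from a m) ≡ m
  length-from a zero    = ≡.refl
  length-from a (suc m) = ≡.cong suc (length-from (suc a) m)

  ∑-cong : ∀ {f g : A → Carrier} xs → (∀ {x} → x ∈ xs → f x ≈ g x) → ∑ f xs ≈ ∑ g xs
  ∑-cong []       _   = refl
  ∑-cong (x ∷ xs) f≈g = +-cong (f≈g (here ≡.refl)) (∑-cong xs (f≈g ∘ there))

  ∑-axpy : ∀ {f g : A → Carrier} α xs → ∑ (λ x → f x - α * g x) xs ≈ ∑ f xs - α * ∑ g xs
  ∑-axpy α []       = solve 1 (λ α → con 0ℤ := con 0ℤ :- α :* con 0ℤ) refl α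
  ∑-axpy {f = f} {g} α (x ∷ xs) = begin
    (f x - α * g x) + ∑ (λ x → f x - α * g x) xs  ≈⟨ +-congˡ (∑-axpy α xs) ⟩
    (f x - α * g x) + (∑ f xs - α * ∑ g xs)       ≈⟨ solve 5 (λ α f g F G → (f :- α :* g) :+ (F :- α :* G) := (f :+ F) :- α :* (g :+ G)) refl α (f x) (g x) (∑ f xs) (∑ g xs) ⟩
    (f x + ∑ f xs) - α * (g x + ∑ g xs)           ∎

  ∑-telescope : ∀ (U : ℕ → Carrier) a m → ∑ (λ r → U r - U (ℕ.pred r)) (from (suc a) m) ≈ U (a ℕ.+ m) - U a
  ∑-telescope U a zero    = trans (sym (-‿inverseʳ (U a))) (+-congʳ (reflexive (≡.cong U (≡.sym (ℕ.+-identityʳ a)))))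
  ∑-telescope U a (suc m) = begin
    (U (suc a) - U a) + ∑ (λ r → U r - U (ℕ.pred r)) (from (suc (suc a)) m)
      ≈⟨ +-congˡ (∑-telescope U (suc a) m) ⟩
    (U (suc a) - U a) + (U (suc a ℕ.+ m) - U (suc a))
      ≈⟨ solve 3 (λ u v w → (u :- v) :+ (w :- u) := w :- v) refl (U (suc a)) (U a) (U (suc a ℕ.+ m)) ⟩
    U (suc a ℕ.+ m) - U a
      ≈⟨ +-congʳ (reflexive (≡.cong U (≡.sym (ℕ.+-suc a m)))) ⟩
    U (a ℕ.+ suc m) - U a ∎

  staircase : Carrier → ℕ → ℕ → Carrier
  staircase t r s = if does (r ℕ.<? s) then t else 1#

  staircase-< : ∀ t {r s} → r ℕ.< s → staircase t r s ≈ t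
  staircase-< t {r} {s} r<s = reflexive (≡.cong (if_then t else 1#) (dec-true (r ℕ.<? s) r<s))

  staircase-≥ : ∀ t {r s} → s ℕ.≤ r → staircase t r s ≈ 1#
  staircase-≥ t {r} {s} s≤r = reflexive (≡.cong (if_then t else 1#) (dec-false (r ℕ.<? s) (ℕ.≤⇒≯ s≤r)))

  staircase-difference : ∀ t r s → staircase t (suc r) s - staircase t r s ≈ (1# - t) * δ (suc r) s
  staircase-difference t r s with ℕ.<-cmp (suc r) s
  ... | tri< r+1<s _ _ = begin
    staircase t (suc r) s - staircase t r s  ≈⟨ +-cong (staircase-< t r+1<s) (-‿cong (staircase-< t (ℕ.<-trans (ℕ.n<1+n r) r+1<s))) ⟩
    t - t                                    ≈⟨ solve 1 (λ t → t :- t := (con 1ℤ :- t) :* con 0ℤ) refl t ⟩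
    (1# - t) * 0#                            ≈⟨ *-congˡ (δ-offDiagonal (ℕ.<⇒≢ r+1<s)) ⟨
    (1# - t) * δ (suc r) s                   ∎
  ... | tri≈ _ ≡.refl _ = begin
    staircase t (suc r) s - staircase t r s  ≈⟨ +-cong (staircase-≥ t {suc r} ℕ.≤-refl) (-‿cong (staircase-< t (ℕ.n<1+n r))) ⟩
    1# - t                                   ≈⟨ *-identityʳ _ ⟨
    (1# - t) * 1#                            ≈⟨ *-congˡ (δ-diagonal (suc r)) ⟨
    (1# - t) * δ (suc r) s                   ∎
  ... | tri> _ _ s<r+1 = begin
    staircase t (suc r) s - staircase t r s  ≈⟨ +-cong (staircase-≥ t (ℕ.<⇒≤ s<r+1)) (-‿cong (staircase-≥ t (ℕ.s≤s⁻¹ s<r+1))) ⟩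
    1# - 1#                                  ≈⟨ solve 1 (λ t → con 1ℤ :- con 1ℤ := (con 1ℤ :- t) :* con 0ℤ) refl t ⟩
    (1# - t) * 0#                            ≈⟨ *-congˡ (δ-offDiagonal (ℕ.>⇒≢ s<r+1)) ⟨
    (1# - t) * δ (suc r) s                   ∎

  -- Consecutive rows of the staircase matrix differ by a multiple of a unit vector.
  Det-staircase : ∀ (U w : ℕ → Carrier) t X m →
    ∑ (λ r → (U r - U (ℕ.pred r)) * w r) (from 1 (suc m)) + (U 0 - t * U (suc m)) * w 0 ≈ X * (1# - t) →
    Det (λ r s → U r * w s + staircase t r s) (from 0 (suc (suc m))) (from 0 (suc (suc m))) ≈ (1# - t) ^ suc m * (1# + X)
  Det-staircase U w t X m cyclicSum = begin
    Det F (0 ∷ L) (0 ∷ L)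
      ≈⟨ Det-differences F 0 (suc m) (0 ∷ L) ⟩
    expand (F (suc m)) (Det (λ r s → F r s - F (ℕ.pred r) s) L) (0 ∷ L)
      ≈⟨ expand-cong (0 ∷ L) lastRow (λ {zs} _ → Det-cong L zs λ {r} {s} r∈ _ → differenceRow r s (proj₁ (∈-from⁻ (suc m) r∈))) ⟩
    expand (λ s → U (suc m) * w s + 1# * 1#) (Det Δ L) (0 ∷ L)
      ≈⟨ expand-linearˡ {g = Det Δ L} (U (suc m)) 1# (0 ∷ L) ⟩
    U (suc m) * expand w (Det Δ L) (0 ∷ L) + 1# * expand (λ _ → 1#) (Det Δ L) (0 ∷ L)
      ≈⟨ +-cong (*-congˡ rowOfW) (*-congˡ rowOfOnes) ⟩
    U (suc m) * (w 0 * C ^ suc m) + 1# * (C ^ suc m + C ^ m * ∑ (λ r → d r * (w r - w 0)) L)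
      ≈⟨ +-congˡ (*-congˡ (+-congˡ (*-congˡ sumOverL))) ⟩
    U (suc m) * (w 0 * C ^ suc m) + 1# * (C ^ suc m + C ^ m * (S - w 0 * (U (suc m) - U 0)))
      -- The row of `w` contributes `(1 - t) u w₀` and the telescoped sum `- w₀ (u - u₀)`; together
      -- they are `(u₀ - t u) w₀`, the wrap-around term that closes the sum into a cycle.
      ≈⟨ solve 6 (λ u u₀ w₀ t c S → u :* (w₀ :* ((con 1ℤ :- t) :* c)) :+ con 1ℤ :* ((con 1ℤ :- t) :* c :+ c :* (S :- w₀ :* (u :- u₀)))
                    := (con 1ℤ :- t) :* c :+ c :* (S :+ (u₀ :- t :* u) :* w₀))
           refl (U (suc m)) (U 0) (w 0) t (C ^ m) S ⟩
    C ^ suc m + C ^ m * (S + (U 0 - t * U (suc m)) * w 0)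
      ≈⟨ +-congˡ (*-congˡ cyclicSum) ⟩
    C ^ suc m + C ^ m * (X * C)
      ≈⟨ solve 3 (λ c C X → C :* c :+ c :* (X :* C) := C :* c :* (con 1ℤ :+ X)) refl (C ^ m) C X ⟩
    C ^ suc m * (1# + X) ∎
    where
    C = 1# - t
    L = from 1 (suc m)
    F Δ : ℕ → ℕ → Carrier
    d : ℕ → Carrier
    F r s = U r * w s + staircase t r s
    d r = U r - U (ℕ.pred r)
    Δ r s = d r * w s + C * δ r s
    S = ∑ (λ r → d r * w r) L

    lastRow : ∀ {s} → s ∈ 0 ∷ L → F (suc m) s ≈ U (suc m) * w s + 1# * 1#
    lastRow s∈ = +-congˡ (trans (staircase-≥ t (ℕ.s≤s⁻¹ (proj₂ (∈-from⁻ (suc (suc m)) s∈)))) (sym (*-identityˡ 1#)))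

    differenceRow : ∀ r s → 1 ℕ.≤ r → F r s - F (ℕ.pred r) s ≈ Δ r s
    differenceRow (suc r) s _ = begin
      (U (suc r) * w s + staircase t (suc r) s) - (U r * w s + staircase t r s)
        ≈⟨ solve 5 (λ u v w p q → (u :* w :+ p) :- (v :* w :+ q) := (u :- v) :* w :+ (p :- q))
             refl (U (suc r)) (U r) (w s) (staircase t (suc r) s) (staircase t r s) ⟩
      (U (suc r) - U r) * w s + (staircase t (suc r) s - staircase t r s)
        ≈⟨ +-congˡ (staircase-difference t r s) ⟩
      Δ (suc r) s ∎

    δ-column₀ : ∀ {r} → r ∈ L → C * δ r 0 ≈ 0#
    δ-column₀ r∈ = trans (*-congˡ (δ-offDiagonal (ℕ.>⇒≢ (proj₁ (∈-from⁻ (suc m) r∈))))) (zeroʳ C)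

    rowOfW : expand w (Det Δ L) (0 ∷ L) ≈ w 0 * C ^ suc m
    rowOfW = begin
      expand w (Det Δ L) (0 ∷ L)                     ≈⟨ expand-addRow d L (0 ∷ L) (λ _ _ → +-comm _ _) ⟩
      expand w (Det (λ r s → C * δ r s) L) (0 ∷ L)   ≈⟨ expand-zeroColumn L 0 L δ-column₀ ⟩
      w 0 * Det (λ r s → C * δ r s) L L              ≈⟨ *-congˡ (Det-diagonal C (from-unique 1 (suc m))) ⟩
      w 0 * C ^ length L                             ≈⟨ *-congˡ (reflexive (≡.cong (C ^_) (length-from 1 (suc m)))) ⟩
      w 0 * C ^ suc m                                ∎

    rowOfOnes : expand (λ _ → 1#) (Det Δ L) (0 ∷ L) ≈ C ^ suc m + C ^ m * ∑ (λ r → d r * (w r - w 0)) L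
    rowOfOnes = begin
      expand (λ _ → 1#) (Det Δ L) (0 ∷ L)
        -- Subtracting `d r * w 0` times the row of ones from row `r` clears column `0`.
        ≈⟨ expand-addRow {F = Δ′} (λ r → d r * w 0) L (0 ∷ L) (λ {r} {s} _ _ →
             solve 4 (λ d w w₀ e → d :* w :+ e := d :* (w :- w₀) :+ e :+ d :* w₀ :* con 1ℤ) refl (d r) (w s) (w 0) (C * δ r s)) ⟩
      expand (λ _ → 1#) (Det Δ′ L) (0 ∷ L)
        ≈⟨ expand-zeroColumn L 0 L (λ {r} r∈ → trans (+-congˡ (δ-column₀ r∈))
             (solve 2 (λ d w → d :* (w :- w) :+ con 0ℤ := con 0ℤ) refl (d r) (w 0))) ⟩
      1# * Det Δ′ L L
        ≈⟨ *-identityˡ _ ⟩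
      Det Δ′ L L
        ≈⟨ Det-rankOneUpdate C d (λ s → w s - w 0) (from-unique 1 (suc m)) ⟩
      C ^ length L + C ^ (length L ℕ.∸ 1) * ∑ (λ r → d r * (w r - w 0)) L
        ≈⟨ reflexive (≡.cong (λ k → C ^ k + C ^ (k ℕ.∸ 1) * ∑ (λ r → d r * (w r - w 0)) L) (length-from 1 (suc m))) ⟩
      C ^ suc m + C ^ m * ∑ (λ r → d r * (w r - w 0)) L ∎
      where
      Δ′ : ℕ → ℕ → Carrier
      Δ′ r s = d r * (w s - w 0) + C * δ r s

    sumOverL : ∑ (λ r → d r * (w r - w 0)) L ≈ S - w 0 * (U (suc m) - U 0)
    sumOverL = begin
      ∑ (λ r → d r * (w r - w 0)) L
        ≈⟨ ∑-cong L (λ {r} _ → solve 3 (λ d w w₀ → d :* (w :- w₀) := d :* w :- w₀ :* d) refl (d r) (w r) (w 0)) ⟩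
      ∑ (λ r → d r * w r - w 0 * d r) L
        ≈⟨ ∑-axpy (w 0) L ⟩
      S - w 0 * ∑ d L
        ≈⟨ +-congˡ (-‿cong (*-congˡ (∑-telescope U 0 (suc m)))) ⟩
      S - w 0 * (U (suc m) - U 0) ∎

-- The matrix of floors

module FloorMatrix {c ℓ} (R : CommutativeRing c ℓ) where

  open CommutativeRing R hiding (zero)
  open OverRing R
  open IntegerSolver R
  open Determinant R
  open import Algebra.Properties.Ring ring using ([y-z]x≈yx-zx)
  open import Algebra.Properties.Semiring.Exp semiring using (^-homo-*)
  open import Relation.Binary.Reasoning.Setoid setoid

  ∑-↭ : ∀ {f : A → Carrier} {s xs ys} → xs ↭[ s ] ys → ∑ f xs ≈ ∑ f ys
  ∑-↭ ↭-refl = refl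
  ∑-↭ (↭-prep x p) = +-congˡ (∑-↭ p)
  ∑-↭ {f = f} (↭-swap {xs = xs} x y) = solve 3 (λ x y z → x :+ (y :+ z) := y :+ (x :+ z)) refl (f x) (f y) (∑ f xs)
  ∑-↭ (↭-trans p q) = trans (∑-↭ p) (∑-↭ q)

  ∑-map : ∀ (f : B → Carrier) (g : A → B) xs → ∑ f (map g xs) ≈ ∑ (f ∘ g) xs
  ∑-map f g xs = reflexive (List.foldr-map _ g 0# xs)

  ∑-∷ʳ : ∀ (f : A → Carrier) xs x → ∑ f (xs ++ [ x ]) ≈ ∑ f xs + f x
  ∑-∷ʳ f []       x = trans (+-identityʳ _) (sym (+-identityˡ _))
  ∑-∷ʳ f (y ∷ xs) x = trans (+-congˡ (∑-∷ʳ f xs x)) (sym (+-assoc (f y) _ _))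

  from≡applyUpTo : ∀ {a} {f : ℕ → ℕ} n → (∀ i → f i ≡ a ℕ.+ i) → from a n ≡ applyUpTo f n
  from≡applyUpTo zero    _   = ≡.refl
  from≡applyUpTo {a} (suc n) f≡ = ≡.cong₂ _∷_ (≡.sym (≡.trans (f≡ 0) (ℕ.+-identityʳ a)))
    (from≡applyUpTo n λ i → ≡.trans (f≡ (suc i)) (ℕ.+-suc a i))

  from≡upTo : ∀ n → from 0 n ≡ upTo n
  from≡upTo n = from≡applyUpTo n λ _ → ≡.refl

  -- The sign of a permutation does not depend on its decomposition into transpositions.
  signum-unique : ∀ {s n} → upTo n ↭[ s ] upTo n → signum s ≈ 1#
  signum-unique {s} {n} p = begin
    signum s                          ≈⟨ *-identityʳ _ ⟨
    signum s * 1#                     ≈⟨ *-congˡ identity ⟨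
    signum s * Det E (upTo n) (upTo n) ≈⟨ Det-permuteRows p (upTo n) ⟨
    Det E (upTo n) (upTo n)           ≈⟨ identity ⟩
    1#                                ∎
    where
    E : ℕ → ℕ → Carrier
    E i j = 1# * δ i j
    1^k≈1 : ∀ k → 1# ^ k ≈ 1#
    1^k≈1 zero    = refl
    1^k≈1 (suc k) = trans (*-identityˡ _) (1^k≈1 k)
    identity : Det E (upTo n) (upTo n) ≈ 1#
    identity = trans (Det-diagonal 1# (Unique.upTo⁺ n)) (1^k≈1 (length (upTo n)))

  signum-product⇒≈ : ∀ s t → signum (s Sign.* t) ≈ 1# → signum s ≈ signum t
  signum-product⇒≈ s t st≈1 = begin
    signum s                          ≈⟨ *-identityʳ _ ⟨
    signum s * 1#                     ≈⟨ *-congˡ (signum-square t) ⟨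
    signum s * (signum t * signum t)  ≈⟨ *-assoc _ _ _ ⟨
    signum s * signum t * signum t    ≈⟨ *-congʳ (trans (sym (signum-* s t)) st≈1) ⟩
    1# * signum t                     ≈⟨ *-identityˡ _ ⟩
    signum t                          ∎

  fromℤ-◃ : ∀ s → fromℤ (s ◃ 1) ≈ signum s
  fromℤ-◃ Sign.+ = +-identityʳ 1#
  fromℤ-◃ Sign.- = -‿cong (+-identityʳ 1#)

  -- Integer powers of `q` and the sorted matrix

  module Powers (q q⁻¹ : Carrier) (q*q⁻¹≈1 : q * q⁻¹ ≈ 1#) where

    Q : ℤ → Carrier
    Q = zpow q q⁻¹

    Q-⊖ : ∀ m n → Q (m ℤ.⊖ n) ≈ q ^ m * q⁻¹ ^ n
    Q-⊖ m       zero    = sym (*-identityʳ _)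
    Q-⊖ zero    (suc n) = sym (*-identityˡ _)
    Q-⊖ (suc m) (suc n) = begin
      Q (suc m ℤ.⊖ suc n)               ≈⟨ reflexive (≡.cong Q (ℤ.[1+m]⊖[1+n]≡m⊖n m n)) ⟩
      Q (m ℤ.⊖ n)                       ≈⟨ Q-⊖ m n ⟩
      q ^ m * q⁻¹ ^ n                   ≈⟨ *-identityˡ _ ⟨
      1# * (q ^ m * q⁻¹ ^ n)            ≈⟨ *-congʳ q*q⁻¹≈1 ⟨
      q * q⁻¹ * (q ^ m * q⁻¹ ^ n)       ≈⟨ solve 4 (λ a b c d → a :* b :* (c :* d) := a :* c :* (b :* d)) refl q q⁻¹ (q ^ m) (q⁻¹ ^ n) ⟩
      q * q ^ m * (q⁻¹ * q⁻¹ ^ n)       ∎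

    Q-+ : ∀ i j → Q (i ℤ.+ j) ≈ Q i * Q j
    Q-+ (+ m)    (+ n)    = ^-homo-* q m n
    Q-+ (+ m)    -[1+ n ] = Q-⊖ m (suc n)
    Q-+ -[1+ m ] (+ n)    = trans (Q-⊖ n (suc m)) (*-comm _ _)
    Q-+ -[1+ m ] -[1+ n ] = begin
      q⁻¹ ^ suc (suc (m ℕ.+ n))   ≈⟨ reflexive (≡.cong (λ k → q⁻¹ ^ suc k) (≡.sym (ℕ.+-suc m n))) ⟩
      q⁻¹ ^ (suc m ℕ.+ suc n)     ≈⟨ ^-homo-* q⁻¹ (suc m) (suc n) ⟩
      q⁻¹ ^ suc m * q⁻¹ ^ suc n   ∎

    Q-≡ : ∀ {i j} → i ≡ j → Q i ≈ Q j
    Q-≡ i≡j = reflexive (≡.cong Q i≡j)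

    Q-inverse : ∀ i → Q i * Q (ℤ.- i) ≈ 1#
    Q-inverse i = trans (sym (Q-+ i (ℤ.- i))) (Q-≡ (ℤ.+-inverseʳ i))

    Q-1 : Q 1ℤ ≈ q
    Q-1 = *-identityʳ q

    Q--1 : Q -1ℤ ≈ q⁻¹
    Q--1 = *-identityʳ q⁻¹

    Q-neg : ∀ i → Q (ℤ.- i) ≡ zpow q⁻¹ q i
    Q-neg (+ zero)    = ≡.refl
    Q-neg (+ (suc m)) = ≡.refl
    Q-neg -[1+ m ]    = ≡.refl

    ∏-Q : ∀ (e : A → ℤ) xs → ∏ (Q ∘ e) xs ≈ Q (sumℤ e xs)
    ∏-Q e []       = refl
    ∏-Q e (x ∷ xs) = trans (*-congˡ (∏-Q e xs)) (sym (Q-+ (e x) (sumℤ e xs)))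

    module Cyclic (a : ℤ) (m : ℕ)
      (cancel : Cancellative (suc m) a) (cancel′ : Cancellative (suc m) (a ℤ.+ 1ℤ))
      (rows : ResidueInverse a (suc m)) (columns : ResidueInverse (a ℤ.+ 1ℤ) (suc m)) where

      open CyclicExponents a m cancel cancel′ rows columns
      private
        module K = ResidueInverseProperties cancel′ columns

      -- Listed by column number instead of residue, the exponents `subdiag` are the exponents
      -- `diag` delayed by one step. Only the last term of one sum and the first of the other
      -- survive.
      ∑-cyclic : ∑ (Q ∘ diag) (upTo (suc m)) - ∑ (Q ∘ subdiag) (upTo (suc m)) ≈ q - 1#
      ∑-cyclic = begin
        ∑ (Q ∘ diag) (upTo (suc m)) - ∑ (Q ∘ subdiag) (upTo (suc m))
          ≈⟨ +-cong (reindex diag) (-‿cong (reindex subdiag)) ⟩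
        ∑ α (upTo (suc m)) - ∑ β (upTo (suc m))
          ≈⟨ +-cong (trans (reflexive (≡.cong (∑ α) (≡.sym (List.upTo-∷ʳ m)))) (∑-∷ʳ α (upTo m) m))
                    (-‿cong (+-congˡ (trans (reflexive (≡.cong (∑ β) (≡.sym (List.map-upTo suc m)))) (∑-map β suc (upTo m))))) ⟩
        (∑ α (upTo m) + α m) - (β 0 + ∑ (β ∘ suc) (upTo m))
          ≈⟨ +-cong (+-congˡ (trans (Q-≡ diag-last) Q-1))
               (-‿cong (+-cong (Q-≡ subdiag-first) (∑-cong (upTo m) λ k∈ → Q-≡ (subdiag-next (∈-upTo⁻ k∈))))) ⟩
        (∑ α (upTo m) + q) - (1# + ∑ α (upTo m))
          ≈⟨ solve 2 (λ s q → (s :+ q) :- (con 1ℤ :+ s) := q :- con 1ℤ) refl (∑ α (upTo m)) q ⟩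
        q - 1# ∎
        where
        α β : ℕ → Carrier
        α k = Q (diag (K.residue k))
        β k = Q (subdiag (K.residue k))
        reindex : ∀ (e : ℕ → ℤ) → ∑ (Q ∘ e) (upTo (suc m)) ≈ ∑ (λ k → Q (e (K.residue k))) (upTo (suc m))
        reindex e = trans (sym (∑-↭ (K.residue-↭ (proj₂ K.index-↭)))) (∑-map (Q ∘ e) K.residue (upTo (suc m)))

    module Floors (x : Carrier) (a : ℤ) (n : ℕ) .{{_ : NonZero n}} where

      entry : ℕ → ℕ → Carrier
      entry i k = x + Q ((a ℤ.* + suc i ℤ.- (a ℤ.+ 1ℤ) ℤ.* + suc k) /ℕ n)

    module Coprime (x : Carrier) (a : ℤ) (m : ℕ)
      (cancel : Cancellative (suc m) a) (cancel′ : Cancellative (suc m) (a ℤ.+ 1ℤ))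
      (rows : ResidueInverse a (suc m)) (columns : ResidueInverse (a ℤ.+ 1ℤ) (suc m)) where

      open Floors x a (suc m)
      open ResidueInverse rows using () renaming (index to I; quot to u; equation to I-equation)
      open ResidueInverse columns using () renaming (index to K; quot to v; equation to K-equation)
      open CyclicExponents a m cancel cancel′ rows columns using (diag; subdiag)
      private
        n : ℕ
        n = suc m

      U w : ℕ → Carrier
      U r = x * Q (ℤ.- u r)
      w s = Q (v s)

      sorted-entry : ∀ {r s} → r ℕ.< n → s ℕ.< n →
                     entry (I r) (K s) ≈ Q (u r) * (Q (ℤ.- v s) * (U r * w s + staircase q⁻¹ r s))
      sorted-entry {r} {s} r<n s<n = begin
        x + Q φ
          ≈⟨ +-congˡ (by-cases (s ℕ.≤? r)) ⟩
        x + Q (u r) * Q (ℤ.- v s) * staircase q⁻¹ r s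
          ≈⟨ +-congʳ (trans (sym (*-identityʳ x)) (*-congˡ (trans (sym (*-identityˡ 1#)) (sym (*-cong (Q-inverse (u r)) (Q-inverse (v s))))))) ⟩
        x * (Q (u r) * Q (ℤ.- u r) * (Q (v s) * Q (ℤ.- v s))) + Q (u r) * Q (ℤ.- v s) * staircase q⁻¹ r s
          ≈⟨ solve 6 (λ x a b c d t → x :* (a :* b :* (c :* d)) :+ a :* d :* t := a :* (d :* (x :* b :* c :+ t)))
               refl x (Q (u r)) (Q (ℤ.- u r)) (Q (v s)) (Q (ℤ.- v s)) (staircase q⁻¹ r s) ⟩
        Q (u r) * (Q (ℤ.- v s) * (U r * w s + staircase q⁻¹ r s)) ∎
        where
        φ = (a ℤ.* + suc (I r) ℤ.- (a ℤ.+ 1ℤ) ℤ.* + suc (K s)) /ℕ n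
        by-cases : Dec (s ℕ.≤ r) → Q φ ≈ Q (u r) * Q (ℤ.- v s) * staircase q⁻¹ r s
        by-cases (yes s≤r) = begin
          Q φ                                         ≈⟨ Q-≡ (/ℕ-difference-≥ n {u = u r} {v s} r<n s≤r (I-equation r) (K-equation s)) ⟩
          Q (u r ℤ.- v s)                             ≈⟨ Q-+ (u r) (ℤ.- v s) ⟩
          Q (u r) * Q (ℤ.- v s)                       ≈⟨ *-identityʳ _ ⟨
          Q (u r) * Q (ℤ.- v s) * 1#                  ≈⟨ *-congˡ (staircase-≥ q⁻¹ s≤r) ⟨
          Q (u r) * Q (ℤ.- v s) * staircase q⁻¹ r s   ∎
        by-cases (no s≰r) = begin
          Q φ                                         ≈⟨ Q-≡ (/ℕ-difference-< n {u = u r} {v s} s<n (ℕ.≰⇒> s≰r) (I-equation r) (K-equation s)) ⟩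
          Q (u r ℤ.- v s ℤ.+ -1ℤ)                     ≈⟨ Q-+ (u r ℤ.- v s) -1ℤ ⟩
          Q (u r ℤ.- v s) * Q -1ℤ                     ≈⟨ *-cong (Q-+ (u r) (ℤ.- v s)) Q--1 ⟩
          Q (u r) * Q (ℤ.- v s) * q⁻¹                 ≈⟨ *-congˡ (staircase-< q⁻¹ (ℕ.≰⇒> s≰r)) ⟨
          Q (u r) * Q (ℤ.- v s) * staircase q⁻¹ r s   ∎

      weight : ∀ e r → x * Q (ℤ.- e) * w r ≈ x * Q (v r ℤ.- e)
      weight e r = trans (*-assoc x _ _) (*-congˡ (trans (*-comm _ _) (sym (Q-+ (v r) (ℤ.- e)))))

      weight-A : ∀ r → U r * w r ≈ x * Q (diag r)
      weight-A r = weight (u r) r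

      -- The wrap-around term of the cyclic sum: its factor `q⁻¹`, the staircase entry above the
      -- diagonal, is what the `- 1ℤ` in `subdiag zero` records.
      weight-B : q⁻¹ * U m * w 0 ≈ x * Q (subdiag 0)
      weight-B = begin
        q⁻¹ * U m * w 0                   ≈⟨ trans (*-assoc q⁻¹ _ _) (*-congˡ (weight (u m) 0)) ⟩
        q⁻¹ * (x * Q (v 0 ℤ.- u m))       ≈⟨ solve 3 (λ t x y → t :* (x :* y) := x :* (y :* t)) refl q⁻¹ x (Q (v 0 ℤ.- u m)) ⟩
        x * (Q (v 0 ℤ.- u m) * q⁻¹)       ≈⟨ *-congˡ (trans (*-congˡ (sym Q--1)) (sym (Q-+ (v 0 ℤ.- u m) -1ℤ))) ⟩
        x * Q (subdiag 0)                       ∎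

      -- Brings the cyclic sum into the shape `X * (1# - t)` asked for by `Det-staircase`, with
      -- `X = q * x` and `t = q⁻¹`.
      x[q-1]≈ : x * (q - 1#) ≈ q * x * (1# - q⁻¹)
      x[q-1]≈ = begin
        x * (q - 1#)                      ≈⟨ *-congˡ (+-congˡ (-‿cong q*q⁻¹≈1)) ⟨
        x * (q - q * q⁻¹)                 ≈⟨ solve 3 (λ x q t → x :* (q :- q :* t) := q :* x :* (con 1ℤ :- t)) refl x q q⁻¹ ⟩
        q * x * (1# - q⁻¹)                ∎

    Det-sorted : ∀ x a m (cancel : Cancellative (suc m) a) (cancel′ : Cancellative (suc m) (a ℤ.+ 1ℤ))
      (rows : ResidueInverse a (suc m)) (columns : ResidueInverse (a ℤ.+ 1ℤ) (suc m)) →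
      Det (λ r s → x * Q (ℤ.- ResidueInverse.quot rows r) * Q (ResidueInverse.quot columns s) + staircase q⁻¹ r s) (upTo (suc m)) (upTo (suc m))
        ≈ (1# - q⁻¹) ^ m * (1# + q * x)
    -- `Det-staircase` begins with two rows, so `n = 1` is separate. Modulo `1` the only residue is
    -- `0`, and `diag-last` gives its exponent.
    Det-sorted x a zero cancel cancel′ rows columns = begin
      (U 0 * w 0 + staircase q⁻¹ 0 0) * 1# - 0#
        ≈⟨ +-congʳ (*-congʳ (+-cong (trans (weight-A 0) (*-congˡ (trans (Q-≡ diag₀≡1) Q-1))) refl)) ⟩
      (x * q + 1#) * 1# - 0#
        ≈⟨ solve 2 (λ x q → (x :* q :+ con 1ℤ) :* con 1ℤ :- con 0ℤ := con 1ℤ :* (con 1ℤ :+ q :* x)) refl x q ⟩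
      1# * (1# + q * x) ∎
      where
      open Coprime x a zero cancel cancel′ rows columns
      open CyclicExponents a zero cancel cancel′ rows columns using (diag; diag-last)
      diag₀≡1 : diag 0 ≡ 1ℤ
      diag₀≡1 = ≡.trans (≡.cong diag (≡.sym (ℕ.n<1⇒n≡0 (ℤ.n%ℕd<d ((a ℤ.+ 1ℤ) ℤ.* + 1) 1)))) diag-last
    Det-sorted x a (suc m) cancel cancel′ rows columns = ≡.subst
      (λ xs → Det (λ r s → U r * w s + staircase q⁻¹ r s) xs xs ≈ (1# - q⁻¹) ^ suc m * (1# + q * x))
      (from≡upTo (suc (suc m)))
      (Det-staircase U w q⁻¹ (q * x) m (begin
        ∑ (λ r → (U r - U (ℕ.pred r)) * w r) (from 1 (suc m)) + (U 0 - q⁻¹ * U (suc m)) * w 0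
          ≈⟨ +-cong (∑-cong (from 1 (suc m)) λ {r} r∈ → step r (proj₁ (∈-from⁻ (suc m) r∈)))
                    (trans ([y-z]x≈yx-zx (w 0) _ _) (+-cong (weight-A 0) (-‿cong weight-B))) ⟩
        ∑ (λ r → x * Q (diag r) - x * Q (subdiag r)) (from 1 (suc m)) + (x * Q (diag 0) - x * Q (subdiag 0))
          ≈⟨ +-comm _ _ ⟩
        ∑ (λ r → x * Q (diag r) - x * Q (subdiag r)) (from 0 (suc (suc m)))
          ≈⟨ reflexive (≡.cong (∑ (λ r → x * Q (diag r) - x * Q (subdiag r))) (from≡upTo (suc (suc m)))) ⟩
        ∑ (λ r → x * Q (diag r) - x * Q (subdiag r)) (upTo (suc (suc m)))
          ≈⟨ ∑-difference (upTo (suc (suc m))) ⟩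
        x * (∑ (Q ∘ diag) (upTo (suc (suc m))) - ∑ (Q ∘ subdiag) (upTo (suc (suc m))))
          ≈⟨ *-congˡ ∑-cyclic ⟩
        x * (q - 1#)
          ≈⟨ x[q-1]≈ ⟩
        q * x * (1# - q⁻¹) ∎))
      where
      open Coprime x a (suc m) cancel cancel′ rows columns
      open Cyclic a (suc m) cancel cancel′ rows columns
      open CyclicExponents a (suc m) cancel cancel′ rows columns using (diag; subdiag)
      open ResidueInverse rows using () renaming (quot to u)
      step : ∀ r → 1 ℕ.≤ r → (U r - U (ℕ.pred r)) * w r ≈ x * Q (diag r) - x * Q (subdiag r)
      step (suc r) _ = trans ([y-z]x≈yx-zx (w (suc r)) _ _) (+-cong (weight-A (suc r)) (-‿cong (weight (u r) (suc r))))
      ∑-difference : ∀ rs → ∑ (λ r → x * Q (diag r) - x * Q (subdiag r)) rs ≈ x * (∑ (Q ∘ diag) rs - ∑ (Q ∘ subdiag) rs)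
      ∑-difference []       = solve 1 (λ x → con 0ℤ := x :* (con 0ℤ :- con 0ℤ)) refl x
      ∑-difference (r ∷ rs) = trans (+-congˡ (∑-difference rs))
        (solve 5 (λ x a b c d → (x :* a :- x :* b) :+ x :* (c :- d) := x :* ((a :+ c) :- (b :+ d))) refl
          x (Q (diag r)) (Q (subdiag r)) (∑ (Q ∘ diag) rs) (∑ (Q ∘ subdiag) rs))

-- In the difference of the two sums only -(1 + ⋯ + n) / n = -(n + 1) / 2 survives.
exponent-sum : ∀ {a t} {u v : ℕ → ℤ} {s s′} → let n = suc (t ℕ.+ t) in
  sumℤ u (upTo n) ℤ.* + n ≡ a ℤ.* s ℤ.- s′ → sumℤ v (upTo n) ℤ.* + n ≡ (a ℤ.+ 1ℤ) ℤ.* s ℤ.- s′ →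
  + 2 ℤ.* s ≡ + n ℤ.* + suc n →
  sumℤ u (upTo n) ℤ.+ sumℤ (λ r → ℤ.- v r) (upTo n) ≡ -[1+ t ]
exponent-sum {a} {t} {u} {v} {s} {s′} Σu Σv Σs = ≡.trans (≡.cong (λ z → sumℤ u (upTo n) ℤ.+ z) (sumℤ-neg v (upTo n)))
  (ℤ.*-cancelˡ-≡ (+ 2) e -[1+ t ] (ℤ.*-cancelʳ-≡ (+ 2 ℤ.* e) (+ 2 ℤ.* -[1+ t ]) (+ n) (begin
    + 2 ℤ.* e ℤ.* + n
      ≡⟨ lemma₁ (sumℤ u (upTo n)) (sumℤ v (upTo n)) (+ n) ⟩
    + 2 ℤ.* (sumℤ u (upTo n) ℤ.* + n ℤ.- sumℤ v (upTo n) ℤ.* + n)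
      ≡⟨ ≡.cong₂ (λ y z → + 2 ℤ.* (y ℤ.- z)) Σu Σv ⟩
    + 2 ℤ.* ((a ℤ.* s ℤ.- s′) ℤ.- ((a ℤ.+ 1ℤ) ℤ.* s ℤ.- s′))
      ≡⟨ lemma₂ a s s′ ⟩
    ℤ.- (+ 2 ℤ.* s)
      ≡⟨ ≡.cong ℤ.-_ Σs ⟩
    ℤ.- (+ n ℤ.* + suc n)
      ≡⟨ lemma₃ (+ t) ⟩
    + 2 ℤ.* (ℤ.- (1ℤ ℤ.+ + t)) ℤ.* + n ∎)))
  where
  open ≡-Reasoning
  n = suc (t ℕ.+ t)
  e = sumℤ u (upTo n) ℤ.- sumℤ v (upTo n)
  lemma₁ : ∀ u v n → + 2 ℤ.* (u ℤ.- v) ℤ.* n ≡ + 2 ℤ.* (u ℤ.* n ℤ.- v ℤ.* n)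
  lemma₁ = solve-∀
  lemma₂ : ∀ a s s′ → + 2 ℤ.* ((a ℤ.* s ℤ.- s′) ℤ.- ((a ℤ.+ 1ℤ) ℤ.* s ℤ.- s′)) ≡ ℤ.- (+ 2 ℤ.* s)
  lemma₂ = solve-∀
  lemma₃ : ∀ t → ℤ.- ((1ℤ ℤ.+ (t ℤ.+ t)) ℤ.* (+ 2 ℤ.+ (t ℤ.+ t))) ≡ + 2 ℤ.* (ℤ.- (1ℤ ℤ.+ t)) ℤ.* (1ℤ ℤ.+ (t ℤ.+ t))
  lemma₃ = solve-∀

parity-double : ∀ t → parity (suc (t ℕ.+ t)) ≡ Sign.-
parity-double t = ≡.cong opposite (≡.trans (parity-+ t t) (Sign.s*s≡+ (parity t)))

odd⇒≡ : ∀ n → ¬ 2 ℕ∣.∣ n → ∃[ t ] n ≡ suc (t ℕ.+ t)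
odd⇒≡ zero          2∤n = ⊥-elim (2∤n (2 ℕ∣.∣0))
odd⇒≡ (suc zero)    2∤n = 0 , ≡.refl
odd⇒≡ (suc (suc n)) 2∤n = Product.map suc
  (λ {t} n≡ → ≡.cong (suc ∘ suc) (≡.trans n≡ (≡.sym (ℕ.+-suc t t))))
  (odd⇒≡ n λ 2∣n → 2∤n (ℕ∣.∣m∣n⇒∣m+n ℕ∣.∣-refl 2∣n))

legendre-zero : ∀ {b p} → + p ∣ b → legendre b p ≡ 0ℤ
legendre-zero {b} {p} p∣b with + p ∣? b | isSquareMod? p b
... | yes _  | _ = ≡.refl
... | no p∤b | _ = ⊥-elim (p∤b p∣b)

legendreProduct-zero : ∀ {b ps} → Any (λ p → + p ∣ b) ps → foldr ℤ._*_ 1ℤ (map (legendre b) ps) ≡ 0ℤ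
legendreProduct-zero {b} {p ∷ ps} (here p∣b) = ≡.cong (ℤ._* foldr ℤ._*_ 1ℤ (map (legendre b) ps)) (legendre-zero p∣b)
legendreProduct-zero {b} {p ∷ ps} (there any) = ≡.trans (≡.cong (legendre b p ℤ.*_) (legendreProduct-zero any)) (ℤ.*-zeroʳ (legendre b p))

-- The modulus is a variable tied to the product by an equation, because `n` equals the product of
-- its prime factors only propositionally.
jacobi-zolotarev : ∀ {b n} .{{_ : NonZero n}} ps → n ≡ product ps → All Prime ps → All (λ p → ¬ + p ∣ b) ps → parity n ≡ Sign.- →
  ∃[ s ] foldr ℤ._*_ 1ℤ (map (legendre b) ps) ≡ s ◃ 1 Product.× upTo n ↭[ s ] map (mulMod b n) (upTo n)
jacobi-zolotarev {b} ps ≡.refl = zolotarev b ps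

-- Leaves room for the three distinct rows in `Det-degenerate`.
oddPrime≥3 : ∀ {p} → Prime p → parity p ≡ Sign.- → 3 ℕ.≤ p
oddPrime≥3 {1}                 pr _ = ⊥-elim (¬prime[1] pr)
oddPrime≥3 {suc (suc (suc _))} _  _ = ℕ.s≤s (ℕ.s≤s (ℕ.s≤s ℕ.z≤n))

-- Evaluation of the floor determinant

module Evaluation {c ℓ} (R : CommutativeRing c ℓ) where

  open CommutativeRing R hiding (zero)
  open OverRing R
  open Determinant R
  open FloorMatrix R
  open import Relation.Binary.Reasoning.Setoid setoid

  module _ (q q⁻¹ : Carrier) (q*q⁻¹≈1 : q * q⁻¹ ≈ 1#) where

    open Powers q q⁻¹ q*q⁻¹≈1

    -- Sorting rows and columns costs `s₁` and `s₂`. Composing the two multiplications gives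
    -- multiplication by `a (a + 1)`, so by uniqueness of signs their product agrees with `s₃` in
    -- `R`, and it is `s₃` that Zolotarev's lemma relates to the symbol in the statement.
    Det-coprime : ∀ x a t {s₁ s₂ s₃} → let n = suc (t ℕ.+ t) in
      Cancellative n a → Cancellative n (a ℤ.+ 1ℤ) →
      upTo n ↭[ s₁ ] map (mulMod a n) (upTo n) →
      upTo n ↭[ s₂ ] map (mulMod (a ℤ.+ 1ℤ) n) (upTo n) →
      upTo n ↭[ s₃ ] map (mulMod (a ℤ.* (a ℤ.+ 1ℤ)) n) (upTo n) →
      Det (Floors.entry x a n) (upTo n) (upTo n) ≈ signum s₃ * (Q -[1+ t ] * ((1# - q⁻¹) ^ (t ℕ.+ t) * (1# + q * x)))
    Det-coprime x a t {s₁} {s₂} {s₃} cancel cancel′ π₁ π₂ π₃ =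
      sort (residueInverse cancel) (residueInverse cancel′)
      where
      n = suc (t ℕ.+ t)
      N = upTo n
      entry = Floors.entry x a n
      value = (1# - q⁻¹) ^ (t ℕ.+ t) * (1# + q * x)
      odd = parity-double t

      s₁s₂≈s₃ : signum s₁ * signum s₂ ≈ signum s₃
      s₁s₂≈s₃ = trans (sym (signum-* s₁ s₂)) (signum-product⇒≈ (s₁ Sign.* s₂) s₃ (signum-unique
        (↭-trans (↭-trans π₁ (↭-map (mulMod a n) π₂)) (↭-respˡ-≡ composite (↭-sym π₃)))))
        where
        composite : map (mulMod (a ℤ.* (a ℤ.+ 1ℤ)) n) N ≡ map (mulMod a n) (map (mulMod (a ℤ.+ 1ℤ) n) N)
        composite = ≡.trans (List.map-cong (λ i → ≡.sym (mulMod-∘ a (a ℤ.+ 1ℤ) n i)) N) (List.map-∘ N)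

      sort : ResidueInverse a n → ResidueInverse (a ℤ.+ 1ℤ) n → Det entry N N ≈ signum s₃ * (Q -[1+ t ] * value)
      sort rows columns = permute I.index-↭ K.index-↭
        where
        open ResidueInverse rows using () renaming (index to I; quot to u)
        open ResidueInverse columns using () renaming (index to K; quot to v)
        open Coprime x a (t ℕ.+ t) cancel cancel′ rows columns
        module I = ResidueInverseProperties cancel rows
        module K = ResidueInverseProperties cancel′ columns

        scaled : Det (λ r s → entry (I r) (K s)) N N ≈ Q (sumℤ u N) * (Q (sumℤ (λ s → ℤ.- v s) N) * value)
        scaled = begin
          Det (λ r s → entry (I r) (K s)) N N
            ≈⟨ Det-cong N N (λ r∈ s∈ → sorted-entry (∈-upTo⁻ r∈) (∈-upTo⁻ s∈)) ⟩
          Det (λ r s → Q (u r) * (Q (ℤ.- v s) * (U r * w s + staircase q⁻¹ r s))) N N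
            ≈⟨ Det-scaleRows (λ r s → Q (ℤ.- v s) * (U r * w s + staircase q⁻¹ r s)) (Q ∘ u) N N ⟩
          ∏ (Q ∘ u) N * Det (λ r s → Q (ℤ.- v s) * (U r * w s + staircase q⁻¹ r s)) N N
            ≈⟨ *-congˡ (Det-scaleColumns (λ r s → U r * w s + staircase q⁻¹ r s) (λ s → Q (ℤ.- v s)) N N) ⟩
          ∏ (Q ∘ u) N * (∏ (λ s → Q (ℤ.- v s)) N * Det (λ r s → U r * w s + staircase q⁻¹ r s) N N)
            ≈⟨ *-cong (∏-Q u N) (*-cong (∏-Q (λ s → ℤ.- v s) N) (Det-sorted x a (t ℕ.+ t) cancel cancel′ rows columns)) ⟩
          Q (sumℤ u N) * (Q (sumℤ (λ s → ℤ.- v s) N) * value) ∎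

        permute : ∃[ s ] N ↭[ s ] map I N → ∃[ s ] N ↭[ s ] map K N → Det entry N N ≈ signum s₃ * (Q -[1+ t ] * value)
        permute (s , p) (s′ , p′) = begin
          Det entry N N
            ≈⟨ Det-permuteRows p N ⟩
          signum s * Det entry (map I N) N
            ≈⟨ *-congˡ (Det-permuteColumns (map I N) p′) ⟩
          signum s * (signum s′ * Det entry (map I N) (map K N))
            ≈⟨ *-assoc _ _ _ ⟨
          signum s * signum s′ * Det entry (map I N) (map K N)
            ≈⟨ *-cong signs (trans (Det-map entry I K N N) scaled) ⟩
          signum s₃ * (Q (sumℤ u N) * (Q (sumℤ (λ s → ℤ.- v s) N) * value))
            ≈⟨ *-congˡ (trans (sym (*-assoc _ _ _)) (*-congʳ (trans (sym (Q-+ (sumℤ u N) (sumℤ (λ s → ℤ.- v s) N)))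
                 (Q-≡ (exponent-sum {a} {t} {u} {v} (I.quot-sum p) (K.quot-sum p′) (sumℤ-suc-upTo n)))))) ⟩
          signum s₃ * (Q -[1+ t ] * value) ∎
          where
          signs : signum s * signum s′ ≈ signum s₃
          signs = trans (sym (*-cong
            (signum-product⇒≈ s₁ s (signum-unique (I.index-mulMod-↭ odd p π₁)))
            (signum-product⇒≈ s₂ s′ (signum-unique (K.index-mulMod-↭ odd p′ π₂))))) s₁s₂≈s₃

    -- Rows 0, m and 2m lie in the span of the all-ones row and row 0 of the powers.
    Det-degenerate : ∀ x a {n p} .{{_ : NonZero n}} → 3 ℕ.≤ p → p ℕ∣.∣ n → + p ∣ a →
                     Det (Floors.entry x a n) (upTo n) (upTo n) ≈ 0#
    Det-degenerate x a {n} {p} 3≤p (ℕ∣.divides m n≡m*p) (divides b a≡b*p) = extract₁ (∈⇒↭ (∈-upTo⁺ (multiple< 0 ℕ.z≤n)))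
      where
      open Floors x a n
      m>0 : 0 ℕ.< m
      m>0 = ℕ.n≢0⇒n>0 λ m≡0 → ℕ.≢-nonZero⁻¹ n (≡.trans n≡m*p (≡.cong (ℕ._* p) m≡0))
      multiple< : ∀ j → j ℕ.≤ 2 → j ℕ.* m ℕ.< n
      multiple< j j≤2 = ≡.subst (j ℕ.* m ℕ.<_) (≡.sym (≡.trans n≡m*p (ℕ.*-comm m p)))
        (ℕ.*-monoˡ-< m {{ℕ.>-nonZero m>0}} (ℕ.≤-trans (ℕ.s≤s j≤2) 3≤p))
      φ₀ : ℕ → ℤ
      φ₀ k = (a ℤ.* + 1 ℤ.- (a ℤ.+ 1ℤ) ℤ.* + suc k) /ℕ n
      -- With `a = b p` and `n = m p` one has `a m = b n`. Moving down `m` rows therefore raises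
      -- each numerator by `b n` and each exponent by exactly `b`.
      row : ∀ j k → entry (j ℕ.* m) k ≈ x + Q (+ j ℤ.* b) * Q (φ₀ k)
      row j k = +-congˡ (trans (Q-≡ (≡.trans (≡.cong (_/ℕ n) numerator) (/ℕ-+* n (a ℤ.* + 1 ℤ.- (a ℤ.+ 1ℤ) ℤ.* + suc k) (+ j ℤ.* b)))) (trans (Q-+ (φ₀ k) (+ j ℤ.* b)) (*-comm _ _)))
        where
        am≡bn : a ℤ.* + m ≡ b ℤ.* + n
        am≡bn = ≡.trans (≡.cong (ℤ._* + m) a≡b*p) (≡.trans (lemma b (+ p) (+ m)) (≡.cong (b ℤ.*_) (≡.trans (≡.sym (ℤ.pos-* m p)) (≡.cong +_ (≡.sym n≡m*p)))))
          where
          lemma : ∀ b p m → b ℤ.* p ℤ.* m ≡ b ℤ.* (m ℤ.* p)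
          lemma = solve-∀
        numerator : a ℤ.* + suc (j ℕ.* m) ℤ.- (a ℤ.+ 1ℤ) ℤ.* + suc k ≡ (a ℤ.* + 1 ℤ.- (a ℤ.+ 1ℤ) ℤ.* + suc k) ℤ.+ + j ℤ.* b ℤ.* + n
        numerator = ≡.trans (≡.cong (λ z → a ℤ.* (1ℤ ℤ.+ z) ℤ.- (a ℤ.+ 1ℤ) ℤ.* + suc k) (ℤ.pos-* j m))
          (≡.trans (lemma₁ a (+ j) (+ m) ((a ℤ.+ 1ℤ) ℤ.* + suc k))
            (≡.trans (≡.cong (λ z → (a ℤ.* 1ℤ ℤ.- (a ℤ.+ 1ℤ) ℤ.* + suc k) ℤ.+ + j ℤ.* z) am≡bn)
              (≡.cong (λ z → (a ℤ.* 1ℤ ℤ.- (a ℤ.+ 1ℤ) ℤ.* + suc k) ℤ.+ z) (≡.sym (ℤ.*-assoc (+ j) b (+ n))))))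
          where
          lemma₁ : ∀ a j m y → a ℤ.* (1ℤ ℤ.+ j ℤ.* m) ℤ.- y ≡ (a ℤ.* 1ℤ ℤ.- y) ℤ.+ j ℤ.* (a ℤ.* m)
          lemma₁ = solve-∀

      multiples-≢ : ∀ i j → i ℕ.< j → i ℕ.* m ≢ j ℕ.* m
      multiples-≢ i j i<j = ℕ.<⇒≢ (ℕ.*-monoˡ-< m {{ℕ.>-nonZero m>0}} i<j)

      vanish : ∀ {s L} → upTo n ↭[ s ] 0 ∷ 1 ℕ.* m ∷ 2 ℕ.* m ∷ L → Det entry (upTo n) (upTo n) ≈ 0#
      vanish {s} p = trans (Det-permuteRows p (upTo n)) (trans
        (*-congˡ (expand-threeDependent (Q (+ 0 ℤ.* b)) (Q (+ 1 ℤ.* b)) (Q (+ 2 ℤ.* b)) (upTo n) (row 0) (row 1) (row 2)))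
        (zeroʳ (signum s)))
      extract₃ : ∀ {s L} → upTo n ↭[ s ] 0 ∷ 1 ℕ.* m ∷ L → ∃[ s′ ] ∃[ L′ ] L ↭[ s′ ] 2 ℕ.* m ∷ L′ → Det entry (upTo n) (upTo n) ≈ 0#
      extract₃ p (_ , _ , p′) = vanish (↭-trans p (↭-prep _ (↭-prep _ p′)))
      extract₂ : ∀ {s L} → upTo n ↭[ s ] 0 ∷ L → ∃[ s′ ] ∃[ L′ ] L ↭[ s′ ] 1 ℕ.* m ∷ L′ → Det entry (upTo n) (upTo n) ≈ 0#
      extract₂ p (_ , _ , p′) = extract₃ p″ (∈⇒↭ (∈-∷⁻ (∈-∷⁻ (∈-resp p″ (∈-upTo⁺ (multiple< 2 ℕ.≤-refl)))
        (≡.≢-sym (multiples-≢ 0 2 ℕ.z<s))) (≡.≢-sym (multiples-≢ 1 2 (ℕ.s<s ℕ.z<s)))))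
        where p″ = ↭-trans p (↭-prep _ p′)
      extract₁ : ∃[ s ] ∃[ L ] upTo n ↭[ s ] 0 ∷ L → Det entry (upTo n) (upTo n) ≈ 0#
      extract₁ (_ , _ , p) = extract₂ p (∈⇒↭ (∈-∷⁻ (∈-resp p (∈-upTo⁺ (multiple< 1 (ℕ.s≤s ℕ.z≤n)))) (≡.≢-sym (multiples-≢ 0 1 ℕ.z<s))))

    Det-degenerate-+1 : ∀ x a {n p} .{{_ : NonZero n}} → 3 ℕ.≤ p → p ℕ∣.∣ n → + p ∣ a ℤ.+ 1ℤ →
                        Det (Floors.entry x a n) (upTo n) (upTo n) ≈ 0#
    Det-degenerate-+1 x a {n} 3≤p p∣n p∣a+1 = begin
      Det (Floors.entry x a n) (upTo n) (upTo n)
        ≈⟨ Det-transpose (Floors.entry x a n) (upTo n) (upTo n) ⟩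
      Det (flip (Floors.entry x a n)) (upTo n) (upTo n)
        ≈⟨ Det-cong (upTo n) (upTo n) (λ {i} {k} _ _ → +-congˡ (Q-≡ (≡.cong (_/ℕ n) (lemma a (+ suc i) (+ suc k))))) ⟩
      Det (Floors.entry x (ℤ.- (a ℤ.+ 1ℤ)) n) (upTo n) (upTo n)
        ≈⟨ Det-degenerate x (ℤ.- (a ℤ.+ 1ℤ)) 3≤p p∣n (∣m⇒∣-m p∣a+1) ⟩
      0# ∎
      where
      lemma : ∀ a i k → a ℤ.* k ℤ.- (a ℤ.+ 1ℤ) ℤ.* i ≡ ℤ.- (a ℤ.+ 1ℤ) ℤ.* i ℤ.- (ℤ.- (a ℤ.+ 1ℤ) ℤ.+ 1ℤ) ℤ.* k
      lemma = solve-∀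

    Det-entry : ∀ x a t → let n = suc (t ℕ.+ t) in
      Det (Floors.entry x a n) (upTo n) (upTo n)
        ≈ fromℤ (jacobi (a ℤ.* (a ℤ.+ 1ℤ)) n) * (Q -[1+ t ] * ((1# - q⁻¹) ^ (t ℕ.+ t) * (1# + q * x)))
    Det-entry x a t = by-cases (any? (λ p → + p ∣? b) ps)
      where
      n = suc (t ℕ.+ t)
      b = a ℤ.* (a ℤ.+ 1ℤ)
      ps = factors (factorise n)
      open PrimeFactorisation (factorise n) using (isFactorisation; factorsPrime)
      value = Q -[1+ t ] * ((1# - q⁻¹) ^ (t ℕ.+ t) * (1# + q * x))
      Goal = Det (Floors.entry x a n) (upTo n) (upTo n) ≈ fromℤ (jacobi b n) * value

      degenerate : Any (λ p → + p ∣ b) ps → ∃[ p ] p ∈ ps Product.× + p ∣ b → Goal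
      degenerate any (p , p∈ , p∣b) = trans (vanish (euclidsLemmaℤ p-prime a (a ℤ.+ 1ℤ) p∣b))
        (sym (trans (*-congʳ (reflexive (≡.cong fromℤ (legendreProduct-zero any)))) (zeroˡ value)))
        where
        p-prime = All.lookup factorsPrime p∈
        p∣n : p ℕ∣.∣ n
        p∣n = ≡.subst (p ℕ∣.∣_) (≡.sym isFactorisation) (∈⇒∣product p∈)
        p-odd : p ℕ∣.∣ n → parity p ≡ Sign.-
        p-odd (ℕ∣.divides m n≡m*p) = proj₂ (parity-* m p (≡.trans (≡.cong parity (≡.sym n≡m*p)) (parity-double t)))
        3≤p = oddPrime≥3 p-prime (p-odd p∣n)
        vanish : + p ∣ a ⊎ + p ∣ a ℤ.+ 1ℤ → Det (Floors.entry x a n) (upTo n) (upTo n) ≈ 0#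
        vanish (inj₁ p∣a)   = Det-degenerate x a 3≤p p∣n p∣a
        vanish (inj₂ p∣a+1) = Det-degenerate-+1 x a 3≤p p∣n p∣a+1

      coprime : All (λ p → ¬ + p ∣ b) ps → Goal
      coprime ps∤b = evaluate (permutation ps∤a) (permutation ps∤a+1) (permutation ps∤b)
        where
        ps∤a : All (λ p → ¬ + p ∣ a) ps
        ps∤a = All.map (λ p∤b p∣a → p∤b (∣m⇒∣m*n (a ℤ.+ 1ℤ) p∣a)) ps∤b
        ps∤a+1 : All (λ p → ¬ + p ∣ a ℤ.+ 1ℤ) ps
        ps∤a+1 = All.map (λ p∤b p∣a+1 → p∤b (∣n⇒∣m*n a p∣a+1)) ps∤b
        cancellative : ∀ {c} → All (λ p → ¬ + p ∣ c) ps → Cancellative n c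
        cancellative {c} ps∤c = ≡.subst (λ k → Cancellative k c) (≡.sym isFactorisation) (product-cancellative ps factorsPrime ps∤c)
        permutation : ∀ {c} → All (λ p → ¬ + p ∣ c) ps →
          ∃[ s ] foldr ℤ._*_ 1ℤ (map (legendre c) ps) ≡ s ◃ 1 Product.× upTo n ↭[ s ] map (mulMod c n) (upTo n)
        permutation ps∤c = jacobi-zolotarev ps isFactorisation factorsPrime ps∤c (parity-double t)
        evaluate :
          ∃[ s ] foldr ℤ._*_ 1ℤ (map (legendre a) ps) ≡ s ◃ 1 Product.× upTo n ↭[ s ] map (mulMod a n) (upTo n) →
          ∃[ s ] foldr ℤ._*_ 1ℤ (map (legendre (a ℤ.+ 1ℤ)) ps) ≡ s ◃ 1 Product.× upTo n ↭[ s ] map (mulMod (a ℤ.+ 1ℤ) n) (upTo n) →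
          ∃[ s ] foldr ℤ._*_ 1ℤ (map (legendre b) ps) ≡ s ◃ 1 Product.× upTo n ↭[ s ] map (mulMod b n) (upTo n) → Goal
        evaluate (_ , _ , π₁) (_ , _ , π₂) (s , eq , π₃) = trans
          (Det-coprime x a t (cancellative ps∤a) (cancellative ps∤a+1) π₁ π₂ π₃)
          (*-congʳ (sym (trans (reflexive (≡.cong fromℤ eq)) (fromℤ-◃ s))))

      by-cases : Dec (Any (λ p → + p ∣ b) ps) → Goal
      by-cases (yes any) = degenerate any (find any)
      by-cases (no ¬any) = coprime (All.¬Any⇒All¬ ps ¬any)

-- From the list determinant to the two identities

tabulate-toℕ : ∀ (f : ℕ → A) n → tabulate (f ∘ toℕ {n}) ≡ applyUpTo f n
tabulate-toℕ f zero    = ≡.refl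
tabulate-toℕ f (suc n) = ≡.cong (f 0 ∷_) (tabulate-toℕ (f ∘ suc) n)

-- Unnormalised fractions keep their numerator and denominator, so once `n` is a successor `floor`
-- reduces to integer division of `z` by `n`.
floor-/ : ∀ z n .{{_ : NonZero n}} → floor (z ℚᵘ./ n) ≡ z /ℕ n
floor-/ z (suc n) = ℤ.div-pos-is-/ℕ z (suc n)

ceiling-/ : ∀ z n .{{_ : NonZero n}} → ceiling (z ℚᵘ./ n) ≡ ℤ.- ((ℤ.- z) /ℕ n)
ceiling-/ z (suc n) = ≡.cong ℤ.-_ (ℤ.div-pos-is-/ℕ (ℤ.- z) (suc n))

exact-/2 : ∀ {z c} → z ≡ c ℤ.* + 2 → z ℤ./ + 2 ≡ c
exact-/2 {z} {c} z≡2c = ≡.trans (ℤ.div-pos-is-/ℕ z 2) (/ℕ-unique 2 z {0} {c} ℕ.z<s (≡.trans z≡2c (≡.sym (ℤ.+-identityˡ (c ℤ.* + 2)))))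

module Identities {c ℓ} (R : CommutativeRing c ℓ) where

  open CommutativeRing R hiding (zero)
  open OverRing R
  open IntegerSolver R
  open Determinant R
  open FloorMatrix R
  open Evaluation R
  open import Algebra.Properties.Semiring.Exp semiring using (^-homo-*; ^-congˡ)
  open import Algebra.Properties.CommutativeSemiring.Exp commutativeSemiring using (^-distrib-*)
  open import Relation.Binary.Reasoning.Setoid setoid

  det≈Det-upTo : ∀ n (F : ℕ → ℕ → Carrier) → det {n} (λ j k → F (toℕ j) (toℕ k)) ≈ Det F (upTo n) (upTo n)
  det≈Det-upTo n F = trans (det≈Det n F toℕ toℕ) (reflexive (≡.cong₂ (Det F) (tabulate-toℕ id n) (tabulate-toℕ id n)))

  module _ (a : ℤ) (t : ℕ) (x q q⁻¹ : Carrier) (q*q⁻¹≈1 : q * q⁻¹ ≈ 1#) where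

    private
      n : ℕ
      n = suc (t ℕ.+ t)
      J : Carrier
      J = fromℤ (jacobi (a ℤ.* (a ℤ.+ 1ℤ)) n)
      open Powers q q⁻¹ q*q⁻¹≈1

    -- Since `1 - q⁻¹ = - q⁻¹ (1 - q)` and the exponent `n - 1 = 2 t` is even, the sign disappears
    -- and `q` receives the further exponent `- 2 t`. The total `- (t + 1) - 2 t` is
    -- `(1 - 3 n) / 2`.
    powers-of-[1-q⁻¹] : Q -[1+ t ] * (1# - q⁻¹) ^ (t ℕ.+ t) ≈ Q ((1ℤ ℤ.- + 3 ℤ.* + n) ℤ./ + 2) * (1# - q) ^ (t ℕ.+ t)
    powers-of-[1-q⁻¹] = begin
      Q -[1+ t ] * (1# - q⁻¹) ^ (t ℕ.+ t)
        ≈⟨ *-congˡ (trans (^-homo-* (1# - q⁻¹) t t) (*-cong power power)) ⟩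
      Q -[1+ t ] * (((- q⁻¹) ^ t * (1# - q) ^ t) * ((- q⁻¹) ^ t * (1# - q) ^ t))
        ≈⟨ solve 3 (λ Q s y → Q :* ((s :* y) :* (s :* y)) := Q :* (s :* s) :* (y :* y)) refl (Q -[1+ t ]) ((- q⁻¹) ^ t) ((1# - q) ^ t) ⟩
      Q -[1+ t ] * ((- q⁻¹) ^ t * (- q⁻¹) ^ t) * ((1# - q) ^ t * (1# - q) ^ t)
        ≈⟨ *-cong (*-congˡ squares) (sym (^-homo-* (1# - q) t t)) ⟩
      Q -[1+ t ] * (q⁻¹ ^ t * q⁻¹ ^ t) * (1# - q) ^ (t ℕ.+ t)
        ≈⟨ *-congʳ (sym (trans (^-homo-* q⁻¹ (suc t) (t ℕ.+ t)) (*-congˡ (^-homo-* q⁻¹ t t)))) ⟩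
      Q -[1+ (t ℕ.+ (t ℕ.+ t)) ] * (1# - q) ^ (t ℕ.+ t)
        ≈⟨ *-congʳ (Q-≡ (exact-/2 {c = -[1+ (t ℕ.+ (t ℕ.+ t)) ]} (lemma (+ t)))) ⟨
      Q ((1ℤ ℤ.- + 3 ℤ.* + n) ℤ./ + 2) * (1# - q) ^ (t ℕ.+ t) ∎
      where
      power : (1# - q⁻¹) ^ t ≈ (- q⁻¹) ^ t * (1# - q) ^ t
      power = trans (^-congˡ t (begin
        1# - q⁻¹             ≈⟨ +-congʳ q*q⁻¹≈1 ⟨
        q * q⁻¹ - q⁻¹        ≈⟨ solve 2 (λ q t → q :* t :- t := :- t :* (con 1ℤ :- q)) refl q q⁻¹ ⟩
        - q⁻¹ * (1# - q)     ∎)) (^-distrib-* (- q⁻¹) (1# - q) t)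
      squares : (- q⁻¹) ^ t * (- q⁻¹) ^ t ≈ q⁻¹ ^ t * q⁻¹ ^ t
      squares = begin
        (- q⁻¹) ^ t * (- q⁻¹) ^ t   ≈⟨ ^-distrib-* (- q⁻¹) (- q⁻¹) t ⟨
        (- q⁻¹ * - q⁻¹) ^ t         ≈⟨ ^-congˡ t (solve 1 (λ t → :- t :* :- t := t :* t) refl q⁻¹) ⟩
        (q⁻¹ * q⁻¹) ^ t             ≈⟨ ^-distrib-* q⁻¹ q⁻¹ t ⟩
        q⁻¹ ^ t * q⁻¹ ^ t           ∎
      lemma : ∀ t → 1ℤ ℤ.- + 3 ℤ.* (1ℤ ℤ.+ (t ℤ.+ t)) ≡ ℤ.- (1ℤ ℤ.+ (t ℤ.+ (t ℤ.+ t))) ℤ.* + 2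
      lemma = solve-∀

    floor-identity :
      det {n} (λ j k → x + zpow q q⁻¹ (floor ((a ℤ.* + suc (toℕ j) ℤ.- (a ℤ.+ 1ℤ) ℤ.* + suc (toℕ k)) ℚᵘ./ n)))
        ≈ fromℤ (jacobi (a ℤ.* (a ℤ.+ 1ℤ)) n) * zpow q q⁻¹ ((1ℤ ℤ.- + 3 ℤ.* + n) ℤ./ + 2) * (1# - q) ^ (n ℕ.∸ 1) * (1# + q * x)
    floor-identity = begin
      det {n} (λ j k → F (toℕ j) (toℕ k))
        ≈⟨ det≈Det-upTo n F ⟩
      Det F (upTo n) (upTo n)
        ≈⟨ Det-cong (upTo n) (upTo n) (λ {i} {k} _ _ → +-congˡ (Q-≡ (floor-/ (a ℤ.* + suc i ℤ.- (a ℤ.+ 1ℤ) ℤ.* + suc k) n))) ⟩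
      Det (Floors.entry x a n) (upTo n) (upTo n)
        ≈⟨ Det-entry q q⁻¹ q*q⁻¹≈1 x a t ⟩
      J * (Q -[1+ t ] * ((1# - q⁻¹) ^ (t ℕ.+ t) * (1# + q * x)))
        ≈⟨ solve 4 (λ J Q y z → J :* (Q :* (y :* z)) := J :* (Q :* y) :* z) refl J (Q -[1+ t ]) ((1# - q⁻¹) ^ (t ℕ.+ t)) (1# + q * x) ⟩
      J * (Q -[1+ t ] * (1# - q⁻¹) ^ (t ℕ.+ t)) * (1# + q * x)
        ≈⟨ *-congʳ (trans (*-congˡ powers-of-[1-q⁻¹]) (sym (*-assoc _ _ _))) ⟩
      J * Q ((1ℤ ℤ.- + 3 ℤ.* + n) ℤ./ + 2) * (1# - q) ^ (t ℕ.+ t) * (1# + q * x) ∎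
      where
      F : ℕ → ℕ → Carrier
      F i k = x + Q (floor ((a ℤ.* + suc i ℤ.- (a ℤ.+ 1ℤ) ℤ.* + suc k) ℚᵘ./ n))

    -- The transpose of the floor matrix for q⁻¹.
    ceiling-identity :
      det {n} (λ j k → x + zpow q q⁻¹ (ceiling (((a ℤ.+ 1ℤ) ℤ.* + suc (toℕ j) ℤ.- a ℤ.* + suc (toℕ k)) ℚᵘ./ n)))
        ≈ fromℤ (jacobi (a ℤ.* (a ℤ.+ 1ℤ)) n) * zpow q q⁻¹ ((+ n ℤ.- 1ℤ) ℤ./ + 2) * (1# - q) ^ (n ℕ.∸ 1) * (x + q)
    ceiling-identity = begin
      det {n} (λ j k → F (toℕ j) (toℕ k))
        ≈⟨ det≈Det-upTo n F ⟩
      Det F (upTo n) (upTo n)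
        ≈⟨ Det-transpose F (upTo n) (upTo n) ⟩
      Det (flip F) (upTo n) (upTo n)
        ≈⟨ Det-cong (upTo n) (upTo n) (λ {i} {k} _ _ → +-congˡ (reflexive (exponent i k))) ⟩
      Det (Powers.Floors.entry q⁻¹ q q⁻¹*q≈1 x a n) (upTo n) (upTo n)
        ≈⟨ Det-entry q⁻¹ q q⁻¹*q≈1 x a t ⟩
      J * (q ^ suc t * ((1# - q) ^ (t ℕ.+ t) * (1# + q⁻¹ * x)))
        -- One of the `t + 1` factors `q` turns `1 + q⁻¹ x` into `q + x`; the remaining `q ^ t` has
        -- exponent `(n - 1) / 2`.
        ≈⟨ solve 6 (λ J q t u y x → J :* (q :* u :* (y :* (con 1ℤ :+ t :* x))) := J :* u :* y :* (q :* t :* x :+ q))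
             refl J q q⁻¹ (q ^ t) ((1# - q) ^ (t ℕ.+ t)) x ⟩
      J * q ^ t * (1# - q) ^ (t ℕ.+ t) * (q * q⁻¹ * x + q)
        ≈⟨ *-cong (*-congʳ (*-congˡ (Q-≡ (≡.sym (exact-/2 {c = + t} (lemma (+ t))))))) (+-congʳ (trans (*-congʳ q*q⁻¹≈1) (*-identityˡ x))) ⟩
      J * Q ((+ n ℤ.- 1ℤ) ℤ./ + 2) * (1# - q) ^ (t ℕ.+ t) * (x + q) ∎
      where
      q⁻¹*q≈1 : q⁻¹ * q ≈ 1#
      q⁻¹*q≈1 = trans (*-comm q⁻¹ q) q*q⁻¹≈1
      F : ℕ → ℕ → Carrier
      F j k = x + Q (ceiling (((a ℤ.+ 1ℤ) ℤ.* + suc j ℤ.- a ℤ.* + suc k) ℚᵘ./ n))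
      negate : ∀ a j k → ℤ.- ((a ℤ.+ 1ℤ) ℤ.* j ℤ.- a ℤ.* k) ≡ a ℤ.* k ℤ.- (a ℤ.+ 1ℤ) ℤ.* j
      negate = solve-∀
      exponent : ∀ i k → Q (ceiling (((a ℤ.+ 1ℤ) ℤ.* + suc k ℤ.- a ℤ.* + suc i) ℚᵘ./ n))
                           ≡ zpow q⁻¹ q ((a ℤ.* + suc i ℤ.- (a ℤ.+ 1ℤ) ℤ.* + suc k) /ℕ n)
      exponent i k = ≡.trans (≡.cong Q (ceiling-/ ((a ℤ.+ 1ℤ) ℤ.* + suc k ℤ.- a ℤ.* + suc i) n))
        (≡.trans (Q-neg ((ℤ.- ((a ℤ.+ 1ℤ) ℤ.* + suc k ℤ.- a ℤ.* + suc i)) /ℕ n))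
          (≡.cong (λ z → zpow q⁻¹ q (z /ℕ n)) (negate a (+ suc k) (+ suc i))))
      lemma : ∀ t → (1ℤ ℤ.+ (t ℤ.+ t)) ℤ.- 1ℤ ≡ t ℤ.* + 2
      lemma = solve-∀

theorem1p3 : ∀ {c ℓ} (R : CommutativeRing c ℓ) →
  let open CommutativeRing R
      open OverRing R
  in
  (a : ℤ) (n : ℕ) .{{_ : NonZero n}} → ¬ (2 ℕ∣.∣ n) →
  (x q q⁻¹ : Carrier) → q * q⁻¹ ≈ 1# →
  (det {n} (λ j k → x + zpow q q⁻¹ (floor ((a ℤ.* + suc (toℕ j) ℤ.- (a ℤ.+ 1ℤ) ℤ.* + suc (toℕ k)) ℚᵘ./ n)))
    ≈ fromℤ (jacobi (a ℤ.* (a ℤ.+ 1ℤ)) n) * zpow q q⁻¹ ((1ℤ ℤ.- + 3 ℤ.* + n) ℤ./ + 2) * (1# - q) ^ (n ∸ 1) * (1# + q * x))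
  Product.×
  (det {n} (λ j k → x + zpow q q⁻¹ (ceiling (((a ℤ.+ 1ℤ) ℤ.* + suc (toℕ j) ℤ.- a ℤ.* + suc (toℕ k)) ℚᵘ./ n)))
    ≈ fromℤ (jacobi (a ℤ.* (a ℤ.+ 1ℤ)) n) * zpow q q⁻¹ ((+ n ℤ.- 1ℤ) ℤ./ + 2) * (1# - q) ^ (n ∸ 1) * (x + q))
theorem1p3 R a n 2∤n x q q⁻¹ q*q⁻¹≈1 =
  identities (odd⇒≡ n 2∤n)
  where
  open CommutativeRing R hiding (zero)
  open OverRing R
  open Identities R
  identities : ∃[ t ] n ≡ suc (t ℕ.+ t) →
    (det {n} (λ j k → x + zpow q q⁻¹ (floor ((a ℤ.* + suc (toℕ j) ℤ.- (a ℤ.+ 1ℤ) ℤ.* + suc (toℕ k)) ℚᵘ./ n)))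
      ≈ fromℤ (jacobi (a ℤ.* (a ℤ.+ 1ℤ)) n) * zpow q q⁻¹ ((1ℤ ℤ.- + 3 ℤ.* + n) ℤ./ + 2) * (1# - q) ^ (n ∸ 1) * (1# + q * x))
    Product.×
    (det {n} (λ j k → x + zpow q q⁻¹ (ceiling (((a ℤ.+ 1ℤ) ℤ.* + suc (toℕ j) ℤ.- a ℤ.* + suc (toℕ k)) ℚᵘ./ n)))
      ≈ fromℤ (jacobi (a ℤ.* (a ℤ.+ 1ℤ)) n) * zpow q q⁻¹ ((+ n ℤ.- 1ℤ) ℤ./ + 2) * (1# - q) ^ (n ∸ 1) * (x + q))
  identities (t , ≡.refl) = floor-identity a t x q q⁻¹ q*q⁻¹≈1 , ceiling-identity a t x q q⁻¹ q*q⁻¹≈1
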